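{- Every general safe recursive function $f:\mathcal T(\mathcal C)^{k+l}\to\mathcal T(\mathcal C)$ can be computed by a constructor GRS $\mathcal G$ that is precedence terminating with argument separation and for which there is a constant $d\ge\max\big(\{\mathrm{ar}(g):g\in\mathcal F\}\cup\{|K{\restriction}r|:(K,l,r)\in\mathcal G_{\mathrm{fin}}\}\big)$ such that every rule $(K,l,r)\in\mathcal G_{\mathrm{inf}}$ satisfies: (i) $(K{\restriction}l)\cap\mathrm{nrm}$ is maximally shared; (ii) $K{\restriction}v$ is closed for every labeled $v\in\mathrm{nrm}(l)$; (iii) $\big|\{v\in\mathrm{nrm}(l):v\text{ unlabeled}\}\cup\bigcup_{v\in\mathrm{safe}(l)}V_{K\restriction v}\big|\le d$; (iv) $|K{\restriction}r|\le|K{\restriction}l|+\big|\bigcup_{v\in\mathrm{nrm}(r)}V_{K\restriction v}\big|$.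
   Context: General safe recursive functions. Fix a finite set $\mathcal C$ of constructors containing at least one constant, enumerated $c_1,\dots,c_{|\mathcal C|}$; $\mathcal T(\mathcal C)$ is the set of ground constructor terms. Functions carry a separation of arguments into normal and safe ones, written $f(x_1,\dots,x_k;y_1,\dots,y_l)$. The general safe recursive functions are the least class containing: constants $O^{k,l}_j(\vec x;\vec y)=c_j$ ($c_j$ a constant); constructors $C_j(;x_1,\dots,x_{\mathrm{ar}(c_j)})=c_j(x_1,\dots,x_{\mathrm{ar}(c_j)})$; projections $I^{k,l}_j(x_1,\dots,x_k;x_{k+1},\dots,x_{k+l})=x_j$; predecessors $P_{i,0}(;c_i)=c_i$ for constant $c_i$ and $P_{i,j}(;c_i(x_1,\dots,x_{\mathrm{ar}(c_i)}))=x_j$; conditional $C(;c_j(\vec x),y_1,\dots,y_{|\mathcal C|})=y_j$; and closed under safe composition $f(\vec x;\vec y)=h(x_{j_1},\dots,x_{j_m};g_1(\vec x;\vec y),\dots,g_n(\vec x;\vec y))$ with $\{j_1,\dots,j_m\}\subseteq\{1,\dots,k\}$, and general safe recursion $f(c_j(x_1,\dots,x_{\mathrm{ar}(c_j)}),\vec y;\vec z)=h_j(\vec x,\vec y;\vec z,f(x_1,\vec y;\vec z),\dots,f(x_{\mathrm{ar}(c_j)},\vec y;\vec z))$ for each constructor $c_j$ (for constants: $f(c_j,\vec y;\vec z)=h_j(\vec y;\vec z)$). Term graphs. $\mathcal F=\mathcal C\cup\mathcal D$ is a finite signature with arity $\mathrm{ar}$. A labeled graph: finite acyclic directed graph $(V_G,E_G)$,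 partial labeling $\mathrm{lab}_G:V_G\to\mathcal F$, successor function $\mathrm{att}_G:V_G\to V_G^*$ with $\mathrm{att}_G(v)$ of length $\mathrm{ar}(\mathrm{lab}_G(v))$ if $v$ is labeled and empty otherwise, its entries being exactly the $E_G$-successors of $v$. A term graph has a root $\rho_G$ from which all nodes are reachable; $\mathcal{TG}(\mathcal F)$, $\mathcal{TG}(\mathcal C)$ as usual. $G{\restriction}v$ is the sub-term graph rooted at $v$; $|G|=|V_G|$. Closed: all nodes labeled. Basic: $\mathrm{lab}_G(\rho_G)\in\mathcal D$ and $G{\restriction}v\in\mathcal{TG}(\mathcal C)$ for each successor $v$ of $\rho_G$. Each $G{\restriction}v$ has a term representation (unlabeled nodes as distinct variables); $G$ is maximally shared if distinct nodes have distinct term representations. Ground constructor terms are represented by closed term graphs over $\mathcal C$. Argument separation. Argument positions of each symbol are split into normal and safe; constructors have only safe positions; nodes with the same label have the same separation. $\mathrm{nrm}(v)$, $\mathrm{safe}(v)$ are the successors of $v$ at normal, resp. safe, positions. $H\sqsubset_{\mathrm{nrm}}G$ means $H=(G{\restriction}v){\restriction}u$ for some $v\in\mathrm{nrm}(\rho_G)$ and node $u$. For $G$ with $\mathrm{att}_G(\rho_G)=v_1,\dots,v_k;v_{k+1},\dots,v_{k+l}$, $G\cap\mathrm{nrm}$ is the term graph with root $\rho_G$ whose nodes are $\rho_G$, the nodes of $G{\restriction}v$ for $v\in\mathrm{nrm}(\rho_G)$, and $l$ fresh unlabeled nodes $u_1,\dots,u_l$, with $\mathrm{att}(\rho_G)=v_1,\dots,v_k;u_1,\dots,u_l$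 (if no safe successor of the root is labeled, $G\cap\mathrm{nrm}=G$). Rewriting. Homomorphisms preserve labels, successor sequences at labeled nodes and the normal/safe split. A graph rewrite rule $(K,l,r)$: labeled graph $K$, distinct nodes $l,r$, every unlabeled node of $K{\restriction}r$ in $K{\restriction}l$; constructor rule if $K{\restriction}l$ is basic. A GRS is a possibly infinite set of rules; a constructor GRS consists of constructor rules. The step $G\to_{\mathcal G}H$ via a rule $(K,l,r)$ and homomorphism $\varphi:K{\restriction}l\to G$ is the standard build/redirection/garbage-collection step replacing $G{\restriction}\varphi(l)$ by an instance of $K{\restriction}r$. $\mathcal D_{\mathrm{inf}}$: defined symbols labeling the left root of infinitely many rules; $\mathcal G_{\mathrm{inf}}$: rules whose left root label is in $\mathcal D_{\mathrm{inf}}$; $\mathcal G_{\mathrm{fin}}=\mathcal G\setminus\mathcal G_{\mathrm{inf}}$. A GRS computes $f$ if some defined symbol $\mathsf f$ with the same argument separation satisfies: for all inputs $\vec t$, every maximal rewrite sequence from the maximally shared closed basic term graph representing $\mathsf f(\vec t)$ is finite and ends in a closed term graph over $\mathcal C$ representing $f(\vec t)$. Precedence termination with argument separation. A precedence $\sqsubset$ is a well-founded strict partial order on $\mathcal F$ with constructors minimal. $H\sqsubset_{\mathrm{pt}}G$ holds if $\mathrm{lab}_H(v)\sqsubset\mathrm{lab}_G(\rho_G)$ for every labeled node $v$ of $H$ and either (1) $H=G{\restriction}u$ or $H\sqsubset_{\mathrm{pt}}G{\restriction}u$ for some successor $u$ of $\rho_G$; or (2) $\rho_H$ is labeled, $H{\restriction}v\sqsubset_{\mathrm{nrm}}G$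 for each $v\in\mathrm{nrm}(\rho_H)$, and $H{\restriction}v\sqsubset_{\mathrm{pt}}G$ for each $v\in\mathrm{safe}(\rho_H)$. A GRS is precedence terminating with argument separation if for some separation and precedence, $K{\restriction}r\sqsubset_{\mathrm{pt}}K{\restriction}l$ for every rule. -}

module Defs where

open import Level using (0ℓ)
open import Data.Nat using (ℕ; _+_; _≤_)
open import Data.Fin using (Fin; _↑ˡ_; _↑ʳ_; splitAt; _≟_)
import Data.Fin.Properties as Fin
open import Data.Fin.Induction using (spo-noetherian)
open import Data.Fin.Subset using (Subset; ∣_∣; ⁅_⁆; ⋃; _∪_)
open import Data.Vec as Vec using (Vec; []; _∷_; lookup; tabulate; toList)
open import Data.Vec.Relation.Binary.Pointwise.Inductive using (Pointwise)
open import Data.List as List using (List; []; filter)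
open import Data.List.Membership.Propositional using (_∈_)
import Data.List.Membership.DecPropositional as DecMembership
open import Data.List.Relation.Unary.All using (All)
open import Data.Maybe using (Maybe; just; nothing)
open import Data.Product using (∃; ∃-syntax; Σ-syntax; _×_; _,_)
open import Data.Sum using (_⊎_; [_,_]′)
open import Function using (_∘_; flip; _↔_)
open import Induction.WellFounded using (WellFounded; Acc; acc)
open import Relation.Binary using (Rel; IsStrictPartialOrder)
open import Relation.Binary.Construct.Closure.ReflexiveTransitive using (Star; ε; _◅_)
open import Relation.Binary.Construct.Closure.Transitive as Plus using (TransClosure; [_])
open import Relation.Binary.PropositionalEquality
  using (_≡_; _≢_; refl; sym; subst; isEquivalence; resp₂)
open import Relation.Binary.Rewriting using (IsNormalForm)
open import Relation.Nullary using (¬_; Dec; yes; no; contradiction)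
open import Relation.Nullary.Decidable using (does; map′)
open import Relation.Unary using (Pred)
open import Data.Bool using (if_then_else_)

------------------------------------------------------------------------
-- General safe recursive functions

record Constructors : Set where
  field
    count     : ℕ
    arity     : Fin count → ℕ
    someConst : ∃[ c ] arity c ≡ 0

module GeneralSafeRecursion (𝒞 : Constructors) where
  open Constructors 𝒞

  data T : Set where
    con : (c : Fin count) → Vec T (arity c) → T

  constantTerm : (c : Fin count) → arity c ≡ 0 → T
  constantTerm c isConst = con c (subst (Vec T) (sym isConst) [])

  Fun : ℕ → ℕ → Set
  Fun k l = Vec T k → Vec T l → T

  -- Functions are specified by their defining equations, so the class is
  -- closed under pointwise equality.
  --
  -- The equations usually given for predecessors only cover arguments headed
  -- by c.  To obtain total functions, a predecessor returns an argument with
  -- another head unchanged, in line with predecessor₀ (;c) = c.  Other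
  -- conventions definable by the remaining clauses give the same class,
  -- since `conditional` can select the value for the other heads.
  data GSR : ∀ {k l} → Fun k l → Set where
    constant : ∀ {k l} {f : Fun k l} c (isConst : arity c ≡ 0) →
      (∀ xs ys → f xs ys ≡ constantTerm c isConst) → GSR f

    construct : ∀ c {f : Fun 0 (arity c)} →
      (∀ ys → f [] ys ≡ con c ys) → GSR f

    projection : ∀ {k l} {f : Fun k l} (j : Fin (k + l)) →
      (∀ xs ys → f xs ys ≡ lookup (xs Vec.++ ys) j) → GSR f

    predecessor₀ : ∀ {f : Fun 0 1} c (isConst : arity c ≡ 0) →
      f [] (constantTerm c isConst ∷ []) ≡ constantTerm c isConst →
      (∀ c′ ts → c′ ≢ c → f [] (con c′ ts ∷ []) ≡ con c′ ts) → GSR f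

    predecessor : ∀ {f : Fun 0 1} c (j : Fin (arity c)) →
      (∀ ts → f [] (con c ts ∷ []) ≡ lookup ts j) →
      (∀ c′ ts → c′ ≢ c → f [] (con c′ ts ∷ []) ≡ con c′ ts) → GSR f

    conditional : ∀ {f : Fun 0 (1 + count)} →
      (∀ j ts ys → f [] (con j ts ∷ ys) ≡ lookup ys j) → GSR f

    composition : ∀ {k l m n} {f : Fun k l} {h : Fun m n} {g : Fin n → Fun k l}
      (js : Vec (Fin k) m) → GSR h → (∀ i → GSR (g i)) →
      (∀ xs ys → f xs ys ≡ h (Vec.map (lookup xs) js) (tabulate (λ i → g i xs ys))) →
      GSR f

    recursion : ∀ {k l} {f : Fun (1 + k) l}
      {h : ∀ c → Fun (arity c + k) (l + arity c)} → (∀ c → GSR (h c)) →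
      (∀ c xs ys zs → f (con c xs ∷ ys) zs
        ≡ h c (xs Vec.++ ys) (zs Vec.++ Vec.map (λ x → f (x ∷ ys) zs) xs)) →
      GSR f

------------------------------------------------------------------------
-- Signatures with argument separation.  As in the notation f(x⃗;y⃗), the
-- normal positions of a symbol precede its safe positions.

record Signature (𝒞 : Constructors) : Set₁ where
  open Constructors 𝒞
  field
    Defined : Set
    finite  : ∃[ m ] (Defined ↔ Fin m)
    normal′ : Defined → ℕ
    safe′   : Defined → ℕ

  data Symbol : Set where
    con : Fin count → Symbol
    def : Defined → Symbol

  #normal #safe ar : Symbol → ℕ
  #normal (con c) = 0
  #normal (def f) = normal′ f
  #safe (con c) = arity c
  #safe (def f) = safe′ f
  ar g = #normal g + #safe g

module TermGraphs {𝒞 : Constructors} (S : Signature 𝒞) where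
  open GeneralSafeRecursion 𝒞 using (T; con)
  open Signature S

  ----------------------------------------------------------------------
  -- Graphs

  -- What a graph stores at a node: nothing for an unlabeled node, else its
  -- label with the normal and the safe part of its successor sequence.
  data Content (V : Set) : Set where
    unlabeled : Content V
    _⟨_⨾_⟩    : (g : Symbol) → Vec V (#normal g) → Vec V (#safe g) → Content V

  module _ {V : Set} where
    label : Content V → Maybe Symbol
    label unlabeled         = nothing
    label (g ⟨ _ ⨾ _ ⟩)     = just g

    normals safes att : Content V → List V
    normals unlabeled       = []
    normals (_ ⟨ ns ⨾ _ ⟩)  = toList ns
    safes unlabeled         = []
    safes (_ ⟨ _ ⨾ ss ⟩)    = toList ss
    att c = normals c List.++ safes c

  mapContent : ∀ {V W} → (V → W) → Content V → Content W
  mapContent φ unlabeled        = unlabeled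
  mapContent φ (g ⟨ ns ⨾ ss ⟩)  = g ⟨ Vec.map φ ns ⨾ Vec.map φ ss ⟩

  -- A graph that need not be acyclic.
  PreGraph : ℕ → Set
  PreGraph n = Fin n → Content (Fin n)

  Labeled Unlabeled : ∀ {n} → PreGraph n → Fin n → Set
  Labeled   G v = ∃[ g ] label (G v) ≡ just g
  Unlabeled G v = label (G v) ≡ nothing

  unlabeled? : ∀ {n} (G : PreGraph n) v → Dec (Unlabeled G v)
  unlabeled? G v with label (G v)
  ... | nothing = yes refl
  ... | just _  = no λ ()

  Edge : ∀ {n} → PreGraph n → Rel (Fin n) 0ℓ
  Edge G u v = v ∈ att (G u)

  Reach : ∀ {n} → PreGraph n → Rel (Fin n) 0ℓ
  Reach G = Star (Edge G)

  Acyclic : ∀ {n} → PreGraph n → Set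
  Acyclic G = ∀ v → ¬ TransClosure (Edge G) v v

  record Graph : Set where
    field
      {size}   : ℕ
      content  : PreGraph size
      acyclic  : Acyclic content

  ----------------------------------------------------------------------
  -- Term graphs.  The term graph G↾v is given by the pair G, v: its nodes are
  -- the nodes u of G with Reach G v u.  The predicates below depend on these
  -- nodes only.

  Closed OverConstructors Basic : ∀ {n} → PreGraph n → Fin n → Set
  Closed G v = ∀ u → Reach G v u → Labeled G u
  OverConstructors G v = ∀ u g → Reach G v u → label (G u) ≡ just g → ∃[ c ] g ≡ con c
  Basic G v = (∃[ f ] label (G v) ≡ just (def f))
            × (∀ u → u ∈ att (G v) → OverConstructors G u)

  data Term (X : Set) : Set where
    var : X → Term X
    app : (g : Symbol) → Vec (Term X) (#normal g) → Vec (Term X) (#safe g) → Term X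

  -- Represents G v t: the term representation of G↾v is t, where unlabeled
  -- nodes serve as variables.
  data Represents {n} (G : PreGraph n) : Fin n → Term (Fin n) → Set where
    var : ∀ {v} → G v ≡ unlabeled → Represents G v (var v)
    app : ∀ {v g ns ss ts us} → G v ≡ g ⟨ ns ⨾ ss ⟩ →
          Pointwise (Represents G) ns ts → Pointwise (Represents G) ss us →
          Represents G v (app g ts us)

  MaximallyShared : ∀ {n} → PreGraph n → Fin n → Set
  MaximallyShared G ρ = ∀ u v t → Reach G ρ u → Reach G ρ v →
    Represents G u t → Represents G v t → u ≡ v

  ground  : ∀ {X} → T → Term X
  grounds : ∀ {X m} → Vec T m → Vec (Term X) m
  ground (con c ts) = app (con c) [] (grounds ts)
  grounds []        = []
  grounds (t ∷ ts)  = ground t ∷ grounds ts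

  -- G↾ρ represents f(xs;ys).
  RepresentsCall : ∀ {n k l} → PreGraph n → Fin n → Defined → Vec T k → Vec T l → Set
  RepresentsCall G ρ f xs ys = ∃[ ns ] ∃[ ss ]
      G ρ ≡ def f ⟨ ns ⨾ ss ⟩
    × Pointwise (Represents G) ns (grounds xs)
    × Pointwise (Represents G) ss (grounds ys)

  -- The graph underlying (G↾ρ) ∩ nrm, whose root is ρ ↑ˡ _: the i-th safe
  -- successor of the root is replaced by the unlabeled node n ↑ʳ i, which is
  -- fresh.  Nodes below safe successors only are no longer reachable.
  safeCount : ∀ {n} → Content (Fin n) → ℕ
  safeCount unlabeled       = 0
  safeCount (g ⟨ _ ⨾ _ ⟩)   = #safe g

  freshRoot : ∀ {n} (c : Content (Fin n)) → Content (Fin (n + safeCount c))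
  freshRoot     unlabeled      = unlabeled
  freshRoot {n} (g ⟨ ns ⨾ _ ⟩) =
    g ⟨ Vec.map (_↑ˡ #safe g) ns ⨾ tabulate (n ↑ʳ_) ⟩

  _∩nrm_ : ∀ {n} (G : PreGraph n) (ρ : Fin n) → PreGraph (n + safeCount (G ρ))
  _∩nrm_ {n} G ρ =
    [ (λ v → if does (v ≟ ρ) then freshRoot (G ρ) else mapContent (_↑ˡ _) (G v))
    , (λ _ → unlabeled) ]′ ∘ splitAt n

  module _ (G : Graph) where
    open Graph G

    reach? : ∀ u v → Dec (Reach content u v)
    reach? u v = go u (noetherian u)
      where
      open DecMembership (_≟_ {size}) using (_∈?_)
      noetherian : WellFounded (flip (TransClosure (Edge content)))
      noetherian = spo-noetherian record
        { isEquivalence = isEquivalence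
        ; irrefl        = λ { refl → acyclic _ }
        ; trans         = Plus._++_
        ; <-resp-≈      = resp₂ _
        }
      go : ∀ w → Acc (flip (TransClosure (Edge content))) w → Dec (Reach content w v)
      go w (acc rec) with w ≟ v
      ... | yes refl = yes ε
      ... | no  w≢v  = map′ (λ (_ , e , p) → e ◅ p)
                            (λ { ε → contradiction refl w≢v
                               ; (e ◅ p) → _ , e , p })
                            (Fin.any? step?)
        where
        step? : ∀ x → Dec (x ∈ att (content w) × Reach content x v)
        step? x with x ∈? att (content w)
        ... | no  ∉ = no (λ (e , _) → ∉ e)
        ... | yes e = map′ (e ,_) (λ (_ , p) → p) (go x (rec [ e ]))

    nodes : Fin size → Subset size
    nodes v = tabulate (does ∘ reach? v)

    ∣_↾_∣ : Fin size → ℕ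
    ∣_↾_∣ v = ∣ nodes v ∣

    unlabeledNodes : List (Fin size) → Subset size
    unlabeledNodes vs = ⋃ (List.map ⁅_⁆ (filter (unlabeled? content) vs))

    nodesBelow : List (Fin size) → Subset size
    nodesBelow vs = ⋃ (List.map nodes vs)

  ----------------------------------------------------------------------
  -- Rewriting

  record Rule : Set where
    field
      K         : Graph
    open Graph K public renaming (content to K₀)
    field
      l r       : Fin size
      l≢r       : l ≢ r
      variables : ∀ v → Reach K₀ r v → Unlabeled K₀ v → Reach K₀ l v

  GRS : Set₁
  GRS = Pred Rule 0ℓ

  ConstructorRule : Rule → Set
  ConstructorRule R = Basic K₀ l
    where open Rule R

  ConstructorGRS : GRS → Set
  ConstructorGRS 𝒢 = ∀ R → 𝒢 R → ConstructorRule R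

  record TermGraph : Set where
    field
      graph : Graph
      root  : Fin (Graph.size graph)
    open Graph graph public

  -- A homomorphism K↾l → G↾ρ.  Values outside K↾l are irrelevant.
  record Hom {m n} (K : PreGraph m) (l : Fin m) (G : PreGraph n) (ρ : Fin n) : Set where
    field
      map       : Fin m → Fin n
      inside    : ∀ v → Reach K l v → Reach G ρ (map v)
      preserves : ∀ {v g ns ss} → Reach K l v → K v ≡ g ⟨ ns ⨾ ss ⟩ →
                  G (map v) ≡ g ⟨ Vec.map map ns ⨾ Vec.map map ss ⟩

  -- Build: add a copy N ↑ʳ w of each node w of K, where successors in K↾l are
  -- replaced by their images under φ.  Redirection: references to φ(l),
  -- including that of the root, become references to the instance of r.
  -- Garbage collection: nodes unreachable from the new root (among them the
  -- copies of nodes of K↾l or outside K↾r) do not belong to the term graph.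
  module Contraction (R : Rule) (G : TermGraph)
    (φ : Hom (Rule.K₀ R) (Rule.l R) (TermGraph.content G) (TermGraph.root G)) where
    open Rule R
    open TermGraph G using (root) renaming (size to N; content to G₀)
    open Hom φ renaming (map to φ₀)

    instanceOf : Fin size → Fin (N + size)
    instanceOf w = if does (reach? K l w) then φ₀ w ↑ˡ size else N ↑ʳ w

    redirect : Fin (N + size) → Fin (N + size)
    redirect x = if does (x ≟ φ₀ l ↑ˡ size) then instanceOf r else x

    result : PreGraph (N + size)
    result = [ (λ v → mapContent (redirect ∘ (_↑ˡ size)) (G₀ v))
             , (λ w → mapContent (redirect ∘ instanceOf) (K₀ w)) ]′ ∘ splitAt N

    resultRoot : Fin (N + size)
    resultRoot = redirect (root ↑ˡ size)

  data Step (𝒢 : GRS) (G : TermGraph) : TermGraph → Set where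
    step : ∀ R (R∈𝒢 : 𝒢 R) φ → let open Contraction R G φ in
           (acyclic : Acyclic result) →
           Step 𝒢 G (record { graph = record { content = result ; acyclic = acyclic }
                            ; root  = resultRoot })

  -- Every maximal rewrite sequence from G is finite (G is accessible for the
  -- converse of Step 𝒢) and ends in a term graph satisfying P.
  MaximalSequencesEndIn : GRS → (TermGraph → Set) → TermGraph → Set
  MaximalSequencesEndIn 𝒢 P G =
      Acc (flip (Step 𝒢)) G
    × (∀ H → Star (Step 𝒢) G H → IsNormalForm (Step 𝒢) H → P H)

  Computes : ∀ {k l} → GRS → (Vec T k → Vec T l → T) → Set
  Computes {k} {l} 𝒢 f = Σ[ 𝖿 ∈ Defined ]
      normal′ 𝖿 ≡ k
    × safe′ 𝖿 ≡ l
    × (∀ xs ys (G : TermGraph) → let open TermGraph G in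
         MaximallyShared content root → Closed content root → Basic content root →
         RepresentsCall content root 𝖿 xs ys →
         MaximalSequencesEndIn 𝒢
           (λ H → let open TermGraph H renaming (content to H₀; root to ρ) in
              Closed H₀ ρ × OverConstructors H₀ ρ × Represents H₀ ρ (ground (f xs ys)))
           G)

  HasFinitelyManyRules : GRS → Defined → Set
  HasFinitelyManyRules 𝒢 f = ∃[ Rs ] ∀ R → 𝒢 R →
    label (Rule.K₀ R (Rule.l R)) ≡ just (def f) → R ∈ Rs

  𝒢inf 𝒢fin : GRS → Pred Rule 0ℓ
  𝒢inf 𝒢 R = 𝒢 R × ∃[ f ] label (Rule.K₀ R (Rule.l R)) ≡ just (def f)
                        × ¬ HasFinitelyManyRules 𝒢 f
  𝒢fin 𝒢 R = 𝒢 R × ¬ 𝒢inf 𝒢 R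

  rhsSize : Rule → ℕ
  rhsSize R = ∣ K ↾ r ∣
    where open Rule R

  record InfiniteRuleConditions (d : ℕ) (R : Rule) : Set where
    open Rule R
    field
      shared  : MaximallyShared (K₀ ∩nrm l) (l ↑ˡ safeCount (K₀ l))
      closed  : ∀ v → v ∈ normals (K₀ l) → Labeled K₀ v → Closed K₀ v
      bounded : ∣ unlabeledNodes K (normals (K₀ l)) ∪ nodesBelow K (safes (K₀ l)) ∣ ≤ d
      growth  : ∣ K ↾ r ∣ ≤ ∣ K ↾ l ∣ + ∣ nodesBelow K (normals (K₀ r)) ∣

  ----------------------------------------------------------------------
  -- Precedence termination with argument separation

  record IsPrecedence (_⊏_ : Rel Symbol 0ℓ) : Set where
    field
      isStrictPartialOrder : IsStrictPartialOrder _≡_ _⊏_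
      wellFounded          : WellFounded _⊏_
      constructorsMinimal  : ∀ g c → ¬ (g ⊏ con c)

  module _ {n} (K : PreGraph n) where
    -- K↾a ⊏nrm K↾b
    SubNormal : Rel (Fin n) 0ℓ
    SubNormal a b = ∃[ v ] v ∈ normals (K b) × Reach K v a

    LabelsBelow : Rel Symbol 0ℓ → Rel (Fin n) 0ℓ
    LabelsBelow _⊏_ a b = ∀ v g → Reach K a v → label (K v) ≡ just g →
      ∃[ h ] label (K b) ≡ just h × g ⊏ h

    -- K↾a ⊏pt K↾b
    data PT (_⊏_ : Rel Symbol 0ℓ) : Rel (Fin n) 0ℓ where
      sub : ∀ {a b} u → LabelsBelow _⊏_ a b → u ∈ att (K b) →
            a ≡ u ⊎ PT _⊏_ a u → PT _⊏_ a b
      arg : ∀ {a b} → LabelsBelow _⊏_ a b → Labeled K a →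
            All (λ v → SubNormal v b) (normals (K a)) →
            All (λ v → PT _⊏_ v b) (safes (K a)) → PT _⊏_ a b

  -- The separation is the one of the signature.
  PrecedenceTerminating : GRS → Set₁
  PrecedenceTerminating 𝒢 = Σ[ prec ∈ Rel Symbol 0ℓ ] IsPrecedence prec
    × (∀ R → 𝒢 R → PT (Rule.K₀ R) prec (Rule.r R) (Rule.l R))

-- The defined symbols are the positions of a derivation of f.  A symbol defined
-- by recursion gets one rule for every maximally shared closed constructor
-- graph t as recursion argument: f(t, y⃗; z⃗) is unfolded at once, into one node
-- h(x⃗, y⃗; z⃗, …) for each node of t.  All other symbols have finitely many rules.
-- During rewriting the normal arguments of all calls stay inside one maximally
-- shared constructor graph, so the rewritten graph itself provides the pattern
-- of the rule to be applied next.  A step replaces a defined node by nodes of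
-- smaller rank, hence the multiset of the ranks decreases; values are preserved
-- because every valuation of a left-hand side extends to the right-hand side.

module Submission where

open import Defs
open import Level using (0ℓ)
open import Data.Nat using (ℕ; zero; suc; _+_; _≤_; _<_; z≤n; s≤s)
import Data.Nat.Properties as ℕ
open import Data.Nat.Induction using (<-wellFounded)
open import Data.Bool using (true)
open import Data.Empty using (⊥)
open import Data.Fin as Fin using (Fin; zero; suc; _↑ˡ_; _↑ʳ_; splitAt; _≟_)
import Data.Fin.Properties as Fin
open import Data.Fin.Induction using (spo-noetherian)
open import Data.Fin.Subset as Subset using (Subset; ∣_∣; ⋃; ⁅_⁆)
import Data.Fin.Subset.Properties as Subset
open import Data.List as List using (List; []; _∷_; allFin; filter)
import Data.List.Properties as List
open import Data.List.Membership.Propositional using (_∈_; _∉_)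
open import Data.List.Membership.Propositional.Properties
  using (∈-map⁺; ∈-map⁻; ∈-++⁺ˡ; ∈-++⁺ʳ; ∈-++⁻; ∈-∃++; ∈-filter⁺; ∈-filter⁻; ∈-allFin)
open import Data.List.Relation.Unary.All as All using (All; []; _∷_)
import Data.List.Relation.Unary.All.Properties as All
open import Data.List.Relation.Unary.Any using (here; there)
open import Data.Maybe using (Maybe; just; nothing)
open import Data.Maybe.Properties using (just-injective)
open import Data.Product using (∃-syntax; Σ-syntax; _×_; _,_; proj₁; proj₂)
open import Data.Sum using (_⊎_; inj₁; inj₂; [_,_]′)
open import Data.Sum.Function.Propositional using (_⊎-↔_)
open import Data.Unit using (⊤; tt)
open import Data.Vec as Vec using (Vec; []; _∷_; lookup; tabulate; toList)
import Data.Vec.Properties as Vec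
import Data.Vec.Membership.Propositional.Properties as VecMembership
open import Data.Vec.Relation.Binary.Pointwise.Inductive using (Pointwise; []; _∷_)
open import Function using (_∘_; flip; id; const; _↔_; Inverse; mk↔ₛ′)
open import Function.Construct.Composition using (_↔-∘_)
open import Function.Construct.Identity using (↔-id)
open import Function.Construct.Symmetry using (↔-sym)
open import Induction.WellFounded using (WellFounded; Acc; acc; wf⇒asym)
open import Relation.Binary using (Rel)
import Relation.Binary.Construct.On as On
open import Relation.Binary.Construct.Closure.ReflexiveTransitive using (Star; ε; _◅_; _◅◅_)
open import Relation.Binary.Construct.Closure.Transitive as Plus
  using (TransClosure; [_]; _∷_; _∷ʳ_)
open import Relation.Binary.PropositionalEquality
  using (_≡_; _≢_; refl; sym; trans; cong; cong₂; subst; subst₂; isEquivalence; resp₂)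
open import Relation.Binary.Rewriting using (IsNormalForm)
open import Relation.Nullary using (¬_; Dec; yes; no; contradiction; does; ¬?; _×-dec_)
open import Relation.Nullary.Decidable using (dec-true)

-- Rewriting does not preserve maximal sharing: a step may create constructor nodes that duplicate
-- existing ones. The invariant therefore asks for unique contents only on a set of constructor
-- nodes fixed at the start, which no step enlarges. This set contains all normal arguments, because
-- clause (2) of the order places the normal arguments of a new node below those of the left root,
-- and constructor nodes have no normal arguments of their own. Newly created data reaches safe
-- positions only, where a rule inspects at most the head constructor. Unfolding a recursion at once
-- keeps its symbol off the right-hand side, so that the size of the subderivation can serve as
-- precedence. Reducibility is shown for innermost calls only, since a normal form with a call would
-- contain an innermost one; termination and preservation of values hold for arbitrary steps. The
-- bound on `𝒢fin` covers every rule outside `𝒢inf`. Hence each recursion symbol must really have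
-- infinitely many rules, even if all constructors are constants; unreachable pattern nodes ensure
-- this.

-- Multisets of natural numbers, as lists: an element is replaced by smaller ones.

data _⇝_ : List ℕ → List ℕ → Set where
  here  : ∀ {a bs} as → All (_< a) as → (a ∷ bs) ⇝ (as List.++ bs)
  there : ∀ {a bs cs} → bs ⇝ cs → (a ∷ bs) ⇝ (a ∷ cs)

⇝-++ : ∀ xs {ys zs} → ys ⇝ zs → (xs List.++ ys) ⇝ (xs List.++ zs)
⇝-++ []       p = p
⇝-++ (x ∷ xs) p = there (⇝-++ xs p)

-- Nested induction. Prepending `a` preserves accessibility, by induction on `a`: a step at the head
-- prepends smaller numbers one after another, and a step in the tail is absorbed by the
-- accessibility of the tail.
⇝-wellFounded : WellFounded (flip _⇝_)
⇝-wellFounded []       = acc λ ()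
⇝-wellFounded (a ∷ as) = cons (<-wellFounded a) as (⇝-wellFounded as)
  where
  Consable : ℕ → Set
  Consable a = ∀ bs → Acc (flip _⇝_) bs → Acc (flip _⇝_) (a ∷ bs)

  prepend : ∀ {as} → All Consable as →
            ∀ {bs} → Acc (flip _⇝_) bs → Acc (flip _⇝_) (as List.++ bs)
  prepend []       p = p
  prepend (q ∷ qs) p = q _ (prepend qs p)

  consable : ∀ {a} → (∀ {b} → b < a → Consable b) → Consable a
  consable smaller bs (acc rec) = acc λ where
    (here as as<a) → prepend (All.map smaller as<a) (acc rec)
    (there p)      → consable smaller _ (rec p)

  cons : ∀ {a} → Acc _<_ a → Consable a
  cons (acc rec) = consable λ b<a → cons (rec b<a)

map-cong-∈ : ∀ {A B : Set} {f g : A → B} {n} (xs : Vec A n) →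
             (∀ x → x ∈ toList xs → f x ≡ g x) → Vec.map f xs ≡ Vec.map g xs
map-cong-∈ []       f≗g = refl
map-cong-∈ (x ∷ xs) f≗g =
  cong₂ _∷_ (f≗g x (here refl)) (map-cong-∈ xs (λ y y∈ → f≗g y (there y∈)))

-- Contents of nodes, acyclicity and maximal sharing

module TermGraphProperties {𝒞 : Constructors} (S : Signature 𝒞) where
  open GeneralSafeRecursion 𝒞 using (T; con)
  open Signature S
  open TermGraphs S

  module _ {V W : Set} (f : V → W) where
    label-map : ∀ c → label (mapContent f c) ≡ label c
    label-map unlabeled       = refl
    label-map (_ ⟨ _ ⨾ _ ⟩)   = refl

    normals-map : ∀ c → normals (mapContent f c) ≡ List.map f (normals c)
    normals-map unlabeled       = refl
    normals-map (_ ⟨ ns ⨾ _ ⟩)  = Vec.toList-map f ns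

    safes-map : ∀ c → safes (mapContent f c) ≡ List.map f (safes c)
    safes-map unlabeled       = refl
    safes-map (_ ⟨ _ ⨾ ss ⟩)  = Vec.toList-map f ss

    att-map : ∀ c → att (mapContent f c) ≡ List.map f (att c)
    att-map c = trans (cong₂ List._++_ (normals-map c) (safes-map c))
                      (sym (List.map-++ f (normals c) (safes c)))

    ∈-att-map⁺ : ∀ c {v} → v ∈ att c → f v ∈ att (mapContent f c)
    ∈-att-map⁺ c v∈ = subst (_ ∈_) (sym (att-map c)) (∈-map⁺ f v∈)

    ∈-att-map⁻ : ∀ c {w} → w ∈ att (mapContent f c) → ∃[ v ] v ∈ att c × w ≡ f v
    ∈-att-map⁻ c w∈ = ∈-map⁻ f (subst (_ ∈_) (att-map c) w∈)

    ∈-normals-map⁺ : ∀ c {v} → v ∈ normals c → f v ∈ normals (mapContent f c)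
    ∈-normals-map⁺ c v∈ = subst (_ ∈_) (sym (normals-map c)) (∈-map⁺ f v∈)

    ∈-normals-map⁻ : ∀ c {w} → w ∈ normals (mapContent f c) → ∃[ v ] v ∈ normals c × w ≡ f v
    ∈-normals-map⁻ c w∈ = ∈-map⁻ f (subst (_ ∈_) (normals-map c) w∈)

  ∈-normals⇒∈-att : ∀ {V : Set} (c : Content V) {v} → v ∈ normals c → v ∈ att c
  ∈-normals⇒∈-att c = ∈-++⁺ˡ {xs = normals c}

  ∈-safes⇒∈-att : ∀ {V : Set} (c : Content V) {v} → v ∈ safes c → v ∈ att c
  ∈-safes⇒∈-att c = ∈-++⁺ʳ (normals c)

  mapContent-∘ : ∀ {U V W : Set} (g : V → W) (f : U → V) c →
                 mapContent g (mapContent f c) ≡ mapContent (g ∘ f) c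
  mapContent-∘ g f unlabeled = refl
  mapContent-∘ g f (h ⟨ ns ⨾ ss ⟩) =
    cong₂ (h ⟨_⨾_⟩) (sym (Vec.map-∘ g f ns)) (sym (Vec.map-∘ g f ss))

  mapContent-cong-∈ : ∀ {V W : Set} {f g : V → W} c →
                      (∀ v → v ∈ att c → f v ≡ g v) → mapContent f c ≡ mapContent g c
  mapContent-cong-∈ unlabeled f≗g = refl
  mapContent-cong-∈ (h ⟨ ns ⨾ ss ⟩) f≗g = cong₂ (h ⟨_⨾_⟩)
    (map-cong-∈ ns (λ v v∈ → f≗g v (∈-++⁺ˡ v∈)))
    (map-cong-∈ ss (λ v v∈ → f≗g v (∈-++⁺ʳ (toList ns) v∈)))

  mapContent-id : ∀ {V : Set} (c : Content V) → mapContent id c ≡ c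
  mapContent-id unlabeled       = refl
  mapContent-id (h ⟨ ns ⨾ ss ⟩) = cong₂ (h ⟨_⨾_⟩) (Vec.map-id ns) (Vec.map-id ss)

  wellFounded⇒acyclic : ∀ {n} {G : PreGraph n} → WellFounded (flip (Edge G)) → Acyclic G
  wellFounded⇒acyclic {G = G} wf v p = wf⇒asym (Plus.wellFounded _ wf) (reverse p) (reverse p)
    where
    reverse : ∀ {u w} → TransClosure (Edge G) u w → TransClosure (flip (Edge G)) w u
    reverse [ e ]   = [ e ]
    reverse (e ∷ p) = reverse p ∷ʳ e

  -- Finiteness enters here: the transitive closure of the edges is a strict partial order on
  -- `Fin n`. Using the closure instead of `Edge` lets later recursions jump along whole paths.
  acyclic⇒wellFounded : ∀ {n} {G : PreGraph n} → Acyclic G →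
                        WellFounded (flip (TransClosure (Edge G)))
  acyclic⇒wellFounded acyclic = spo-noetherian record
    { isEquivalence = isEquivalence
    ; irrefl        = λ { refl → acyclic _ }
    ; trans         = Plus._++_
    ; <-resp-≈      = resp₂ _
    }

  label-def : ∀ {V : Set} {c : Content V} {g} → label c ≡ just g →
              ∃[ ns ] ∃[ ss ] c ≡ (g ⟨ ns ⨾ ss ⟩)
  label-def {c = _ ⟨ ns ⨾ ss ⟩} refl = ns , ss , refl

  Reach⇒Plus : ∀ {n} {G : PreGraph n} {u v w} → Edge G u v → Reach G v w → TransClosure (Edge G) u w
  Reach⇒Plus     e ε        = [ e ]
  Reach⇒Plus {G = G} e (e′ ◅ p) = e ∷ Reach⇒Plus {G = G} e′ p

  -- Induction on the common term: corresponding successors represent equal subterms, hence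
  -- coincide, so the two contents agree. The hypothesis compares contents only, which is easier to
  -- verify than a statement about terms.
  content-injective⇒maximallyShared : ∀ {n} (G : PreGraph n) (ρ : Fin n) →
    (∀ {u v} → Reach G ρ u → Reach G ρ v → Labeled G u → G u ≡ G v → u ≡ v) →
    MaximallyShared G ρ
  content-injective⇒maximallyShared G ρ inj u v t = go
    where
    go : ∀ {u v t} → Reach G ρ u → Reach G ρ v → Represents G u t → Represents G v t → u ≡ v
    gos : ∀ {m} {us vs : Vec _ m} {ts : Vec (Term _) m} →
          (∀ x → x ∈ toList us → Reach G ρ x) → (∀ x → x ∈ toList vs → Reach G ρ x) →
          Pointwise (Represents G) us ts → Pointwise (Represents G) vs ts → us ≡ vs
    go ρ⇒u ρ⇒v (var _) (var _) = refl
    go ρ⇒u ρ⇒v (app {g = g} {ns = ns} {ss = ss} eq p q) (app {ns = ns′} {ss = ss′} eq′ p′ q′) =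
      inj ρ⇒u ρ⇒v (g , cong label eq) (trans eq (trans (cong₂ (g ⟨_⨾_⟩)
        (gos (λ x x∈ → ρ⇒u ◅◅ edge eq (∈-++⁺ˡ x∈) ◅ ε)
             (λ x x∈ → ρ⇒v ◅◅ edge eq′ (∈-++⁺ˡ x∈) ◅ ε) p p′)
        (gos (λ x x∈ → ρ⇒u ◅◅ edge eq (∈-++⁺ʳ (toList ns) x∈) ◅ ε)
             (λ x x∈ → ρ⇒v ◅◅ edge eq′ (∈-++⁺ʳ (toList ns′) x∈) ◅ ε) q q′)) (sym eq′)))
      where
      edge : ∀ {u x} {c : Content (Fin _)} → G u ≡ c → x ∈ att c → Edge G u x
      edge refl x∈ = x∈
    gos r r′ []       []         = refl
    gos r r′ (p ∷ ps) (p′ ∷ ps′) = cong₂ _∷_ (go (r _ (here refl)) (r′ _ (here refl)) p p′)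
      (gos (λ x x∈ → r x (there x∈)) (λ x x∈ → r′ x (there x∈)) ps ps′)

-- Values of nodes, ranks and the invariant of rewriting

module Evaluation {𝒞 : Constructors} (S : Signature 𝒞)
  (⟦_⟧ : ∀ f → GeneralSafeRecursion.Fun 𝒞 (Signature.normal′ S f) (Signature.safe′ S f))
  (rank : Signature.Defined S → ℕ) where
  open Constructors 𝒞
  open GeneralSafeRecursion 𝒞 using (T; con)
  open Signature S
  open TermGraphs S
  open TermGraphProperties S

  meaning : ∀ g → Vec T (#normal g) → Vec T (#safe g) → T
  meaning (con c) _ = con c
  meaning (def f)   = ⟦ f ⟧

  -- The `suc` makes constructors minimal and puts every defined symbol above all of them.
  symbolRank : Symbol → ℕ
  symbolRank (con c) = 0
  symbolRank (def f) = suc (rank f)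

  _⊏_ : Rel Symbol 0ℓ
  g ⊏ h = symbolRank g < symbolRank h

  contentRank : ∀ {V} → Content V → ℕ
  contentRank unlabeled     = 0
  contentRank (g ⟨ _ ⨾ _ ⟩) = symbolRank g

  contentRank-map : ∀ {V W} (f : V → W) c → contentRank (mapContent f c) ≡ contentRank c
  contentRank-map f unlabeled     = refl
  contentRank-map f (_ ⟨ _ ⨾ _ ⟩) = refl

  contentRank-label : ∀ {V} (c : Content V) {g} → label c ≡ just g → contentRank c ≡ symbolRank g
  contentRank-label (_ ⟨ _ ⨾ _ ⟩) refl = refl

  Sat : ∀ {V} → (V → T) → T → Content V → Set
  Sat σ t unlabeled       = ⊤
  Sat σ t (g ⟨ ns ⨾ ss ⟩) = t ≡ meaning g (Vec.map σ ns) (Vec.map σ ss)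

  Sat-map⁺ : ∀ {V W} {σ : V → T} {τ : W → T} (f : V → W) {t} c →
             (∀ v → v ∈ att c → τ (f v) ≡ σ v) → Sat σ t c → Sat τ t (mapContent f c)
  Sat-map⁺ f unlabeled τf≗σ _ = tt
  Sat-map⁺ f (g ⟨ ns ⨾ ss ⟩) τf≗σ eq = trans eq (cong₂ (meaning g)
    (trans (map-cong-∈ ns λ v v∈ → sym (τf≗σ v (∈-++⁺ˡ v∈))) (Vec.map-∘ _ f ns))
    (trans (map-cong-∈ ss λ v v∈ → sym (τf≗σ v (∈-++⁺ʳ (toList ns) v∈))) (Vec.map-∘ _ f ss)))

  Sat-map⁻ : ∀ {V W} {σ : W → T} (f : V → W) {t} c → Sat σ t (mapContent f c) → Sat (σ ∘ f) t c
  Sat-map⁻ f unlabeled _ = tt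
  Sat-map⁻ f (g ⟨ ns ⨾ ss ⟩) eq =
    trans eq (cong₂ (meaning g) (sym (Vec.map-∘ _ f ns)) (sym (Vec.map-∘ _ f ss)))

  -- The valuation of K↾l is extended, not replaced: nodes common to both sides are not copied by a
  -- step, so their values in the rewritten graph must survive. The equation between `r` and `l`
  -- accounts for the redirection.
  Sound : Rule → Set
  Sound R = ∀ (σ : Fin size → T) → (∀ w → Reach K₀ l w → Sat σ (σ w) (K₀ w)) →
    Σ[ τ ∈ (Fin size → T) ] (∀ w → Reach K₀ l w → τ w ≡ σ w)
      × (∀ w → Reach K₀ r w → Sat τ (τ w) (K₀ w)) × τ r ≡ τ l
    where open Rule R

  -- `l-top` excludes new nodes that refer to `l`; after redirection such a reference would lead
  -- back to the instance of `r`.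
  record Admissible (R : Rule) : Set where
    open Rule R
    field
      basic       : ConstructorRule R
      terminating : PT K₀ _⊏_ r l
      l-top       : ∀ w → l ∉ att (K₀ w)
      sound       : Sound R

  PT⇒LabelsBelow : ∀ {n} {K : PreGraph n} {a b} → PT K _⊏_ a b → LabelsBelow K _⊏_ a b
  PT⇒LabelsBelow (sub _ below _ _) = below
  PT⇒LabelsBelow (arg below _ _ _) = below

  OverConstructors⇒no-normals : ∀ {n} {K : PreGraph n} {b n′} →
    OverConstructors K b → n′ ∉ normals (K b)
  OverConstructors⇒no-normals {K = K} {b} over n∈ with K b in eq
  ... | g ⟨ ns ⨾ _ ⟩ with over b g ε (cong label eq)
  OverConstructors⇒no-normals over () | .(con c) ⟨ [] ⨾ _ ⟩ | c , refl

  -- In a constructor rule, the side condition of `PT` on normal arguments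
  -- cannot be discharged below the root of the left-hand side.
  module _ {n} (K : PreGraph n) {l : Fin n} (basic : Basic K l) where
    private
      Below : Fin n → Set
      Below b = b ≡ l ⊎ ∃[ u ] u ∈ att (K l) × Reach K u b

      Below⇒Reach : ∀ {b} → Below b → Reach K l b
      Below⇒Reach (inj₁ refl)        = ε
      Below⇒Reach (inj₂ (_ , e , p)) = e ◅ p

      SubNormal⇒l : ∀ {b v} → Below b → SubNormal K v b → SubNormal K v l
      SubNormal⇒l (inj₁ refl)        s = s
      SubNormal⇒l (inj₂ (u , e , p)) (_ , n∈ , _) = contradiction n∈
        (OverConstructors⇒no-normals {K = K} λ w g q → proj₂ basic u e w g (p ◅◅ q))

    -- Following the derivation of `PT` down to `w`: a `sub` that ends, or a path through a normal
    -- argument, stays inside K↾l and cannot lead to `w`. So `w` is introduced by `arg`, whose side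
    -- condition on normal arguments transfers from `b` to `l` by `SubNormal⇒l`.
    PT⇒SubNormal : ∀ {a b w v} → PT K _⊏_ a b → Below b → Reach K a w → ¬ Reach K l w →
                   v ∈ normals (K w) → SubNormal K v l
    safes-SubNormal : ∀ {as b u w v} → All (λ a → PT K _⊏_ a b) as → Below b → u ∈ as →
                      Reach K u w → ¬ Reach K l w → v ∈ normals (K w) → SubNormal K v l
    PT⇒SubNormal (sub u _ e (inj₁ refl)) b a⇒w l⇏w =
      contradiction (Below⇒Reach b ◅◅ e ◅ a⇒w) l⇏w
    PT⇒SubNormal (sub u _ e (inj₂ p)) b = PT⇒SubNormal p (inj₂ (deeper b))
      where
      deeper : Below _ → _
      deeper (inj₁ refl)         = u , e , ε
      deeper (inj₂ (v , e′ , p)) = v , e′ , p ◅◅ e ◅ ε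
    PT⇒SubNormal (arg _ _ normal _) b ε l⇏w v∈ = SubNormal⇒l b (All.lookup normal v∈)
    PT⇒SubNormal {a = a} (arg _ _ normal safe) b (e ◅ p) l⇏w v∈
      with ∈-++⁻ (normals (K a)) e
    ... | inj₂ s∈ = safes-SubNormal safe b s∈ p l⇏w v∈
    ... | inj₁ n∈ with All.lookup normal n∈
    ...   | u , u∈ , q = contradiction
      (Below⇒Reach b ◅◅ ∈-normals⇒∈-att (K _) u∈ ◅ q ◅◅ p) l⇏w
    safes-SubNormal (p ∷ _)  b (here refl) = PT⇒SubNormal p b
    safes-SubNormal (_ ∷ ps) b (there u∈)  = safes-SubNormal ps b u∈

  -- `live` contains all reachable nodes but is not cut down by garbage collection: a step then
  -- replaces one entry, whatever else becomes unreachable, and `weights` can be compared directly.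
  -- `Shared` marks the constructor graph in which all normal arguments lie; nodes outside it may
  -- duplicate its contents.
  record Invariant (G : TermGraph) (t : T) : Set₁ where
    open TermGraph G renaming (content to G₀)
    field
      live           : List (Fin size)
      root-live      : root ∈ live
      edge-live      : ∀ {u v} → u ∈ live → v ∈ att (G₀ u) → v ∈ live
      labeled        : ∀ {u} → u ∈ live → Labeled G₀ u
      value          : Fin size → T
      satisfied      : ∀ {u} → u ∈ live → Sat value (value u) (G₀ u)
      root-value     : value root ≡ t
      Shared         : Fin size → Set
      shared-con     : ∀ {u} → Shared u → ∃[ c ] label (G₀ u) ≡ just (con c)
      shared-edge    : ∀ {u v} → Shared u → v ∈ att (G₀ u) → Shared v
      shared-unique  : ∀ {u v} → Shared u → Shared v → G₀ u ≡ G₀ v → u ≡ v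
      normals-shared : ∀ {u v} → u ∈ live → v ∈ normals (G₀ u) → Shared v

    reach-live : ∀ {u v} → u ∈ live → Reach G₀ u v → v ∈ live
    reach-live u∈ ε       = u∈
    reach-live u∈ (e ◅ p) = reach-live (edge-live u∈ e) p

    weights : List ℕ
    weights = List.map (contentRank ∘ G₀) live

  module _ {m n} {K : PreGraph m} {l : Fin m} {G : PreGraph n} {ρ : Fin n} (φ : Hom K l G ρ) where
    open Hom φ

    hom-content : ∀ {v} → Reach K l v → Labeled K v → G (map v) ≡ mapContent map (K v)
    hom-content {v} p (g , eq) with label-def {c = K v} eq
    ... | ns , ss , eq′ rewrite eq′ = preserves p eq′

    edge-labeled : ∀ {u v} → Edge K u v → Labeled K u
    edge-labeled {u} e with K u
    edge-labeled () | unlabeled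
    edge-labeled e  | g ⟨ _ ⨾ _ ⟩ = g , refl

    hom-edge : ∀ {u v} → Reach K l u → Edge K u v → Edge G (map u) (map v)
    hom-edge {u} {v} p e = subst (λ c → map v ∈ att c) (sym (hom-content p (edge-labeled e)))
                         (∈-att-map⁺ map (K u) e)

    hom-reach : ∀ {u v} → Reach K l u → Reach K u v → Reach G (map u) (map v)
    hom-reach p ε       = ε
    hom-reach p (e ◅ q) = hom-edge p e ◅ hom-reach (p ◅◅ e ◅ ε) q

  -- A single step: acyclicity of the result and preservation of the invariant

  module Contracted (R : Rule) (admissible : Admissible R) (G : TermGraph)
    (φ : Hom (Rule.K₀ R) (Rule.l R) (TermGraph.content G) (TermGraph.root G)) where
    open Rule R
    open Admissible admissible
    open TermGraph G using (root) renaming (size to N; content to G₀)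
    open Hom φ renaming (map to φ₀)
    open Contraction R G φ

    f : Defined
    f = proj₁ (proj₁ basic)

    label-l : label (K₀ l) ≡ just (def f)
    label-l = proj₂ (proj₁ basic)

    content-φl : G₀ (φ₀ l) ≡ mapContent φ₀ (K₀ l)
    content-φl = hom-content φ ε (def f , label-l)

    label-φl : label (G₀ (φ₀ l)) ≡ just (def f)
    label-φl = trans (cong label content-φl) (trans (label-map φ₀ (K₀ l)) label-l)

    φ-below : ∀ {w} → Reach K₀ l w → w ≢ l → TransClosure (Edge G₀) (φ₀ l) (φ₀ w)
    φ-below ε       w≢l = contradiction refl w≢l
    φ-below (e ◅ p) _   =
      Reach⇒Plus {G = G₀} (hom-edge φ ε e) (hom-reach φ (e ◅ ε) p)

    -- A homomorphism may identify nodes, but sending a proper descendant of `l` to the root of the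
    -- redex would close a cycle.
    φ≢φl : ∀ {w} → Reach K₀ l w → w ≢ l → φ₀ w ≢ φ₀ l
    φ≢φl p w≢l eq =
      TermGraph.acyclic G (φ₀ l) (subst (TransClosure (Edge G₀) (φ₀ l)) eq (φ-below p w≢l))

    instance-inside : ∀ {w} → Reach K₀ l w → instanceOf w ≡ φ₀ w ↑ˡ size
    instance-inside {w} p with reach? K l w
    ... | yes _ = refl
    ... | no ¬p = contradiction p ¬p

    instance-outside : ∀ {w} → ¬ Reach K₀ l w → instanceOf w ≡ N ↑ʳ w
    instance-outside {w} ¬p with reach? K l w
    ... | yes p = contradiction p ¬p
    ... | no _  = refl

    old≢new : ∀ {v w} → v ↑ˡ size ≢ N ↑ʳ w
    old≢new {v} {w} eq
      with () ← trans (sym (Fin.splitAt-↑ˡ N v size))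
                      (trans (cong (splitAt N) eq) (Fin.splitAt-↑ʳ N size w))

    redirect-redex : redirect (φ₀ l ↑ˡ size) ≡ instanceOf r
    redirect-redex with φ₀ l ↑ˡ size ≟ φ₀ l ↑ˡ size
    ... | yes _ = refl
    ... | no ¬p = contradiction refl ¬p

    redirect-other : ∀ {x} → x ≢ φ₀ l ↑ˡ size → redirect x ≡ x
    redirect-other {x} x≢ with x ≟ φ₀ l ↑ˡ size
    ... | yes p = contradiction p x≢
    ... | no _  = refl

    redirect-old : ∀ {v} → v ≢ φ₀ l → redirect (v ↑ˡ size) ≡ v ↑ˡ size
    redirect-old v≢ = redirect-other (v≢ ∘ Fin.↑ˡ-injective size _ _)

    redirect-new : ∀ {w} → redirect (N ↑ʳ w) ≡ N ↑ʳ w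
    redirect-new = redirect-other (old≢new ∘ sym)

    result-old : ∀ v → result (v ↑ˡ size) ≡ mapContent (redirect ∘ (_↑ˡ size)) (G₀ v)
    result-old v rewrite Fin.splitAt-↑ˡ N v size = refl

    result-new : ∀ w → result (N ↑ʳ w) ≡ mapContent (redirect ∘ instanceOf) (K₀ w)
    result-new w rewrite Fin.splitAt-↑ʳ N size w = refl

    result-old-edge : ∀ v {y} → Edge result (v ↑ˡ size) y →
                      ∃[ u ] u ∈ att (G₀ v) × y ≡ redirect (u ↑ˡ size)
    result-old-edge v e =
      ∈-att-map⁻ _ (G₀ v) (subst (λ c → _ ∈ att c) (result-old v) e)

    result-new-edge : ∀ w {y} → Edge result (N ↑ʳ w) y →
                      ∃[ u ] u ∈ att (K₀ w) × y ≡ redirect (instanceOf u)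
    result-new-edge w e =
      ∈-att-map⁻ _ (K₀ w) (subst (λ c → _ ∈ att c) (result-new w) e)

    l⇒r-distinct : Reach K₀ l r → φ₀ r ≢ φ₀ l
    l⇒r-distinct p = φ≢φl p (l≢r ∘ sym)

    -- `step` demands this, so it is part of showing that a matching rule can be applied. Old nodes
    -- are accessible by induction in `G₀`; at the redex this passes to the instance of `r`, whose
    -- new nodes are handled by induction in `K₀` and whose old nodes lie strictly below the redex.
    result-acyclic : Acyclic result
    result-acyclic = wellFounded⇒acyclic {G = result} wellFounded
      where
      Acc′ : Fin (N + size) → Set
      Acc′ = Acc (flip (Edge result))

      G-wf : WellFounded (flip (TransClosure (Edge G₀)))
      G-wf = acyclic⇒wellFounded {G = G₀} (TermGraph.acyclic G)

      K-wf : WellFounded (flip (TransClosure (Edge K₀)))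
      K-wf = acyclic⇒wellFounded {G = K₀} (Graph.acyclic K)

      new : (∀ w → Reach K₀ l w → w ≢ l → Acc′ (redirect (φ₀ w ↑ˡ size))) →
            ∀ w → Acc (flip (TransClosure (Edge K₀))) w → Acc′ (N ↑ʳ w)
      new inner w (acc rec) = acc λ e → go (result-new-edge w e)
        where
        go : ∀ {y} → (∃[ u ] u ∈ att (K₀ w) × y ≡ redirect (instanceOf u)) → Acc′ y
        go (u , e , refl) with reach? K l u
        -- By `l-top` the successor differs from `l`, so its image is strictly below the redex.
        ... | yes p = inner u p λ { refl → l-top w e }
        ... | no _  = subst Acc′ (sym redirect-new) (new inner u (rec [ e ]))

      redirected : ∀ v → Acc (flip (TransClosure (Edge G₀))) v → Acc′ (redirect (v ↑ˡ size))
      redirected v (acc rec) with v ≟ φ₀ l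
      ... | no v≢ = subst Acc′ (sym (redirect-old v≢)) (acc λ e → go (result-old-edge v e))
        where
        go : ∀ {y} → (∃[ u ] u ∈ att (G₀ v) × y ≡ redirect (u ↑ˡ size)) → Acc′ y
        go (u , e , refl) = redirected u (rec [ e ])
      ... | yes refl = subst Acc′ (sym redirect-redex) (go (reach? K l r))
        where
        go : Dec (Reach K₀ l r) → Acc′ (instanceOf r)
        go (yes p) = subst Acc′ (trans (redirect-old (l⇒r-distinct p)) (sym (instance-inside p)))
                                (redirected (φ₀ r) (rec (φ-below p (l≢r ∘ sym))))
        go (no ¬p) = subst Acc′ (sym (instance-outside ¬p))
          (new (λ w p w≢l → redirected (φ₀ w) (rec (φ-below p w≢l))) r (K-wf r))

      wellFounded : WellFounded (flip (Edge result))
      wellFounded x with splitAt N x in eq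
      ... | inj₁ v = subst Acc′ (Fin.splitAt⁻¹-↑ˡ eq) (acc λ e → go (result-old-edge v e))
        where
        go : ∀ {y} → (∃[ u ] u ∈ att (G₀ v) × y ≡ redirect (u ↑ˡ size)) → Acc′ y
        go (u , _ , refl) = redirected u (G-wf u)
      ... | inj₂ w = subst Acc′ (Fin.splitAt⁻¹-↑ʳ eq)
        (new (λ w _ _ → redirected (φ₀ w) (G-wf _)) w (K-wf w))

    module _ {t} (inv : Invariant G t) (acyclic : Acyclic result) where
      open Invariant inv

      contractum : TermGraph
      contractum = record
        { graph = record { content = result ; acyclic = acyclic } ; root = resultRoot }

      private
        φ-live : ∀ {w} → Reach K₀ l w → φ₀ w ∈ live
        φ-live p = reach-live root-live (inside _ p)

        IsNew : Fin size → Set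
        IsNew w = Reach K₀ r w × ¬ Reach K₀ l w

        new : List (Fin size)
        new = filter (λ w → reach? K r w ×-dec ¬? (reach? K l w)) (allFin size)

        new⁺ : ∀ {w} → IsNew w → w ∈ new
        new⁺ {w} = ∈-filter⁺ _ (∈-allFin w)

        new⁻ : ∀ {w} → w ∈ new → IsNew w
        new⁻ w∈ = proj₂ (∈-filter⁻ _ {xs = allFin size} w∈)

        before after : List (Fin N)
        before = proj₁ (∈-∃++ (φ-live ε))
        after  = proj₁ (proj₂ (∈-∃++ (φ-live ε)))

        live-split : live ≡ before List.++ φ₀ l ∷ after
        live-split = proj₂ (proj₂ (∈-∃++ (φ-live ε)))

        -- The new nodes take the place of the redex in the list, so that the ranks change by a
        -- single `here`.
        live′ : List (Fin (N + size))
        live′ = List.map (_↑ˡ size) before List.++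
                List.map (N ↑ʳ_) new List.++ List.map (_↑ˡ size) after

        new-live : ∀ {w} → IsNew w → N ↑ʳ w ∈ live′
        new-live p = ∈-++⁺ʳ (List.map _ before) (∈-++⁺ˡ (∈-map⁺ (N ↑ʳ_) (new⁺ p)))

        old-live : ∀ {v} → v ∈ live → v ≢ φ₀ l → v ↑ˡ size ∈ live′
        old-live v∈ v≢ with ∈-++⁻ before (subst (_ ∈_) live-split v∈)
        ... | inj₁ p          = ∈-++⁺ˡ (∈-map⁺ (_↑ˡ size) p)
        ... | inj₂ (here v≡)  = contradiction v≡ v≢
        ... | inj₂ (there p)  =
          ∈-++⁺ʳ (List.map _ before) (∈-++⁺ʳ (List.map _ new) (∈-map⁺ (_↑ˡ size) p))

        Origin : Fin (N + size) → Set
        Origin x = (∃[ v ] v ∈ live × x ≡ v ↑ˡ size) ⊎ (∃[ w ] IsNew w × x ≡ N ↑ʳ w)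

        origin : ∀ {x} → x ∈ live′ → Origin x
        origin x∈ with ∈-++⁻ (List.map _ before) x∈
        ... | inj₁ p with ∈-map⁻ _ p
        ...   | v , v∈ , refl = inj₁ (v , subst (v ∈_) (sym live-split) (∈-++⁺ˡ v∈) , refl)
        origin x∈ | inj₂ q with ∈-++⁻ (List.map _ new) q
        ... | inj₁ p with ∈-map⁻ _ p
        ...   | w , w∈ , refl = inj₂ (w , new⁻ w∈ , refl)
        origin x∈ | inj₂ q | inj₂ p with ∈-map⁻ _ p
        ... | v , v∈ , refl =
          inj₁ (v , subst (v ∈_) (sym live-split) (∈-++⁺ʳ before (there v∈)) , refl)

        redirect-live : ∀ {v} → v ∈ live → redirect (v ↑ˡ size) ∈ live′
        redirect-live {v} v∈ with v ≟ φ₀ l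
        ... | no v≢    = subst (_∈ live′) (sym (redirect-old v≢)) (old-live v∈ v≢)
        ... | yes refl = subst (_∈ live′) (sym redirect-redex) (go (reach? K l r))
          where
          go : Dec (Reach K₀ l r) → instanceOf r ∈ live′
          go (yes p) =
            subst (_∈ live′) (sym (instance-inside p)) (old-live (φ-live p) (l⇒r-distinct p))
          go (no ¬p) = subst (_∈ live′) (sym (instance-outside ¬p)) (new-live (ε , ¬p))

        instance-live : ∀ {w} → Reach K₀ r w → redirect (instanceOf w) ∈ live′
        instance-live {w} p with reach? K l w
        ... | yes q = redirect-live (φ-live q)
        ... | no ¬q = subst (_∈ live′) (sym redirect-new) (new-live (p , ¬q))

        edge-live′ : ∀ {x y} → x ∈ live′ → Edge result x y → y ∈ live′
        edge-live′ x∈ e with origin x∈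
        ... | inj₁ (v , v∈ , refl) with result-old-edge v e
        ...   | u , u∈ , refl = redirect-live (edge-live v∈ u∈)
        edge-live′ x∈ e | inj₂ (w , (p , _) , refl) with result-new-edge w e
        ...   | u , u∈ , refl = instance-live (p ◅◅ u∈ ◅ ε)

        new-labeled : ∀ {w} → IsNew w → Labeled K₀ w
        new-labeled {w} (p , ¬q) with label (K₀ w) in eq
        ... | just g  = g , refl
        ... | nothing = contradiction (variables w p eq) ¬q

        labeled′ : ∀ {x} → x ∈ live′ → Labeled result x
        labeled′ x∈ with origin x∈
        ... | inj₁ (v , v∈ , refl) =
          proj₁ (labeled v∈) ,
          trans (cong label (result-old v)) (trans (label-map _ (G₀ v)) (proj₂ (labeled v∈)))
        ... | inj₂ (w , w-new , refl) =
          proj₁ (new-labeled w-new) ,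
          trans (cong label (result-new w)) (trans (label-map _ (K₀ w)) (proj₂ (new-labeled w-new)))

        σ-sat : ∀ w → Reach K₀ l w → Sat (value ∘ φ₀) (value (φ₀ w)) (K₀ w)
        σ-sat w p with label (K₀ w) in eq
        ... | nothing = unlabeled-sat (K₀ w) eq
          where
          unlabeled-sat : ∀ {V} {σ : V → T} {t} c → label c ≡ nothing → Sat σ t c
          unlabeled-sat unlabeled _ = tt
        ... | just g  = Sat-map⁻ φ₀ (K₀ w)
          (subst (Sat value _) (hom-content φ p (g , eq)) (satisfied (φ-live p)))

        extension = sound (value ∘ φ₀) σ-sat

        τ : Fin size → T
        τ = proj₁ extension

        τ-inside : ∀ w → Reach K₀ l w → τ w ≡ value (φ₀ w)
        τ-inside = proj₁ (proj₂ extension)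

        τ-sat : ∀ w → Reach K₀ r w → Sat τ (τ w) (K₀ w)
        τ-sat = proj₁ (proj₂ (proj₂ extension))

        τ-r : τ r ≡ τ l
        τ-r = proj₂ (proj₂ (proj₂ extension))

        value′ : Fin (N + size) → T
        value′ = [ value , τ ]′ ∘ splitAt N

        value′-old : ∀ v → value′ (v ↑ˡ size) ≡ value v
        value′-old v rewrite Fin.splitAt-↑ˡ N v size = refl

        value′-new : ∀ w → value′ (N ↑ʳ w) ≡ τ w
        value′-new w rewrite Fin.splitAt-↑ʳ N size w = refl

        value′-instance : ∀ w → value′ (instanceOf w) ≡ τ w
        value′-instance w with reach? K l w
        ... | yes p = trans (value′-old (φ₀ w)) (sym (τ-inside w p))
        ... | no _  = value′-new w

        -- Only references to the redex are moved, and their new target `r` has the value of `l` by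
        -- soundness of the rule.
        value′-redirect : ∀ x → value′ (redirect x) ≡ value′ x
        value′-redirect x with x ≟ φ₀ l ↑ˡ size
        ... | yes refl = trans (value′-instance r) (trans τ-r
                         (trans (τ-inside l ε) (sym (value′-old (φ₀ l)))))
        ... | no _     = refl

        satisfied′ : ∀ {x} → x ∈ live′ → Sat value′ (value′ x) (result x)
        satisfied′ x∈ with origin x∈
        ... | inj₁ (v , v∈ , refl) rewrite value′-old v | result-old v =
          Sat-map⁺ _ (G₀ v) (λ u _ → trans (value′-redirect _) (value′-old u)) (satisfied v∈)
        ... | inj₂ (w , (p , _) , refl) rewrite value′-new w | result-new w =
          Sat-map⁺ _ (K₀ w) (λ u _ → trans (value′-redirect _) (value′-instance u)) (τ-sat w p)

        -- Old nodes only: constructors created by the step are left out, even if they duplicate a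
        -- shared node. The redex carries a defined symbol, so redirection leaves this part
        -- untouched.
        Shared′ : Fin (N + size) → Set
        Shared′ x = ∃[ v ] Shared v × x ≡ v ↑ˡ size

        shared≢φl : ∀ {v} → Shared v → v ≢ φ₀ l
        shared≢φl s refl with shared-con s
        ... | c , eq with () ← trans (sym label-φl) eq

        redirect-shared : ∀ {v} → Shared v → redirect (v ↑ˡ size) ≡ v ↑ˡ size
        redirect-shared s = redirect-old (shared≢φl s)

        shared-con′ : ∀ {x} → Shared′ x → ∃[ c ] label (result x) ≡ just (con c)
        shared-con′ (v , s , refl) = proj₁ (shared-con s) ,
          trans (cong label (result-old v)) (trans (label-map _ (G₀ v)) (proj₂ (shared-con s)))

        shared-edge′ : ∀ {x y} → Shared′ x → Edge result x y → Shared′ y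
        shared-edge′ (v , s , refl) e with result-old-edge v e
        ... | u , u∈ , refl = u , shared-edge s u∈ , redirect-shared (shared-edge s u∈)

        -- Left inverse of the embedding of old nodes, by which contents are compared in the old
        -- graph; `φ₀ l` is an arbitrary default.
        forget : Fin (N + size) → Fin N
        forget = [ id , const (φ₀ l) ]′ ∘ splitAt N

        forget-shared : ∀ {v} → Shared v →
                        mapContent forget (result (v ↑ˡ size)) ≡ G₀ v
        forget-shared {v} s = trans (cong (mapContent forget) (result-old v))
          (trans (mapContent-∘ forget _ (G₀ v))
          (trans (mapContent-cong-∈ (G₀ v) λ u u∈ →
                   trans (cong forget (redirect-shared (shared-edge s u∈)))
                         (cong [ id , _ ]′ (Fin.splitAt-↑ˡ N u size)))
                 (mapContent-id (G₀ v))))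

        shared-unique′ : ∀ {x y} → Shared′ x → Shared′ y → result x ≡ result y → x ≡ y
        shared-unique′ (u , s , refl) (v , s′ , refl) eq =
          cong (_↑ˡ size) (shared-unique s s′ (trans (sym (forget-shared s))
            (trans (cong (mapContent forget) eq) (forget-shared s′))))

        φ-shared : ∀ {w} → SubNormal K₀ w l → Reach K₀ l w × Shared (φ₀ w)
        φ-shared (u , u∈ , p) = u-edge ◅ p ,
          go (u-edge ◅ ε) (normals-shared (φ-live ε)
            (subst (λ c → _ ∈ normals c) (sym content-φl) (∈-normals-map⁺ φ₀ (K₀ l) u∈))) p
          where
          u-edge : Edge K₀ l u
          u-edge = ∈-normals⇒∈-att (K₀ l) u∈
          go : ∀ {u w} → Reach K₀ l u → Shared (φ₀ u) → Reach K₀ u w → Shared (φ₀ w)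
          go q s ε       = s
          go q s (e ◅ p) = go (q ◅◅ e ◅ ε) (shared-edge s (hom-edge φ q e)) p

        normals-shared′ : ∀ {x y} → x ∈ live′ → y ∈ normals (result x) → Shared′ y
        normals-shared′ {y = y} x∈ y∈ with origin x∈
        ... | inj₁ (v , v∈ , refl)
          with u , u∈ , refl ← ∈-normals-map⁻ _ (G₀ v)
            (subst (λ c → y ∈ normals c) (result-old v) y∈)
          = u , normals-shared v∈ u∈ , redirect-shared (normals-shared v∈ u∈)
        ... | inj₂ (w , (p , ¬q) , refl)
          with u , u∈ , refl ← ∈-normals-map⁻ _ (K₀ w)
            (subst (λ c → y ∈ normals c) (result-new w) y∈)
          -- Precedence termination keeps the normal arguments shared: this one lies below a normal
          -- argument of `l`, whose image is shared.
          with r , s ← φ-shared (PT⇒SubNormal K₀ basic terminating (inj₁ refl) p ¬q u∈)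
          = φ₀ u , s , trans (cong redirect (instance-inside r)) (redirect-shared s)

      preserved : Invariant contractum t
      preserved = record
        { live           = live′
        ; root-live      = redirect-live root-live
        ; edge-live      = edge-live′
        ; labeled        = labeled′
        ; value          = value′
        ; satisfied      = satisfied′
        ; root-value     = trans (value′-redirect _) (trans (value′-old root) root-value)
        ; Shared         = Shared′
        ; shared-con     = shared-con′
        ; shared-edge    = shared-edge′
        ; shared-unique  = shared-unique′
        ; normals-shared = normals-shared′
        }

      decreasing : weights ⇝ Invariant.weights preserved
      decreasing = subst₂ _⇝_ (sym old) (sym fresh)
        (⇝-++ (List.map weight before)
          (here (List.map (contentRank ∘ K₀) new) (All.map⁺ (All.tabulate smaller))))
        where
        weight : Fin N → ℕ
        weight = contentRank ∘ G₀

        old : weights ≡ List.map weight before List.++ weight (φ₀ l) ∷ List.map weight after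
        old = trans (cong (List.map weight) live-split) (List.map-++ weight before _)

        lift : ∀ vs → List.map (contentRank ∘ result) (List.map (_↑ˡ size) vs) ≡ List.map weight vs
        lift vs = trans (sym (List.map-∘ vs)) (List.map-cong
          (λ v → trans (cong contentRank (result-old v)) (contentRank-map _ (G₀ v))) vs)

        lift-new : ∀ ws → List.map (contentRank ∘ result) (List.map (N ↑ʳ_) ws) ≡
                          List.map (contentRank ∘ K₀) ws
        lift-new ws = trans (sym (List.map-∘ ws)) (List.map-cong
          (λ w → trans (cong contentRank (result-new w)) (contentRank-map _ (K₀ w))) ws)

        fresh : List.map (contentRank ∘ result) live′ ≡
                List.map weight before List.++
                List.map (contentRank ∘ K₀) new List.++ List.map weight after
        fresh = trans (List.map-++ _ (List.map _ before) _) (cong₂ List._++_ (lift before)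
               (trans (List.map-++ _ (List.map _ new) _)
               (cong₂ List._++_ (lift-new new) (lift after))))

        smaller : ∀ {w} → w ∈ new → contentRank (K₀ w) < weight (φ₀ l)
        smaller {w} w∈ with new⁻ w∈
        ... | w-new@(p , _) with new-labeled w-new
        ... | g , eq with PT⇒LabelsBelow terminating w g p eq
        ... | h , eq′ , g⊏h = subst₂ _<_ (sym (contentRank-label (K₀ w) eq))
          (sym (trans (trans (cong contentRank content-φl) (contentRank-map φ₀ (K₀ l)))
                      (contentRank-label (K₀ l) eq′))) g⊏h

  module _ (𝒢 : GRS) (admissible : ∀ R → 𝒢 R → Admissible R) where
    step-invariant : ∀ {G H t} → Step 𝒢 G H → (inv : Invariant G t) →
      Σ[ inv′ ∈ Invariant H t ] Invariant.weights inv ⇝ Invariant.weights inv′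
    step-invariant (step R R∈𝒢 φ acyclic) inv = preserved inv acyclic , decreasing inv acyclic
      where open Contracted R (admissible R R∈𝒢) _ φ

    terminates : ∀ {G t} → Invariant G t → Acc (flip (Step 𝒢)) G
    terminates inv = go inv (⇝-wellFounded (Invariant.weights inv))
      where
      go : ∀ {G t} (inv : Invariant G t) → Acc (flip _⇝_) (Invariant.weights inv) →
           Acc (flip (Step 𝒢)) G
      go inv (acc rec) = acc λ s →
        go (proj₁ (step-invariant s inv)) (rec (proj₂ (step-invariant s inv)))

    steps-invariant : ∀ {G H t} → Star (Step 𝒢) G H → Invariant G t → Invariant H t
    steps-invariant ε        inv = inv
    steps-invariant (s ◅ ss) inv = steps-invariant ss (proj₁ (step-invariant s inv))

-- Evaluation of graphs, normal forms and computed values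

collect : ∀ {A B : Set} {n} (xs : Vec A n) → (∀ x → x ∈ toList xs → B) → Vec B n
collect []       f = []
collect (x ∷ xs) f = f x (here refl) ∷ collect xs (λ y y∈ → f y (there y∈))

collect-map : ∀ {A B : Set} {n} (xs : Vec A n) {f : ∀ x → x ∈ toList xs → B} {g : A → B} →
               (∀ x x∈ → f x x∈ ≡ g x) → collect xs f ≡ Vec.map g xs
collect-map []       f≗g = refl
collect-map (x ∷ xs) f≗g =
  cong₂ _∷_ (f≗g x (here refl)) (collect-map xs (λ y y∈ → f≗g y (there y∈)))

module Computation {𝒞 : Constructors} (S : Signature 𝒞)
  (⟦_⟧ : ∀ f → GeneralSafeRecursion.Fun 𝒞 (Signature.normal′ S f) (Signature.safe′ S f))
  (rank : Signature.Defined S → ℕ) where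
  open Constructors 𝒞
  open GeneralSafeRecursion 𝒞
  open Signature S
  open TermGraphs S
  open TermGraphProperties S
  open Evaluation S ⟦_⟧ rank

  defaultTerm : T
  defaultTerm = constantTerm (proj₁ someConst) (proj₂ someConst)

  -- The function on successors receives the membership proof, from which `valueAt` obtains
  -- accessibility for its recursion. Unlabeled nodes get a default, as `Sat` constrains labeled
  -- nodes only.
  evaluate : ∀ {V} (c : Content V) → (∀ v → v ∈ att c → T) → T
  evaluate unlabeled       _ = defaultTerm
  evaluate (g ⟨ ns ⨾ ss ⟩) f = meaning g
    (collect ns λ v v∈ → f v (∈-++⁺ˡ v∈)) (collect ss λ v v∈ → f v (∈-++⁺ʳ (toList ns) v∈))

  evaluate-Sat : ∀ {V} (c : Content V) {f : ∀ v → v ∈ att c → T} {σ : V → T} →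
                 (∀ v v∈ → f v v∈ ≡ σ v) → Sat σ (evaluate c f) c
  evaluate-Sat unlabeled       _   = tt
  evaluate-Sat (g ⟨ ns ⨾ ss ⟩) f≗σ = cong₂ (meaning g)
    (collect-map ns λ v v∈ → f≗σ v (∈-++⁺ˡ v∈))
    (collect-map ss λ v v∈ → f≗σ v (∈-++⁺ʳ (toList ns) v∈))

  module _ {n} {G : PreGraph n} (acyclic : Acyclic G) where
    private
      Accessible : Fin n → Set
      Accessible = Acc (flip (TransClosure (Edge G)))

      valueAt : ∀ u → Accessible u → T
      valueAt u (acc rec) = evaluate (G u) λ v v∈ → valueAt v (rec [ v∈ ])

      evaluate-cong : ∀ {V} (c : Content V) {f g : ∀ v → v ∈ att c → T} →
                      (∀ v v∈ → f v v∈ ≡ g v v∈) → evaluate c f ≡ evaluate c g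
      evaluate-cong unlabeled       _   = refl
      evaluate-cong (h ⟨ ns ⨾ ss ⟩) f≗g = cong₂ (meaning h)
        (collect-cong ns λ v v∈ → f≗g v (∈-++⁺ˡ v∈))
        (collect-cong ss λ v v∈ → f≗g v (∈-++⁺ʳ (toList ns) v∈))
        where
        collect-cong : ∀ {V : Set} {n} (xs : Vec V n) {f g : ∀ x → x ∈ toList xs → T} →
                        (∀ x x∈ → f x x∈ ≡ g x x∈) → collect xs f ≡ collect xs g
        collect-cong []       f≗g = refl
        collect-cong (x ∷ xs) f≗g =
          cong₂ _∷_ (f≗g x (here refl)) (collect-cong xs (λ y y∈ → f≗g y (there y∈)))

      -- Identifies the value computed inside the recursion with that of `valuation`, which starts
      -- from another accessibility proof.
      valueAt-irrelevant : ∀ u (a b : Accessible u) → valueAt u a ≡ valueAt u b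
      valueAt-irrelevant u (acc rec) (acc rec′) =
        evaluate-cong (G u) λ v v∈ → valueAt-irrelevant v (rec [ v∈ ]) (rec′ [ v∈ ])

    valuation : Fin n → T
    valuation u = valueAt u (acyclic⇒wellFounded {G = G} acyclic u)

    valuation-Sat : ∀ u → Sat valuation (valuation u) (G u)
    valuation-Sat u = go (acyclic⇒wellFounded {G = G} acyclic u)
      where
      go : (a : Accessible u) → Sat valuation (valueAt u a) (G u)
      go (acc rec) = evaluate-Sat (G u) λ v v∈ → valueAt-irrelevant v (rec [ v∈ ])
        (acyclic⇒wellFounded {G = G} acyclic v)

  module _ {n} {G : PreGraph n} {σ : Fin n → T} where
    Represents⇒value : (∀ u → Sat σ (σ u) (G u)) →
                       ∀ t {u} → Represents G u (ground t) → σ u ≡ t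
    Represents⇒values : (∀ u → Sat σ (σ u) (G u)) → ∀ {m} (ts : Vec T m) {us} →
                        Pointwise (Represents G) us (grounds ts) → Vec.map σ us ≡ ts
    Represents⇒value sat (con c ts) {u} (app eq _ ps) = trans
      (subst (Sat σ (σ u)) eq (sat u)) (cong (con c) (Represents⇒values sat ts ps))
    Represents⇒values sat []       []       = refl
    Represents⇒values sat (t ∷ ts) (p ∷ ps) =
      cong₂ _∷_ (Represents⇒value sat t p) (Represents⇒values sat ts ps)

    value⇒Represents : Acyclic G → (P : Fin n → Set) →
      (∀ {u} → P u → ∃[ c ] label (G u) ≡ just (con c)) →
      (∀ {u v} → P u → v ∈ att (G u) → P v) →
      (∀ {u} → P u → Sat σ (σ u) (G u)) →
      ∀ {u} → P u → Represents G u (ground (σ u))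
    value⇒Represents acyclic P P-con P-edge P-sat {u} = go (acyclic⇒wellFounded {G = G} acyclic u)
      where
      go : ∀ {u} → Acc (flip (TransClosure (Edge G))) u → P u → Represents G u (ground (σ u))
      go {u} (acc rec) p with P-con p
      ... | c , eq with label-def {c = G u} eq
      ... | [] , ss , eq′ = subst (Represents G u ∘ ground)
          (sym (subst (Sat σ (σ u)) eq′ (P-sat p)))
          (app eq′ [] (all ss λ v∈ → go (rec [ edge v∈ ]) (P-edge p (edge v∈))))
        where
        edge : ∀ {v} → v ∈ toList ss → v ∈ att (G u)
        edge v∈ = subst (λ c → _ ∈ att c) (sym eq′) v∈
        all : ∀ {m} (vs : Vec (Fin n) m) →
              (∀ {v} → v ∈ toList vs → Represents G v (ground (σ v))) →
              Pointwise (Represents G) vs (grounds (Vec.map σ vs))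
        all []       f = []
        all (v ∷ vs) f = f (here refl) ∷ all vs (f ∘ there)

  Represents-resp : ∀ {n} {G : PreGraph n} t {u v} → G u ≡ G v →
                    Represents G u (ground t) → Represents G v (ground t)
  Represents-resp (con c ts) eq (app eq′ ps qs) = app (trans (sym eq) eq′) ps qs

  -- Initially the shared part consists of all nodes properly below the root. Closedness makes each
  -- of them represent a ground term; nodes with equal contents represent the same term, so maximal
  -- sharing identifies them.
  initial : ∀ (G : TermGraph) {f xs ys} →
    MaximallyShared (TermGraph.content G) (TermGraph.root G) →
    Closed (TermGraph.content G) (TermGraph.root G) →
    Basic (TermGraph.content G) (TermGraph.root G) →
    RepresentsCall (TermGraph.content G) (TermGraph.root G) f xs ys → Invariant G (⟦ f ⟧ xs ys)
  initial G {f} {xs} {ys} shared closed basic (ns , ss , root≡ , ps , qs) = record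
    { live           = filter (reach? graph root) (allFin size)
    ; root-live      = live⁺ ε
    ; edge-live      = λ u∈ e → live⁺ (live⁻ u∈ ◅◅ e ◅ ε)
    ; labeled        = λ u∈ → closed _ (live⁻ u∈)
    ; value          = σ
    ; satisfied      = λ _ → σ-sat _
    ; root-value     = trans (subst (Sat σ (σ root)) root≡ (σ-sat root))
                         (cong₂ ⟦ f ⟧ (Represents⇒values {G = content} σ-sat xs ps)
                                      (Represents⇒values {G = content} σ-sat ys qs))
    ; Shared         = Shared
    ; shared-con     = shared-con
    ; shared-edge    = shared-edge
    ; shared-unique  = λ {u} s s′ eq → shared _ _ _ (reached s) (reached s′)
                         (represented s) (Represents-resp {G = content} (σ u) eq (represented s))
    ; normals-shared = λ u∈ v∈ → normals-shared (live⁻ u∈) v∈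
    }
    where
    open TermGraph G

    live⁺ : ∀ {u} → Reach content root u → u ∈ filter (reach? graph root) (allFin size)
    live⁺ {u} = ∈-filter⁺ _ (∈-allFin u)

    live⁻ : ∀ {u} → u ∈ filter (reach? graph root) (allFin size) → Reach content root u
    live⁻ u∈ = proj₂ (∈-filter⁻ _ {xs = allFin size} u∈)

    σ : Fin size → T
    σ = valuation {G = content} acyclic

    σ-sat : ∀ u → Sat σ (σ u) (content u)
    σ-sat = valuation-Sat {G = content} acyclic

    Shared : Fin size → Set
    Shared u = ∃[ v ] v ∈ att (content root) × Reach content v u

    reached : ∀ {u} → Shared u → Reach content root u
    reached (_ , e , p) = e ◅ p

    shared-con : ∀ {u} → Shared u → ∃[ c ] label (content u) ≡ just (con c)
    shared-con {u} s@(v , e , p) with closed u (reached s)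
    ... | g , eq with proj₂ basic v e u g p eq
    ... | c , refl = c , eq

    shared-edge : ∀ {u v} → Shared u → v ∈ att (content u) → Shared v
    shared-edge (w , e , p) e′ = w , e , p ◅◅ e′ ◅ ε

    represented : ∀ {u} → Shared u → Represents content u (ground (σ u))
    represented =
      value⇒Represents {G = content} acyclic Shared shared-con shared-edge (λ _ → σ-sat _)

    normals-shared : ∀ {u v} → Reach content root u → v ∈ normals (content u) → Shared v
    normals-shared ε v∈ = _ , ∈-normals⇒∈-att (content root) v∈ , ε
    normals-shared {u} (e ◅ p) v∈ = contradiction v∈
      (OverConstructors⇒no-normals {K = content} λ w g q → proj₂ basic _ e w g (p ◅◅ q))

  Innermost : ∀ {n} → PreGraph n → Fin n → Set
  Innermost G u = ∀ {v w} → v ∈ att (G u) → Reach G v w → ∃[ c ] label (G w) ≡ just (con c)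

  -- Rules with a pattern apply only once the inspected arguments are constructors, so progress is
  -- asked just for calls with nothing but constructors below them.
  ReducesInnermost : GRS → Set₁
  ReducesInnermost 𝒢 = ∀ {G t f u} → Invariant G t →
    Reach (TermGraph.content G) (TermGraph.root G) u →
    label (TermGraph.content G u) ≡ just (def f) → Innermost (TermGraph.content G) u →
    ∃[ H ] Step 𝒢 G H

  IsValue : T → TermGraph → Set
  IsValue t H = Closed content root × OverConstructors content root
              × Represents content root (ground t)
    where open TermGraph H

  module _ (𝒢 : GRS) (admissible : ∀ R → 𝒢 R → Admissible R)
    (progress : ReducesInnermost 𝒢) where

    -- Induction from below: once everything under a call is a constructor, the call is innermost
    -- and a step exists.
    normalForm-con : ∀ H {t} → Invariant H t → IsNormalForm (Step 𝒢) H → ∀ {u} →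
      Reach (TermGraph.content H) (TermGraph.root H) u →
      ∃[ c ] label (TermGraph.content H u) ≡ just (con c)
    normalForm-con H inv normal {u} = go (acyclic⇒wellFounded {G = content} acyclic u)
      where
      open TermGraph H
      go : ∀ {u} → Acc (flip (TransClosure (Edge content))) u → Reach content root u →
           ∃[ c ] label (content u) ≡ just (con c)
      open Invariant inv using (labeled; reach-live; root-live)
      go (acc rec) p with labeled (reach-live root-live p)
      ... | con c , eq = c , eq
      ... | def f , eq = contradiction (progress inv p eq λ e q →
              go (rec (Reach⇒Plus {G = content} e q)) (p ◅◅ e ◅ q)) normal

    computes : ∀ f → Computes 𝒢 ⟦ f ⟧
    computes f = f , refl , refl , λ xs ys G shared closed basic call →
      terminates 𝒢 admissible (initial G shared closed basic call) , λ H G↠H normal →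
        result H (steps-invariant 𝒢 admissible G↠H (initial G shared closed basic call)) normal
      where
      result : ∀ H {t} → Invariant H t → IsNormalForm (Step 𝒢) H → IsValue t H
      result H {t} inv normal =
          (λ u p → _ , proj₂ (reach-con p))
        , (λ u g p eq → proj₁ (reach-con p) , just-injective (trans (sym eq) (proj₂ (reach-con p))))
        , subst (Represents content root ∘ ground) root-value
            (value⇒Represents {G = content} acyclic (Reach content root) reach-con
              (λ p e → p ◅◅ e ◅ ε) (λ p → satisfied (reach-live root-live p)) ε)
        where
        open TermGraph H
        open Invariant inv
        reach-con : ∀ {u} → Reach content root u → ∃[ c ] label (content u) ≡ just (con c)
        reach-con = normalForm-con H inv normal

-- Rules presented by templates

module Templates {𝒞 : Constructors} (S : Signature 𝒞)
  (⟦_⟧ : ∀ f → GeneralSafeRecursion.Fun 𝒞 (Signature.normal′ S f) (Signature.safe′ S f))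
  (rank : Signature.Defined S → ℕ) where
  open Constructors 𝒞
  open GeneralSafeRecursion 𝒞
  open Signature S
  open TermGraphs S
  open TermGraphProperties S
  open Evaluation S ⟦_⟧ rank

  -- A graph over the constructors, where `nothing` is an unlabeled node.
  Pattern : ℕ → Set
  Pattern n = Fin n → Maybe (Σ[ c ∈ Fin count ] Vec (Fin n) (arity c))

  patternContent : ∀ {V : Set} → Maybe (Σ[ c ∈ Fin count ] Vec V (arity c)) → Content V
  patternContent nothing         = unlabeled
  patternContent (just (c , vs)) = con c ⟨ [] ⨾ vs ⟩

  patternContent-label : ∀ {V : Set} (p : Maybe (Σ[ c ∈ Fin count ] Vec V (arity c))) {g} →
                         label (patternContent p) ≡ just g → ∃[ c ] g ≡ con c
  patternContent-label (just (c , _)) refl = c , refl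

  patternGraph : ∀ {n} → Pattern n → PreGraph n
  patternGraph p = patternContent ∘ p

  -- The nodes of K↾l besides l: those of its pattern, and one for each
  -- variable at a normal or a safe position of l.
  Left : (P k l : ℕ) → Set
  Left P k l = Fin P ⊎ (Fin k ⊎ Fin l)

  pattern pat x   = inj₁ x
  pattern nrm i   = inj₂ (inj₁ i)
  pattern sf i    = inj₂ (inj₂ i)
  pattern left z  = inj₁ z
  pattern right y = inj₂ y

  -- The nodes of `K` come in disjoint kinds: the left root, pattern nodes, variables and the `Q`
  -- nodes of the right-hand side. Reachability can be treated kind by kind, and soundness only has
  -- to find values for the last kind.
  record Template : Set₁ where
    field
      𝖿         : Defined
      {P k l Q} : ℕ
      shape     : Pattern P
      ns        : Vec (Left P k l) (normal′ 𝖿)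
      ss        : Vec (Left P k l) (safe′ 𝖿)
      rhs       : Fin Q → Content (Left P k l ⊎ Fin Q)
      root      : Left P k l ⊎ Fin Q
      -- contains the numbers of the nodes of K↾r outside K↾l
      Used      : Fin Q → Set

    InNormal InLeft : Fin P → Set
    InNormal x = ∃[ z ] pat z ∈ toList ns × Reach (patternGraph shape) z x
    InLeft x   = ∃[ z ] pat z ∈ toList ns List.++ toList ss × Reach (patternGraph shape) z x

    -- Restrictions under which the order can be verified: normal arguments come from the normal
    -- part of the left-hand side, safe ones are variables or new nodes. A pattern node serves as
    -- right root only if it is a safe argument as a whole or an unlabeled child of one.
    NormalArgument SafeArgument Root : Left P k l ⊎ Fin Q → Set
    NormalArgument (left (pat x))   = InNormal x
    NormalArgument (left (nrm i))   = ⊤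
    NormalArgument (left (sf i))    = ⊥
    NormalArgument (right y)        = ⊥
    SafeArgument   (left (pat x))   = ⊥
    SafeArgument   (left (inj₂ i))  = ⊤
    SafeArgument   (right y)        = Used y
    Root           (left (pat x))   =
      ∃[ z ] pat z ∈ toList ss × (x ≡ z ⊎ x ∈ att (patternGraph shape z) × shape x ≡ nothing)
    Root           (left (inj₂ i))  = ⊤
    Root           (right y)        = Used y

  record WellFormed (t : Template) : Set where
    open Template t
    field
      shape-acyclic : Acyclic (patternGraph shape)
      rhs-wf        : WellFounded (λ y′ y → right y′ ∈ att (rhs y))
      nrm∈          : ∀ i → nrm i ∈ toList ns
      sf∈           : ∀ i → sf i ∈ toList ss
      root-ok       : Root root
      rhs-label     : ∀ {y} → Used y → ∃[ g ] label (rhs y) ≡ just g × g ⊏ def 𝖿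
      rhs-normals   : ∀ {y b} → Used y → b ∈ normals (rhs y) → NormalArgument b
      rhs-safes     : ∀ {y b} → Used y → b ∈ safes (rhs y) → SafeArgument b
      sound         : ∀ (σ : Left P k l → T) →
        (∀ x → InLeft x → Sat (σ ∘ pat) (σ (pat x)) (patternGraph shape x)) →
        Σ[ ρ ∈ (Fin Q → T) ] (∀ y → Used y → Sat [ σ , ρ ]′ (ρ y) (rhs y))
          × [ σ , ρ ]′ root ≡ ⟦ 𝖿 ⟧ (Vec.map σ ns) (Vec.map σ ss)

  module TemplateRule {t : Template} (wellFormed : WellFormed t) where
    open Template t
    open WellFormed wellFormed

    size : ℕ
    size = suc ((P + (k + l)) + Q)

    private
      code : Fin ((P + (k + l)) + Q) ↔ (Left P k l ⊎ Fin Q)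
      code = ((↔-id _ ⊎-↔ Fin.+↔⊎) ↔-∘ Fin.+↔⊎ ⊎-↔ ↔-id _) ↔-∘ Fin.+↔⊎

    abstract
      encode : Left P k l ⊎ Fin Q → Fin ((P + (k + l)) + Q)
      encode = Inverse.from code

      decode : Fin ((P + (k + l)) + Q) → Left P k l ⊎ Fin Q
      decode = Inverse.to code

      decode-encode : ∀ b → decode (encode b) ≡ b
      decode-encode = Inverse.strictlyInverseˡ code

      encode-decode : ∀ i → encode (decode i) ≡ i
      encode-decode = Inverse.strictlyInverseʳ code

    node : Left P k l ⊎ Fin Q → Fin size
    node b = suc (encode b)

    patNode : Fin P → Left P k l ⊎ Fin Q
    patNode x = left (pat x)

    -- `nothing` is the left root, which has the number `zero`.
    Node : Set
    Node = Maybe (Left P k l ⊎ Fin Q)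

    view : Fin size → Node
    view zero    = nothing
    view (suc i) = just (decode i)

    view-node : ∀ b → view (node b) ≡ just b
    view-node b = cong just (decode-encode b)

    node-view : ∀ {i b} → view i ≡ just b → i ≡ node b
    node-view {suc i} refl = cong suc (sym (encode-decode i))

    view-zero : ∀ {i} → view i ≡ nothing → i ≡ zero
    view-zero {zero} refl = refl

    body : Node → Content (Left P k l ⊎ Fin Q)
    body nothing                 = def 𝖿 ⟨ Vec.map left ns ⨾ Vec.map left ss ⟩
    body (just (left (pat x)))   = mapContent patNode (patternGraph shape x)
    body (just (left (inj₂ i)))  = unlabeled
    body (just (right y))        = rhs y

    K₀ : PreGraph size
    K₀ i = mapContent node (body (view i))

    K₀-node : ∀ b → K₀ (node b) ≡ mapContent node (body (just b))
    K₀-node b = cong (mapContent node ∘ body) (view-node b)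

    edge⁻ : ∀ i {j} → Edge K₀ i j → ∃[ b ] b ∈ att (body (view i)) × j ≡ node b
    edge⁻ i = ∈-att-map⁻ node (body (view i))

    edge⁺ : ∀ v {b} → b ∈ att (body (just v)) → Edge K₀ (node v) (node b)
    edge⁺ v e = subst (λ c → _ ∈ att c) (sym (K₀-node v)) (∈-att-map⁺ node (body (just v)) e)

    edge-zero : ∀ {z} → z ∈ toList ns List.++ toList ss → Edge K₀ zero (node (left z))
    edge-zero {z} z∈ = ∈-att-map⁺ node (body nothing) (subst (left z ∈_)
      (trans (List.map-++ left (toList ns) _)
             (sym (cong₂ List._++_ (Vec.toList-map left ns) (Vec.toList-map left ss))))
      (∈-map⁺ left z∈))

    edge-zero⁻ : ∀ {b} → b ∈ att (body nothing) →
                 ∃[ z ] z ∈ toList ns List.++ toList ss × b ≡ left z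
    edge-zero⁻ b∈ = ∈-map⁻ left (subst (_ ∈_)
      (trans (cong₂ List._++_ (Vec.toList-map left ns) (Vec.toList-map left ss))
             (sym (List.map-++ left (toList ns) _))) b∈)

    edge-pat⁻ : ∀ {x b} → b ∈ att (body (just (left (pat x)))) →
                ∃[ y ] y ∈ att (patternGraph shape x) × b ≡ left (pat y)
    edge-pat⁻ {x} = ∈-att-map⁻ patNode (patternGraph shape x)

    -- Upper bounds on reachability are obtained from predicates on the kinds of nodes, which spares
    -- reasoning about their numbers.
    reach-closed : ∀ (P : Node → Set) → (∀ v {b} → P v → b ∈ att (body v) → P (just b)) →
                   ∀ {i j} → P (view i) → Reach K₀ i j → P (view j)
    reach-closed P closed p ε       = p
    reach-closed P closed {i} p (e ◅ q) with edge⁻ i e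
    ... | b , b∈ , refl =
      reach-closed P closed (subst P (sym (view-node b)) (closed (view i) p b∈)) q

    reach-pat : ∀ {x y} → Reach (patternGraph shape) x y →
                Reach K₀ (node (left (pat x))) (node (left (pat y)))
    reach-pat ε       = ε
    reach-pat (e ◅ p) =
      edge⁺ (patNode _) (∈-att-map⁺ patNode (patternGraph shape _) e) ◅ reach-pat p

    reach-pat⁻ : ∀ {x i} → Reach K₀ (node (left (pat x))) i →
                 ∃[ y ] i ≡ node (left (pat y)) × Reach (patternGraph shape) x y
    reach-pat⁻ {x} p = go (reach-closed Below closed
      (subst Below (sym (view-node _)) (x , refl , ε)) p)
      where
      Below : Node → Set
      Below v = ∃[ y ] v ≡ just (left (pat y)) × Reach (patternGraph shape) x y
      closed : ∀ v {b} → Below v → b ∈ att (body v) → Below (just b)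
      closed _ (y , refl , q) b∈ with edge-pat⁻ b∈
      ... | z , z∈ , refl = z , refl , q ◅◅ z∈ ◅ ε
      go : ∀ {i} → Below (view i) → ∃[ y ] i ≡ node (left (pat y)) × Reach (patternGraph shape) x y
      go (y , eq , q) = y , node-view eq , q

    reach-variable⁻ : ∀ {z i} → Reach K₀ (node (left (inj₂ z))) i → i ≡ node (left (inj₂ z))
    reach-variable⁻ ε = refl
    reach-variable⁻ {z} (e ◅ p) with () ← subst (λ c → _ ∈ att c) (K₀-node (left (inj₂ z))) e

    -- Upper bounds for the nodes of K↾l and K↾r. The case `nothing` of `RightNode` records that K↾r
    -- does not return to `l`.
    LeftNode RightNode : Node → Set
    LeftNode nothing                 = ⊤
    LeftNode (just (left (pat x)))   = InLeft x
    LeftNode (just (left (inj₂ i)))  = ⊤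
    LeftNode (just (right y))        = ⊥
    RightNode nothing                = ⊥
    RightNode (just (left (pat x)))  = InLeft x
    RightNode (just (left (inj₂ i))) = ⊤
    RightNode (just (right y))       = Used y

    InLeft-closed : ∀ {x y} → InLeft x → y ∈ att (patternGraph shape x) → InLeft y
    InLeft-closed (z , z∈ , p) e = z , z∈ , p ◅◅ e ◅ ε

    LeftNode-closed : ∀ v {b} → LeftNode v → b ∈ att (body v) → LeftNode (just b)
    LeftNode-closed nothing _ b∈ with edge-zero⁻ b∈
    ... | pat x  , z∈ , refl = x , z∈ , ε
    ... | inj₂ _ , z∈ , refl = tt
    LeftNode-closed (just (left (pat x))) p b∈ with edge-pat⁻ b∈
    ... | y , y∈ , refl = InLeft-closed p y∈

    NormalArgument⇒RightNode : ∀ b → NormalArgument b → RightNode (just b)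
    NormalArgument⇒RightNode (left (pat x)) (z , z∈ , p) = z , ∈-++⁺ˡ z∈ , p
    NormalArgument⇒RightNode (left (nrm i)) _            = tt

    SafeArgument⇒RightNode : ∀ b → SafeArgument b → RightNode (just b)
    SafeArgument⇒RightNode (left (inj₂ _)) _ = tt
    SafeArgument⇒RightNode (right y)       u = u

    Root⇒RightNode : ∀ b → Root b → RightNode (just b)
    Root⇒RightNode (left (pat x)) (z , z∈ , inj₁ refl) = z , ∈-++⁺ʳ (toList ns) z∈ , ε
    Root⇒RightNode (left (pat x)) (z , z∈ , inj₂ (e , _)) = z , ∈-++⁺ʳ (toList ns) z∈ , e ◅ ε
    Root⇒RightNode (left (inj₂ _)) _ = tt
    Root⇒RightNode (right y)       u = u

    RightNode-closed : ∀ v {b} → RightNode v → b ∈ att (body v) → RightNode (just b)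
    RightNode-closed (just (left (pat x))) p b∈ with edge-pat⁻ b∈
    ... | y , y∈ , refl = InLeft-closed p y∈
    RightNode-closed (just (right y)) {b} u b∈ with ∈-++⁻ (normals (rhs y)) b∈
    ... | inj₁ n∈ = NormalArgument⇒RightNode b (rhs-normals u n∈)
    ... | inj₂ s∈ = SafeArgument⇒RightNode b (rhs-safes u s∈)

    reach-left⁻ : ∀ {i} → Reach K₀ zero i → LeftNode (view i)
    reach-left⁻ = reach-closed LeftNode LeftNode-closed {i = zero} tt

    reach-left : ∀ z → LeftNode (just (left z)) → Reach K₀ zero (node (left z))
    reach-left (pat x) (y , y∈ , p) = edge-zero y∈ ◅ reach-pat p
    reach-left (nrm i) _ = edge-zero (∈-++⁺ˡ (nrm∈ i)) ◅ ε
    reach-left (sf i)  _ = edge-zero (∈-++⁺ʳ (toList ns) (sf∈ i)) ◅ ε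

    reach-right⁻ : ∀ b {i} → RightNode (just b) → Reach K₀ (node b) i → RightNode (view i)
    reach-right⁻ b p = reach-closed RightNode RightNode-closed
      (subst RightNode (sym (view-node b)) p)

    -- No edge leads to the left root or from a left node to a right one, so accessibility is
    -- established for pattern nodes and variables, then right nodes, then the root.
    K₀-acyclic : Acyclic K₀
    K₀-acyclic = wellFounded⇒acyclic {G = K₀} (λ i → all (view i) refl)
      where
      Acc′ : Fin size → Set
      Acc′ = Acc (flip (Edge K₀))

      fromBody : ∀ b → (∀ {b′} → b′ ∈ att (body (just b)) → Acc′ (node b′)) → Acc′ (node b)
      fromBody b rec = acc λ e → go (∈-att-map⁻ node (body (just b))
          (subst (λ c → _ ∈ att c) (K₀-node b) e))
        where
        go : ∀ {j} → (∃[ b′ ] b′ ∈ att (body (just b)) × j ≡ node b′) → Acc′ j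
        go (b′ , b′∈ , refl) = rec b′∈

      accPat : ∀ x → Acc (flip (TransClosure (Edge (patternGraph shape)))) x →
               Acc′ (node (left (pat x)))
      accPat x (acc rec) = fromBody (left (pat x)) λ b∈ → go (edge-pat⁻ b∈)
        where
        go : ∀ {b} → (∃[ y ] y ∈ att (patternGraph shape x) × b ≡ left (pat y)) → Acc′ (node b)
        go (y , y∈ , refl) = accPat y (rec [ y∈ ])

      accLeft : ∀ z → Acc′ (node (left z))
      accLeft (pat x)  = accPat x (acyclic⇒wellFounded {G = patternGraph shape} shape-acyclic x)
      accLeft (inj₂ i) = fromBody (left (inj₂ i)) λ ()

      accRight : ∀ y → Acc (λ y′ y → right y′ ∈ att (rhs y)) y → Acc′ (node (right y))
      accRight y (acc rec) = fromBody (right y) λ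
        { {left z}   _  → accLeft z
        ; {right y′} e → accRight y′ (rec e)
        }

      accBody : ∀ b → Acc′ (node b)
      accBody (left z)  = accLeft z
      accBody (right y) = accRight y (rhs-wf y)

      all : ∀ {i} v → view i ≡ v → Acc′ i
      all {i} (just b) eq = subst Acc′ (sym (node-view eq)) (accBody b)
      all {i} nothing  eq = acc λ e → go (edge⁻ i e)
        where
        go : ∀ {j} → (∃[ b ] b ∈ att (body (view i)) × j ≡ node b) → Acc′ j
        go (b , _ , refl) = accBody b

    RightNode-label : ∀ v {g} → RightNode v → label (body v) ≡ just g → g ⊏ def 𝖿
    RightNode-label (just (left (pat x))) _ eq
      with patternContent-label (shape x) (trans (sym (label-map _ (patternGraph shape x))) eq)
    ... | c , refl = s≤s z≤n
    RightNode-label (just (right y)) u eq with rhs-label u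
    ... | g , eq′ , g⊏ with trans (sym eq) eq′
    ... | refl = g⊏

    label-K₀ : ∀ i → label (K₀ i) ≡ label (body (view i))
    label-K₀ i = label-map node (body (view i))

    rule : Rule
    rule = record
      { K         = record { content = K₀ ; acyclic = K₀-acyclic }
      ; l         = zero
      ; r         = node root
      ; l≢r       = λ ()
      ; variables = λ i p unl → unlabeledLeft (view i) refl
          (reach-right⁻ root (Root⇒RightNode root root-ok) p) unl
      }
      where
      unlabeledLeft : ∀ {i} v → view i ≡ v → RightNode (view i) → Unlabeled K₀ i → Reach K₀ zero i
      unlabeledLeft (just (left z)) eq p unl rewrite node-view eq | view-node (left z) =
        reach-left z (leftNode z p)
        where
        leftNode : ∀ z → RightNode (just (left z)) → LeftNode (just (left z))
        leftNode (pat x)  p = p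
        leftNode (inj₂ _) _ = tt
      unlabeledLeft {i} (just (right y)) eq p unl rewrite eq
        with () ← trans (sym (proj₁ (proj₂ (rhs-label p))))
          (trans (sym (label-map node (rhs y))) unl)
      unlabeledLeft {i} nothing eq p unl rewrite eq = contradiction p λ ()

    rule-basic : ConstructorRule rule
    rule-basic = (𝖿 , refl) , λ u u∈ → below (edge⁻ zero u∈)
      where
      below : ∀ {u} → (∃[ b ] b ∈ att (body nothing) × u ≡ node b) → OverConstructors K₀ u
      below (b , b∈ , refl) i g p eq with edge-zero⁻ b∈
      ... | inj₂ z , _ , refl with refl ← reach-variable⁻ {z} p
        with () ← trans (sym eq) (cong label (K₀-node (left (inj₂ z))))
      below (b , b∈ , refl) i g p eq | pat x , _ , refl with reach-pat⁻ {x} p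
      ... | y , refl , _ = patternContent-label (shape y)
        (trans (sym (trans (cong label (K₀-node (left (pat y))))
          (trans (label-map node _) (label-map patNode (patternGraph shape y))))) eq)

    labelsBelow : ∀ b → RightNode (just b) → LabelsBelow K₀ _⊏_ (node b) zero
    labelsBelow b p i g q eq = def 𝖿 , refl ,
      RightNode-label (view i) (reach-right⁻ b p q) (trans (sym (label-K₀ i)) eq)

    -- New nodes are compared by `arg`, with recursion along `rhs-wf`; variables and pattern nodes
    -- are subgraphs of the left-hand side and are compared by `sub`.
    rule-terminating : PT K₀ _⊏_ (node root) zero
    rule-terminating = fromRoot root root-ok
      where
      fromVariable : ∀ z → PT K₀ _⊏_ (node (left (inj₂ z))) zero
      fromVariable (inj₁ i) =
        sub _ (labelsBelow (left (nrm i)) tt) (edge-zero (∈-++⁺ˡ (nrm∈ i))) (inj₁ refl)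
      fromVariable (inj₂ i) =
        sub _ (labelsBelow (left (sf i)) tt) (edge-zero (∈-++⁺ʳ (toList ns) (sf∈ i))) (inj₁ refl)

      subNormal : ∀ b → NormalArgument b → SubNormal K₀ (node b) zero
      subNormal (left (pat x)) (z , z∈ , p) = node (left (pat z)) , normal z∈ , reach-pat p
        where
        normal : ∀ {z} → z ∈ toList ns → node (left z) ∈ normals (K₀ zero)
        normal z∈ = ∈-normals-map⁺ node (body nothing)
          (subst (_ ∈_) (sym (Vec.toList-map left ns)) (∈-map⁺ left z∈))
      subNormal (left (nrm i)) _ = node (left (nrm i)) , ∈-normals-map⁺ node (body nothing)
          (subst (_ ∈_) (sym (Vec.toList-map left ns)) (∈-map⁺ left (nrm∈ i))) , ε

      fromRight : ∀ y → Acc (λ y′ y → right y′ ∈ att (rhs y)) y → Used y →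
                  PT K₀ _⊏_ (node (right y)) zero
      fromRight y (acc rec) u = arg (labelsBelow (right y) u)
        (proj₁ (rhs-label u) , trans (cong label (K₀-node (right y)))
          (trans (label-map node (rhs y)) (proj₁ (proj₂ (rhs-label u)))))
        (All.tabulate λ n∈ → normal (∈-normals-map⁻ node (rhs y)
          (subst (λ c → _ ∈ normals c) (K₀-node (right y)) n∈)))
        (All.tabulate λ s∈ → safe (∈-map⁻ node (subst (_ ∈_)
          (trans (cong safes (K₀-node (right y))) (safes-map node (rhs y))) s∈)))
        where
        normal : ∀ {i} → (∃[ b ] b ∈ normals (rhs y) × i ≡ node b) → SubNormal K₀ i zero
        normal (b , b∈ , refl) = subNormal b (rhs-normals u b∈)
        safe : ∀ {i} → (∃[ b ] b ∈ safes (rhs y) × i ≡ node b) → PT K₀ _⊏_ i zero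
        safe (left (inj₂ z) , b∈ , refl) = fromVariable z
        safe (right y′ , b∈ , refl) = fromRight y′ (rec (∈-safes⇒∈-att (rhs y) b∈)) (rhs-safes u b∈)
        safe (left (pat x) , b∈ , refl) = contradiction (rhs-safes u b∈) λ ()

      fromRoot : ∀ b → Root b → PT K₀ _⊏_ (node b) zero
      fromRoot (left (inj₂ z)) _ = fromVariable z
      fromRoot (right y)       u = fromRight y (rhs-wf y) u
      fromRoot (left (pat x)) root-ok@(z , z∈ , inj₁ refl) =
        sub _ (labelsBelow (patNode x) (Root⇒RightNode (left (pat x)) root-ok))
          (edge-zero (∈-++⁺ʳ (toList ns) z∈)) (inj₁ refl)
      -- A grandchild of `l` takes two uses of `sub`, the inner one below a constructor. As
      -- constructors are minimal, this works only because the grandchild is unlabeled.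
      fromRoot (left (pat x)) root-ok@(z , z∈ , inj₂ (e , x-unlabeled)) =
        sub _ (labelsBelow (patNode x) (Root⇒RightNode (left (pat x)) root-ok))
          (edge-zero (∈-++⁺ʳ (toList ns) z∈))
          (inj₂ (sub _ nothingBelow
            (edge⁺ (patNode z) (∈-att-map⁺ patNode (patternGraph shape z) e)) (inj₁ refl)))
        where
        x-content : K₀ (node (left (pat x))) ≡ unlabeled
        x-content = trans (K₀-node (left (pat x)))
          (cong (mapContent node ∘ mapContent (patNode) ∘ patternContent) x-unlabeled)
        nothingBelow : LabelsBelow K₀ _⊏_ (node (left (pat x))) (node (left (pat z)))
        nothingBelow _ g ε       eq with () ← trans (sym eq) (cong label x-content)
        nothingBelow _ g (e ◅ _) eq with () ← subst (λ c → _ ∈ att c) x-content e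

    rule-sound : Sound rule
    rule-sound σ σ-sat = τ , τ-left , τ-sat , τ-root
      where
      σ′ : Left P k l → T
      σ′ = σ ∘ node ∘ left

      pattern-sat : ∀ x → InLeft x → Sat (σ′ ∘ pat) (σ′ (pat x)) (patternGraph shape x)
      pattern-sat x p = Sat-map⁻ patNode (patternGraph shape x)
        (Sat-map⁻ node (body (just (left (pat x)))) (subst (Sat σ _) (K₀-node (left (pat x)))
          (σ-sat _ (reach-left (pat x) p))))

      solution = sound σ′ pattern-sat

      ρ : Fin Q → T
      ρ = proj₁ solution

      τᴺ : Node → T
      τᴺ nothing  = σ zero
      τᴺ (just b) = [ σ′ , ρ ]′ b

      τ : Fin size → T
      τ = τᴺ ∘ view

      τ-node : ∀ b → τ (node b) ≡ [ σ′ , ρ ]′ b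
      τ-node b = cong τᴺ (view-node b)

      τ-left : ∀ i → Reach K₀ zero i → τ i ≡ σ i
      τ-left i p = go (view i) refl (reach-left⁻ p)
        where
        go : ∀ {i} v → view i ≡ v → LeftNode v → τᴺ v ≡ σ i
        go nothing         eq _ = cong σ (sym (view-zero eq))
        go (just (left z)) eq _ = cong σ (sym (node-view eq))

      τ-sat : ∀ i → Reach K₀ (node root) i → Sat τ (τ i) (K₀ i)
      τ-sat i p = Sat-map⁺ node (body (view i)) (λ b _ → τ-node b)
          (go (view i) refl (reach-right⁻ root (Root⇒RightNode root root-ok) p))
        where
        go : ∀ {i} v → view i ≡ v → RightNode v → Sat [ σ′ , ρ ]′ (τᴺ v) (body v)
        go (just (left (pat x)))  eq p =
          Sat-map⁺ patNode (patternGraph shape x) (λ _ _ → refl) (pattern-sat x p)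
        go (just (left (inj₂ z))) eq _ = tt
        go (just (right y))       eq u = proj₁ (proj₂ solution) y u

      τ-root : τ (node root) ≡ τ zero
      τ-root = trans (τ-node root) (trans (proj₂ (proj₂ solution))
        (sym (trans (σ-sat zero ε) (cong₂ ⟦ 𝖿 ⟧ (twice ns) (twice ss)))))
        where
        twice : ∀ {n} (zs : Vec (Left P k l) n) →
                Vec.map σ (Vec.map node (Vec.map left zs)) ≡ Vec.map σ′ zs
        twice zs = trans (sym (Vec.map-∘ σ node _)) (sym (Vec.map-∘ (σ ∘ node) left zs))

    rule-admissible : Admissible rule
    rule-admissible = record
      { basic       = rule-basic
      ; terminating = rule-terminating
      ; l-top       = λ i e → l-top (view i) (edge⁻ i e)
      ; sound       = rule-sound
      }
      where
      l-top : ∀ v → ¬ (∃[ b ] b ∈ att (body v) × zero ≡ node b)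
      l-top _ (_ , _ , ())

    -- Unlabeled pattern nodes match anything, so conditions are imposed on the call and on labeled
    -- pattern nodes only.
    record Match (G : TermGraph) (u : Fin (TermGraph.size G)) : Set where
      open TermGraph G using () renaming (content to G₀)
      field
        μ         : Left P k l → Fin (TermGraph.size G)
        μ-redex   : G₀ u ≡ def 𝖿 ⟨ Vec.map μ ns ⨾ Vec.map μ ss ⟩
        μ-pattern : ∀ x → InLeft x → Labeled (patternGraph shape) x →
                    G₀ (μ (pat x)) ≡ mapContent (μ ∘ pat) (patternGraph shape x)

    module _ (G : TermGraph) {u : Fin (TermGraph.size G)} (match : Match G u)
      (root⇒u : Reach (TermGraph.content G) (TermGraph.root G) u) where
      open TermGraph G using () renaming (content to G₀; size to N; root to ρ)
      open Match match

      private
        μᴺ : Node → Fin N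
        μᴺ nothing          = u
        μᴺ (just (left z))  = μ z
        -- Right nodes lie outside K↾l; `u` is a mere default.
        μᴺ (just (right _)) = u

        φ : Fin size → Fin N
        φ = μᴺ ∘ view

        φ-node : ∀ b → φ (node b) ≡ μᴺ (just b)
        φ-node b = cong μᴺ (view-node b)

        φ-content : ∀ i → Reach K₀ zero i → Labeled K₀ i → G₀ (φ i) ≡ mapContent φ (K₀ i)
        φ-content i p (g , eq) = trans
          (go (view i) (reach-left⁻ p) (g , trans (sym (label-K₀ i)) eq))
          (sym (trans (mapContent-∘ φ node (body (view i)))
                      (mapContent-cong-∈ (body (view i)) λ b _ → φ-node b)))
          where
          go : ∀ v → LeftNode v → ∃[ g ] label (body v) ≡ just g →
               G₀ (μᴺ v) ≡ mapContent (μᴺ ∘ just) (body v)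
          go nothing _ _ = trans μ-redex
            (cong₂ (def 𝖿 ⟨_⨾_⟩) (Vec.map-∘ (μᴺ ∘ just) left ns) (Vec.map-∘ (μᴺ ∘ just) left ss))
          go (just (left (pat x))) p (g , eq) = trans
            (μ-pattern x p (g , trans (sym (label-map patNode (patternGraph shape x))) eq))
            (sym (mapContent-∘ (μᴺ ∘ just) patNode (patternGraph shape x)))

        inside : ∀ {i j} → Reach K₀ zero i → Reach G₀ ρ (φ i) → Reach K₀ i j → Reach G₀ ρ (φ j)
        inside p q ε                = q
        inside {i} p q (_◅_ {j = j} e r) = inside (p ◅◅ e ◅ ε) (q ◅◅ φ-edge ◅ ε) r
          where
          labeled : ∀ {V : Set} (c : Content V) {v} → v ∈ att c → ∃[ g ] label c ≡ just g
          labeled (g ⟨ _ ⨾ _ ⟩) _ = g , refl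
          φ-edge : Edge G₀ (φ i) (φ j)
          φ-edge = subst (λ c → φ j ∈ att c) (sym (φ-content i p (labeled (K₀ i) e)))
                         (∈-att-map⁺ φ (K₀ i) e)

      hom : Hom K₀ zero G₀ ρ
      hom = record
        { map       = φ
        ; inside    = λ i p → inside {i = zero} ε root⇒u p
        ; preserves = λ {i} p eq →
            trans (φ-content i p (_ , cong label eq)) (cong (mapContent φ) eq)
        }

      rule-applies : ∀ 𝒢 → 𝒢 rule → ∃[ H ] Step 𝒢 G H
      rule-applies 𝒢 rule∈𝒢 = _ , step rule rule∈𝒢 hom
        (Contracted.result-acyclic rule rule-admissible G hom)

module _ {A : Set} (P : A → Set) where
  ∈-toList-map : ∀ {B : Set} (f : B → A) {n} (xs : Vec B n) → (∀ {x} → x ∈ toList xs → P (f x)) →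
                 ∀ {y} → y ∈ toList (Vec.map f xs) → P y
  ∈-toList-map f (x ∷ xs) p (here refl) = p (here refl)
  ∈-toList-map f (x ∷ xs) p (there y∈)  = ∈-toList-map f xs (p ∘ there) y∈

  ∈-toList-tabulate : ∀ {n} (f : Fin n → A) → (∀ i → P (f i)) →
                      ∀ {y} → y ∈ toList (tabulate f) → P y
  ∈-toList-tabulate {suc n} f p (here refl) = p zero
  ∈-toList-tabulate {suc n} f p (there y∈)  = ∈-toList-tabulate (f ∘ suc) (p ∘ suc) y∈

  ∈-toList-++ : ∀ {m n} (xs : Vec A m) (ys : Vec A n) →
                (∀ {y} → y ∈ toList xs → P y) → (∀ {y} → y ∈ toList ys → P y) →
                ∀ {y} → y ∈ toList (xs Vec.++ ys) → P y
  ∈-toList-++ []       ys p q y∈          = q y∈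
  ∈-toList-++ (x ∷ xs) ys p q (here refl) = p (here refl)
  ∈-toList-++ (x ∷ xs) ys p q (there y∈)  = ∈-toList-++ xs ys (p ∘ there) q y∈

tabulate∈ : ∀ {A : Set} {n} (f : Fin n → A) i → f i ∈ toList (tabulate f)
tabulate∈ f i = VecMembership.∈-toList⁺ (VecMembership.∈-tabulate⁺ f i)

map-tabulate : ∀ {A B : Set} {n} (g : A → B) (f : Fin n → A) →
               Vec.map g (tabulate f) ≡ tabulate (g ∘ f)
map-tabulate g f = sym (Vec.tabulate-∘ g f)

-- Defined symbols, the kinds of defining equations and their rules

module System (𝒞 : Constructors)
  (Sym : ∀ {k l} → GeneralSafeRecursion.Fun 𝒞 k l → Set)
  (symRank : ∀ {k l} {f : GeneralSafeRecursion.Fun 𝒞 k l} → Sym f → ℕ) where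
  open Constructors 𝒞
  open GeneralSafeRecursion 𝒞

  -- A symbol is packed with the function it denotes, which makes `fun` the interpretation for
  -- evaluation.
  record DefinedSymbol : Set where
    constructor ⌈_⌉
    field
      {#n #s} : ℕ
      {fun}   : Fun #n #s
      sym′    : Sym fun
  open DefinedSymbol

  module Rules (finite : ∃[ m ] (DefinedSymbol ↔ Fin m)) where
    S : Signature 𝒞
    S = record { Defined = DefinedSymbol ; finite = finite ; normal′ = #n ; safe′ = #s }

    open Signature S
    open TermGraphs S
    open TermGraphProperties S
    open Evaluation S fun (λ f → symRank (sym′ f))
    open Computation S fun (λ f → symRank (sym′ f))
    open Templates S fun (λ f → symRank (sym′ f))

    -- Four kinds of equations cover all clauses: `copy` projections and predecessors of constants,
    -- `apply` constants, constructors and safe composition, `cases` the other predecessors and the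
    -- conditional. The parameter `b` is the rank of the symbol being defined and exceeds the ranks
    -- of all defined symbols called.
    data Entry (b : ℕ) : ∀ {k l} → Fun k l → Set where
      copy : ∀ {k l} {f : Fun k l} (z : Fin k ⊎ Fin l) →
        (∀ xs ys → f xs ys ≡ [ lookup xs , lookup ys ]′ z) → Entry b f
      apply : ∀ {k l n} {f : Fun k l} g → symbolRank g < suc b → (js : Vec (Fin k) (#normal g)) →
        {h : Fin n → Fun k l} (hs : ∀ i → Sym (h i)) → (∀ i → symRank (hs i) < b) →
        (as : Vec ((Fin k ⊎ Fin l) ⊎ Fin n) (#safe g)) →
        (∀ xs ys → f xs ys ≡ meaning g (Vec.map (lookup xs) js)
          (Vec.map [ [ lookup xs , lookup ys ]′ , (λ i → h i xs ys) ]′ as)) → Entry b f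
      cases : ∀ {l} {f : Fun 0 (suc l)} (target : ∀ c → ⊤ ⊎ (Fin (arity c) ⊎ Fin l)) →
        (∀ c ts ys → f [] (con c ts ∷ ys) ≡
          [ const (con c ts) , [ lookup ts , lookup ys ]′ ]′ (target c)) → Entry b f
      recursive : ∀ {k l} {f : Fun (suc k) l} {h : ∀ c → Fun (arity c + k) (l + arity c)}
        (hs : ∀ c → Sym (h c)) → (∀ c → symRank (hs c) < b) →
        (∀ c xs ys zs → f (con c xs ∷ ys) zs
          ≡ h c (xs Vec.++ ys) (zs Vec.++ Vec.map (λ x → f (x ∷ ys) zs) xs)) → Entry b f

    -- The index of a recursion rule is the term graph below top.  Junk outside
    -- it allows any graph being rewritten to serve as shape.
    record SharedGraph : Set where
      field
        {order}  : ℕ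
        shape    : Pattern order
        acyclic  : Acyclic (patternGraph shape)
        top      : Fin order
        closed   : ∀ {x} → Reach (patternGraph shape) top x → Labeled (patternGraph shape) x
        unique   : ∀ {x y} → Reach (patternGraph shape) top x → Reach (patternGraph shape) top y →
                   patternGraph shape x ≡ patternGraph shape y → x ≡ y

    Index : ∀ {b k l} {f : Fun k l} → Entry b f → Set
    Index (copy _ _)            = ⊤
    Index (apply _ _ _ _ _ _ _) = ⊤
    Index (cases _ _)           = Fin count
    Index (recursive _ _ _)     = SharedGraph

    normalVariables : ∀ {P k l} → Vec (Left P k l) k
    normalVariables = tabulate λ i → nrm i

    safeVariables : ∀ {P k l} → Vec (Left P k l) l
    safeVariables = tabulate λ i → sf i

    variable-value : ∀ {P k l} (σ : Left P k l → T) (z : Fin k ⊎ Fin l) →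
      [ lookup (Vec.map σ normalVariables) , lookup (Vec.map σ safeVariables) ]′ z ≡ σ (inj₂ z)
    variable-value σ (inj₁ i) =
      trans (Vec.lookup-map i σ normalVariables) (cong σ (Vec.lookup∘tabulate (λ i → nrm i) i))
    variable-value σ (inj₂ i) =
      trans (Vec.lookup-map i σ safeVariables) (cong σ (Vec.lookup∘tabulate (λ i → sf i) i))

    module Copy {k l} {f : Fun k l} (s : Sym f) (z : Fin k ⊎ Fin l)
      (eq : ∀ xs ys → f xs ys ≡ [ lookup xs , lookup ys ]′ z) where
      template : Template
      template = record
        { 𝖿     = ⌈ s ⌉
        ; P     = 0
        ; Q     = 0
        ; shape = λ ()
        ; ns    = normalVariables
        ; ss    = safeVariables
        ; rhs   = λ ()
        ; root  = left (inj₂ z)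
        ; Used  = λ ()
        }

      wellFormed : WellFormed template
      wellFormed = record
        { shape-acyclic = λ ()
        ; rhs-wf        = λ ()
        ; nrm∈          = tabulate∈ _
        ; sf∈           = tabulate∈ _
        ; root-ok       = tt
        ; rhs-label     = λ { {()} }
        ; rhs-normals   = λ { {()} }
        ; rhs-safes     = λ { {()} }
        ; sound         = λ σ _ → (λ ()) , (λ ()) , sym (trans (eq _ _) (variable-value σ z))
        }

    module Apply {k l n} {f : Fun k l} (s : Sym f)
      (g : Symbol) (g⊏f : symbolRank g < suc (symRank s))
      (js : Vec (Fin k) (#normal g)) {h : Fin n → Fun k l} (hs : ∀ i → Sym (h i))
      (hs⊏f : ∀ i → symRank (hs i) < symRank s) (as : Vec ((Fin k ⊎ Fin l) ⊎ Fin n) (#safe g))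
      (eq : ∀ xs ys → f xs ys ≡ meaning g (Vec.map (lookup xs) js)
        (Vec.map [ [ lookup xs , lookup ys ]′ , (λ i → h i xs ys) ]′ as)) where

      argument : (Fin k ⊎ Fin l) ⊎ Fin n → Left 0 k l ⊎ Fin (suc n)
      argument (inj₁ z) = left (inj₂ z)
      argument (inj₂ i) = right (suc i)

      normalVariable : Fin k → Left 0 k l ⊎ Fin (suc n)
      normalVariable i = left (nrm i)

      safeVariable : Fin l → Left 0 k l ⊎ Fin (suc n)
      safeVariable i = left (sf i)

      right-content : Fin (suc n) → Content (Left 0 k l ⊎ Fin (suc n))
      right-content zero    = g ⟨ Vec.map normalVariable js ⨾ Vec.map argument as ⟩
      right-content (suc i) = def ⌈ hs i ⌉ ⟨ tabulate normalVariable ⨾ tabulate safeVariable ⟩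

      template : Template
      template = record
        { 𝖿     = ⌈ s ⌉
        ; P     = 0
        ; Q     = suc n
        ; shape = λ ()
        ; ns    = normalVariables
        ; ss    = safeVariables
        ; rhs   = right-content
        ; root  = right zero
        ; Used  = λ _ → ⊤
        }

      open Template template using (NormalArgument; SafeArgument)

      wellFormed : WellFormed template
      wellFormed = record
        { shape-acyclic = λ ()
        ; rhs-wf        = wf
        ; nrm∈          = tabulate∈ _
        ; sf∈           = tabulate∈ _
        ; root-ok       = tt
        ; rhs-label     = λ { {zero} _ → g , refl , g⊏f ; {suc i} _ → _ , refl , s≤s (hs⊏f i) }
        ; rhs-normals   = λ {y} _ → rhs-normals y
        ; rhs-safes     = λ {y} _ → rhs-safes y
        ; sound         = sound
        }
        where
        safeArgument : ∀ z → SafeArgument (argument z)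
        safeArgument (inj₁ _) = tt
        safeArgument (inj₂ _) = tt

        rhs-normals : ∀ y {b} → b ∈ normals (right-content y) → NormalArgument b
        rhs-normals zero    = ∈-toList-map NormalArgument normalVariable js (λ _ → tt)
        rhs-normals (suc i) = ∈-toList-tabulate NormalArgument normalVariable (λ _ → tt)

        rhs-safes : ∀ y {b} → b ∈ safes (right-content y) → SafeArgument b
        rhs-safes zero    = ∈-toList-map SafeArgument argument as (λ {z} _ → safeArgument z)
        rhs-safes (suc i) = ∈-toList-tabulate SafeArgument safeVariable (λ _ → tt)

        NotRight : Left 0 k l ⊎ Fin (suc n) → Set
        NotRight (left _)  = ⊤
        NotRight (right _) = ⊥

        NotRoot : Left 0 k l ⊎ Fin (suc n) → Set
        NotRoot (right zero) = ⊥
        NotRoot _            = ⊤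

        leaf : ∀ i → Acc (λ y′ y → right y′ ∈ att (right-content y)) (suc i)
        leaf i = acc λ e → contradiction (noEdge e) λ ()
          where
          noEdge : ∀ {b} → b ∈ att (right-content (suc i)) → NotRight b
          noEdge e with ∈-++⁻ (toList (tabulate normalVariable)) e
          ... | inj₁ p = ∈-toList-tabulate NotRight normalVariable (λ _ → tt) p
          ... | inj₂ p = ∈-toList-tabulate NotRight safeVariable (λ _ → tt) p

        wf : WellFounded (λ y′ y → right y′ ∈ att (right-content y))
        wf (suc i) = leaf i
        wf zero = acc λ { {suc i} _ → leaf i ; {zero} e → contradiction (notRoot e) λ () }
          where
          notRoot′ : ∀ z → NotRoot (argument z)
          notRoot′ (inj₁ _) = tt
          notRoot′ (inj₂ _) = tt
          notRoot : ∀ {b} → b ∈ att (right-content zero) → NotRoot b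
          notRoot e with ∈-++⁻ (toList (Vec.map normalVariable js)) e
          ... | inj₁ p = ∈-toList-map NotRoot normalVariable js (λ _ → tt) p
          ... | inj₂ p = ∈-toList-map NotRoot argument as (λ {z} _ → notRoot′ z) p

        sound : ∀ (σ : Left 0 k l → T) → (∀ x → _) → _
        sound σ _ = ρ , ρ-sat , refl
          where
          xs = Vec.map σ normalVariables
          ys = Vec.map σ safeVariables
          ρ : Fin (suc n) → T
          -- The root gets the value of `f` itself, so the defining equation is what `Sat` asks of
          -- node `zero`.
          ρ zero    = f xs ys
          ρ (suc i) = h i xs ys
          value-argument : ∀ z → [ [ lookup xs , lookup ys ]′ , (λ i → h i xs ys) ]′ z ≡
                            [ σ , ρ ]′ (argument z)
          value-argument (inj₁ z) = variable-value σ z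
          value-argument (inj₂ i) = refl
          ρ-sat : ∀ y → ⊤ → Sat [ σ , ρ ]′ (ρ y) (right-content y)
          ρ-sat zero _ = trans (eq xs ys) (cong₂ (meaning g)
            (trans (Vec.map-cong (λ j → variable-value σ (inj₁ j)) js)
                   (Vec.map-∘ [ σ , ρ ]′ normalVariable js))
            (trans (Vec.map-cong value-argument as) (Vec.map-∘ [ σ , ρ ]′ argument as)))
          ρ-sat (suc i) _ = cong₂ (h i)
            (trans (map-tabulate σ _) (sym (map-tabulate [ σ , ρ ]′ normalVariable)))
            (trans (map-tabulate σ _) (sym (map-tabulate [ σ , ρ ]′ safeVariable)))

    module Cases {l} {f : Fun 0 (suc l)} (s : Sym f) (target : ∀ c → ⊤ ⊎ (Fin (arity c) ⊎ Fin l))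
      (eq : ∀ c ts ys → f [] (con c ts ∷ ys) ≡
        [ const (con c ts) , [ lookup ts , lookup ys ]′ ]′ (target c)) (c : Fin count) where

      shape : Pattern (suc (arity c))
      shape zero    = just (c , tabulate suc)
      shape (suc _) = nothing

      -- `pat zero` returns the argument as a whole, as a predecessor does on other heads.
      selected : ⊤ ⊎ (Fin (arity c) ⊎ Fin l) → Left (suc (arity c)) 0 l
      selected (inj₁ _)        = pat zero
      selected (inj₂ (inj₁ j)) = pat (suc j)
      selected (inj₂ (inj₂ i)) = sf i

      template : Template
      template = record
        { 𝖿     = ⌈ s ⌉
        ; Q     = 0
        ; shape = shape
        ; ns    = []
        ; ss    = pat zero ∷ safeVariables
        ; rhs   = λ ()
        ; root  = left (selected (target c))
        ; Used  = λ ()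
        }

      open Template template using (Root)

      wellFormed : WellFormed template
      wellFormed = record
        { shape-acyclic = wellFounded⇒acyclic {G = patternGraph shape} wf
        ; rhs-wf        = λ ()
        ; nrm∈          = λ ()
        ; sf∈           = λ i → there (tabulate∈ _ i)
        ; root-ok       = root-ok (target c)
        ; rhs-label     = λ { {()} }
        ; rhs-normals   = λ { {()} }
        ; rhs-safes     = λ { {()} }
        ; sound         = λ σ sat → (λ ()) , (λ ()) , sound σ (sat zero (zero , here refl , ε))
        }
        where
        leaf : ∀ i → Acc (flip (Edge (patternGraph shape))) (suc i)
        leaf i = acc λ ()
        wf : WellFounded (flip (Edge (patternGraph shape)))
        wf (suc i) = leaf i
        wf zero    = acc λ e → ∈-toList-tabulate (Acc (flip (Edge (patternGraph shape)))) suc leaf e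

        root-ok : ∀ z → Root (left (selected z))
        root-ok (inj₁ _)        = zero , here refl , inj₁ refl
        root-ok (inj₂ (inj₁ j)) = zero , here refl , inj₂ (tabulate∈ suc j , refl)
        root-ok (inj₂ (inj₂ i)) = tt

        sound : ∀ (σ : Left (suc (arity c)) 0 l → T) →
                σ (pat zero) ≡ con c (Vec.map (σ ∘ pat) (tabulate suc)) →
                σ (selected (target c)) ≡ f [] (σ (pat zero) ∷ Vec.map σ safeVariables)
        sound σ value = sym (trans (cong (λ t → f [] (t ∷ ys)) value)
          (trans (eq c ts ys) (go (target c))))
          where
          ts : Vec T (arity c)
          ts = Vec.map (λ x → σ (pat x)) (tabulate suc)
          ys : Vec T l
          ys = Vec.map σ safeVariables
          go : ∀ z → [ const (con c ts) , [ lookup ts , lookup ys ]′ ]′ z ≡ σ (selected z)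
          go (inj₁ _)        = sym value
          go (inj₂ (inj₁ j)) = trans (Vec.lookup-map j _ (tabulate suc))
            (cong (λ x → σ (pat x)) (Vec.lookup∘tabulate suc j))
          go (inj₂ (inj₂ i)) = variable-value σ (inj₂ i)

    module Recursive {k l} {f : Fun (suc k) l} (s : Sym f)
      {h : ∀ c → Fun (arity c + k) (l + arity c)}
      (hs : ∀ c → Sym (h c)) (hs⊏f : ∀ c → symRank (hs c) < symRank s)
      (eq : ∀ c xs ys zs → f (con c xs ∷ ys) zs
          ≡ h c (xs Vec.++ ys) (zs Vec.++ Vec.map (λ x → f (x ∷ ys) zs) xs)) (G : SharedGraph) where
      open SharedGraph G renaming (order to N)

      patNode : Fin N → Left N k l ⊎ Fin N
      patNode x = left (pat x)

      recursiveCall : Fin N → Left N k l ⊎ Fin N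
      recursiveCall x = right x

      normalVariable : Fin k → Left N k l ⊎ Fin N
      normalVariable i = left (nrm i)

      safeVariable : Fin l → Left N k l ⊎ Fin N
      safeVariable i = left (sf i)

      -- Right node `x` stands for f(x, y⃗; z⃗) at the pattern node `x`. Recursive calls are
      -- references to right nodes, so calls on a shared argument are shared, and the symbol `⌈ s ⌉`
      -- itself does not occur.
      unfold : Maybe (Σ[ c ∈ Fin count ] Vec (Fin N) (arity c)) → Content (Left N k l ⊎ Fin N)
      unfold nothing         = unlabeled
      unfold (just (c , xs)) = def ⌈ hs c ⌉
        ⟨ Vec.map patNode xs Vec.++ tabulate normalVariable
        ⨾ tabulate safeVariable Vec.++ Vec.map recursiveCall xs ⟩

      template : Template
      template = record
        { 𝖿     = ⌈ s ⌉
        ; shape = shape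
        ; ns    = pat top ∷ normalVariables
        ; ss    = safeVariables
        ; rhs   = unfold ∘ shape
        ; root  = right top
        -- `unfold` also copies the junk nodes of the index; they are kept out here.
        ; Used  = Reach (patternGraph shape) top
        }

      open Template template using (NormalArgument; SafeArgument; InLeft)

      wellFormed : WellFormed template
      wellFormed = record
        { shape-acyclic = acyclic
        ; rhs-wf        = λ y → wf (acyclic⇒wellFounded {G = patternGraph shape} acyclic y)
        ; nrm∈          = λ i → there (tabulate∈ _ i)
        ; sf∈           = tabulate∈ _
        ; root-ok       = ε
        ; rhs-label     = rhs-label
        ; rhs-normals   = λ {y} → rhs-normals y
        ; rhs-safes     = λ {y} → rhs-safes y
        ; sound         = sound
        }
        where
        LeftOrBelow : (Fin N → Set) → Left N k l ⊎ Fin N → Set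
        LeftOrBelow P (left _)  = ⊤
        LeftOrBelow P (right y) = P y

        wf : ∀ {y} → Acc (flip (TransClosure (Edge (patternGraph shape)))) y →
             Acc (λ y′ y → right y′ ∈ att (unfold (shape y))) y
        wf {y} (acc rec) = acc λ {y′} e → wf (rec [ right-edge (shape y) e ])
          where
          right-edge : ∀ p {b} → b ∈ att (unfold p) →
                       LeftOrBelow (λ y′ → y′ ∈ att (patternContent p)) b
          right-edge (just (c , xs)) {b} e =
            go (∈-++⁻ (toList (Vec.map patNode xs Vec.++ tabulate normalVariable)) e)
            where
            Q : Left N k l ⊎ Fin N → Set
            Q = LeftOrBelow (_∈ toList xs)
            go : _ ⊎ _ → Q b
            go (inj₁ p) = ∈-toList-++ Q (Vec.map patNode xs) _
              (∈-toList-map Q patNode xs (λ _ → tt))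
              (∈-toList-tabulate Q normalVariable (λ _ → tt)) p
            go (inj₂ p) = ∈-toList-++ Q (tabulate safeVariable) _
              (∈-toList-tabulate Q safeVariable (λ _ → tt)) (∈-toList-map Q recursiveCall xs id) p

        rhs-label : ∀ {y} → Reach (patternGraph shape) top y →
                    ∃[ g ] label (unfold (shape y)) ≡ just g × g ⊏ def ⌈ s ⌉
        rhs-label {y} p with shape y | closed p
        ... | just (c , _) | _ = _ , refl , s≤s (hs⊏f c)

        rhs-normals : ∀ y {b} → Reach (patternGraph shape) top y → b ∈ normals (unfold (shape y)) →
                      NormalArgument b
        rhs-normals y p with shape y in y≡
        ... | just (c , xs) = ∈-toList-++ NormalArgument (Vec.map patNode xs) _
          (∈-toList-map NormalArgument patNode xs
            (λ {x} x∈ → top , here refl ,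
              p ◅◅ subst (λ q → x ∈ att (patternContent q)) (sym y≡) x∈ ◅ ε))
          (∈-toList-tabulate NormalArgument normalVariable (λ _ → tt))

        rhs-safes : ∀ y {b} → Reach (patternGraph shape) top y → b ∈ safes (unfold (shape y)) →
                    SafeArgument b
        rhs-safes y p with shape y in y≡
        ... | just (c , xs) = ∈-toList-++ SafeArgument (tabulate safeVariable) _
          (∈-toList-tabulate SafeArgument safeVariable (λ _ → tt))
          (∈-toList-map SafeArgument recursiveCall xs
            (λ {x} x∈ → p ◅◅ subst (λ q → x ∈ att (patternContent q)) (sym y≡) x∈ ◅ ε))

        sound : ∀ (σ : Left N k l → T) →
          (∀ x → InLeft x → Sat (λ x → σ (pat x)) (σ (pat x)) (patternGraph shape x)) → _
        sound σ σ-sat = ρ , ρ-sat , refl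
          where
          ys = Vec.map σ normalVariables
          zs = Vec.map σ safeVariables
          ρ : Fin N → T
          -- With this choice the recursion equation of `f` becomes a local condition at each node,
          -- without induction on the argument.
          ρ x = f (σ (pat x) ∷ ys) zs
          ρ-sat : ∀ y → Reach (patternGraph shape) top y → Sat [ σ , ρ ]′ (ρ y) (unfold (shape y))
          ρ-sat y p = go (shape y) (σ-sat y (top , here refl , p))
            where
            go : ∀ q → Sat (λ x → σ (pat x)) (σ (pat y)) (patternContent q) →
                 Sat [ σ , ρ ]′ (ρ y) (unfold q)
            go nothing         _     = tt
            go (just (c , xs)) value = trans (cong (λ t → f (t ∷ ys) zs) value)
              (trans (eq c (Vec.map (λ x → σ (pat x)) xs) ys zs) (cong₂ (h c)
                (sym (trans (Vec.map-++ [ σ , ρ ]′ (Vec.map patNode xs) _) (cong₂ Vec._++_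
                  (sym (Vec.map-∘ [ σ , ρ ]′ patNode xs))
                  (trans (map-tabulate [ σ , ρ ]′ normalVariable) (sym (map-tabulate σ _))))))
                (sym (trans (Vec.map-++ [ σ , ρ ]′ (tabulate safeVariable) _) (cong₂ Vec._++_
                  (trans (map-tabulate [ σ , ρ ]′ safeVariable) (sym (map-tabulate σ _)))
                  (trans (sym (Vec.map-∘ [ σ , ρ ]′ recursiveCall xs))
                         (Vec.map-∘ (λ t → f (t ∷ ys) zs) (λ x → σ (pat x)) xs)))))))

-- The rewriting system and its progress on innermost calls

module SystemProperties (𝒞 : Constructors)
  (Sym : ∀ {k l} → GeneralSafeRecursion.Fun 𝒞 k l → Set)
  (symRank : ∀ {k l} {f : GeneralSafeRecursion.Fun 𝒞 k l} → Sym f → ℕ)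
  (finite : ∃[ m ] (System.DefinedSymbol 𝒞 Sym symRank ↔ Fin m))
  (entry : ∀ {k l} {f : GeneralSafeRecursion.Fun 𝒞 k l} (s : Sym f) →
    System.Rules.Entry 𝒞 Sym symRank finite (symRank s) f) where
  open Constructors 𝒞
  open GeneralSafeRecursion 𝒞
  open System 𝒞 Sym symRank
  open DefinedSymbol
  open Rules finite
  open Signature S
  open TermGraphs S
  open TermGraphProperties S
  open Evaluation S fun (λ f → symRank (sym′ f))
  open Computation S fun (λ f → symRank (sym′ f))
  open Templates S fun (λ f → symRank (sym′ f))
  template : ∀ {k l} {f : Fun k l} (s : Sym f) (e : Entry (symRank s) f) → Index e → Template
  template s (copy z eq)                     _ = Copy.template s z eq
  template s (apply g g⊏f js hs hs⊏f as eq)  _ = Apply.template s g g⊏f js hs hs⊏f as eq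
  template s (cases target eq)               c = Cases.template s target eq c
  template s (recursive hs hs⊏f eq)          G = Recursive.template s hs hs⊏f eq G

  wellFormed : ∀ {k l} {f : Fun k l} (s : Sym f) (e : Entry (symRank s) f) (i : Index e) →
               WellFormed (template s e i)
  wellFormed s (copy z eq)                     _ = Copy.wellFormed s z eq
  wellFormed s (apply g g⊏f js hs hs⊏f as eq)  _ = Apply.wellFormed s g g⊏f js hs hs⊏f as eq
  wellFormed s (cases target eq)               c = Cases.wellFormed s target eq c
  wellFormed s (recursive hs hs⊏f eq)          G = Recursive.wellFormed s hs hs⊏f eq G

  ruleOf : ∀ {k l} {f : Fun k l} (s : Sym f) (e : Entry (symRank s) f) → Index e → Rule
  ruleOf s e i = TemplateRule.rule (wellFormed s e i)

  𝒢 : GRS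
  𝒢 R = Σ[ f ∈ DefinedSymbol ] Σ[ i ∈ Index (entry (sym′ f)) ]
    R ≡ ruleOf (sym′ f) (entry (sym′ f)) i

  𝒢-admissible : ∀ R → 𝒢 R → Admissible R
  𝒢-admissible _ (f , i , refl) =
    TemplateRule.rule-admissible (wellFormed (sym′ f) (entry (sym′ f)) i)

  assign : ∀ {A : Set} {P k l} → (Fin P → A) → Vec A k → Vec A l → Left P k l → A
  assign π ns ss (pat x) = π x
  assign π ns ss (nrm i) = lookup ns i
  assign π ns ss (sf i)  = lookup ss i

  module _ {A : Set} {P k l} (π : Fin P → A) (ns : Vec A k) (ss : Vec A l) where
    assign-normal : Vec.map (assign π ns ss) normalVariables ≡ ns
    assign-normal = trans (map-tabulate (assign π ns ss) _) (Vec.tabulate∘lookup ns)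

    assign-safe : Vec.map (assign π ns ss) safeVariables ≡ ss
    assign-safe = trans (map-tabulate (assign π ns ss) _) (Vec.tabulate∘lookup ss)

  -- Erasing the calls turns any graph being rewritten into a pattern; below an innermost call
  -- nothing is erased.
  constructorPart : ∀ {V} → Content V → Maybe (Σ[ c ∈ Fin count ] Vec V (arity c))
  constructorPart unlabeled          = nothing
  constructorPart (con c ⟨ _ ⨾ ss ⟩) = just (c , ss)
  constructorPart (def _ ⟨ _ ⨾ _ ⟩)  = nothing

  constructorPart-att : ∀ {V} (c : Content V) {v} →
                        v ∈ att (patternContent (constructorPart c)) → v ∈ att c
  constructorPart-att (con c ⟨ [] ⨾ ss ⟩) v∈ = v∈

  constructorPart-con : ∀ {V} (c : Content V) {d} → label c ≡ just (con d) →
                        patternContent (constructorPart c) ≡ c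
  constructorPart-con (con c ⟨ [] ⨾ ss ⟩) refl = refl

  constructorPart-labeled : ∀ {V} (c : Content V) {g} →
    label (patternContent (constructorPart c)) ≡ just g → patternContent (constructorPart c) ≡ c
  constructorPart-labeled (con c ⟨ [] ⨾ ss ⟩) _ = refl

  module _ {G : TermGraph} {t u} (inv : Invariant G t)
    (root⇒u : Reach (TermGraph.content G) (TermGraph.root G) u)
    (innermost : Innermost (TermGraph.content G) u) where
    open TermGraph G renaming (content to G₀; size to N)
    open Invariant inv

    matching : ∀ {k l} {f : Fun k l} (s : Sym f) (e : Entry (symRank s) f) {ns ss} →
      G₀ u ≡ def ⌈ s ⌉ ⟨ ns ⨾ ss ⟩ → Σ[ i ∈ Index e ] TemplateRule.Match (wellFormed s e i) G u
    matching s (copy z eq) {ns} {ss} u≡ = tt , record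
      { μ         = assign (λ ()) ns ss
      ; μ-redex   = trans u≡ (sym (cong₂ (def ⌈ s ⌉ ⟨_⨾_⟩)
                      (assign-normal (λ ()) ns ss) (assign-safe (λ ()) ns ss)))
      ; μ-pattern = λ ()
      }
    matching s (apply _ _ _ _ _ _ _) {ns} {ss} u≡ = tt , record
      { μ         = assign (λ ()) ns ss
      ; μ-redex   = trans u≡ (sym (cong₂ (def ⌈ s ⌉ ⟨_⨾_⟩)
                      (assign-normal (λ ()) ns ss) (assign-safe (λ ()) ns ss)))
      ; μ-pattern = λ ()
      }
    -- The call is innermost, so its first safe argument has a head constructor, which selects the
    -- rule.
    matching s (cases target eq) {[]} {v ∷ ss} u≡
      with innermost (subst (λ c → v ∈ att c) (sym u≡) (here refl)) ε
    ... | c , v-con with label-def {c = G₀ v} v-con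
    ... | [] , ts , v≡ = c , record
      { μ         = assign π [] ss
      ; μ-redex   = trans u≡ (cong (λ vs → def ⌈ s ⌉ ⟨ [] ⨾ v ∷ vs ⟩) (sym (assign-safe π [] ss)))
      ; μ-pattern = μ-pattern
      }
      where
      π : Fin (suc (arity c)) → Fin N
      π zero    = v
      π (suc j) = lookup ts j
      μ-pattern : ∀ x → _ → Labeled (patternGraph (Cases.shape s target eq c)) x →
                  G₀ (π x) ≡ mapContent π (patternGraph (Cases.shape s target eq c) x)
      μ-pattern zero _ _ = trans v≡ (cong (con c ⟨ [] ⨾_⟩)
        (sym (trans (map-tabulate π suc) (Vec.tabulate∘lookup ts))))
      μ-pattern (suc j) _ (_ , ())
    -- The index is the current graph with its calls erased and with the recursion argument as
    -- `top`, so every pattern node matches itself. Innermostness yields `closed`, the invariant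
    -- yields `unique`.
    matching s (recursive hs hs⊏f eq) {v ∷ ns} {ss} u≡ = shared , record
      { μ         = assign id ns ss
      ; μ-redex   = trans u≡ (sym (cong₂ (λ ns ss → def ⌈ s ⌉ ⟨ v ∷ ns ⨾ ss ⟩)
                      (assign-normal id ns ss) (assign-safe id ns ss)))
      ; μ-pattern = λ x _ labeled-x → trans (sym (constructorPart-labeled (G₀ x) (proj₂ labeled-x)))
                                            (sym (mapContent-id (patternGraph shape x)))
      }
      where
      shape : Pattern N
      shape = constructorPart ∘ G₀
      v∈ : v ∈ normals (G₀ u)
      v∈ = subst (λ c → v ∈ normals c) (sym u≡) (here refl)
      edge : ∀ {x y} → Edge (patternGraph shape) x y → Edge G₀ x y
      edge {x} = constructorPart-att (G₀ x)
      reach : ∀ {x y} → Reach (patternGraph shape) x y → Reach G₀ x y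
      reach ε       = ε
      reach (e ◅ p) = edge e ◅ reach p
      plus : ∀ {x y} → TransClosure (Edge (patternGraph shape)) x y → TransClosure (Edge G₀) x y
      plus [ e ]   = [ edge e ]
      plus (e ∷ p) = edge e ∷ plus p
      below-con : ∀ {x} → Reach (patternGraph shape) v x → patternGraph shape x ≡ G₀ x
      below-con {x} p = constructorPart-con (G₀ x)
        (proj₂ (innermost (∈-normals⇒∈-att (G₀ u) v∈) (reach p)))
      shared-reach : ∀ {x y} → Shared x → Reach G₀ x y → Shared y
      shared-reach x∈ ε       = x∈
      shared-reach x∈ (e ◅ p) = shared-reach (shared-edge x∈ e) p
      below-shared : ∀ {x} → Reach (patternGraph shape) v x → Shared x
      below-shared p = shared-reach (normals-shared (reach-live root-live root⇒u) v∈) (reach p)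
      shared : SharedGraph
      shared = record
        { shape   = shape
        ; acyclic = λ x p → TermGraph.acyclic G x (plus p)
        ; top     = v
        ; closed  = λ p → _ , trans (cong label (below-con p))
                      (proj₂ (innermost (∈-normals⇒∈-att (G₀ u) v∈) (reach p)))
        ; unique  = λ p q eq → shared-unique (below-shared p) (below-shared q)
                      (trans (sym (below-con p)) (trans eq (below-con q)))
        }

    progress : ∀ {f} → label (G₀ u) ≡ just (def f) → ∃[ H ] Step 𝒢 G H
    progress {⌈ s ⌉} u-def with label-def {c = G₀ u} u-def
    ... | ns , ss , u≡ with matching s (entry s) u≡
    ... | i , match = TemplateRule.rule-applies (wellFormed s (entry s) i) G match root⇒u
                        𝒢 (⌈ s ⌉ , i , refl)

  𝒢-constructorGRS : ConstructorGRS 𝒢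
  𝒢-constructorGRS R R∈𝒢 = Admissible.basic (𝒢-admissible R R∈𝒢)

  𝒢-computes : ∀ f → Computes 𝒢 (fun f)
  𝒢-computes = computes 𝒢 𝒢-admissible λ inv p u-def innermost → progress inv p innermost u-def

-- Cardinalities of finite subsets

members : ∀ {n} → Subset n → List (Fin n)
members []            = []
members (Subset.outside ∷ p) = List.map suc (members p)
members (Subset.inside ∷ p)  = zero ∷ List.map suc (members p)

length-members : ∀ {n} (p : Subset n) → List.length (members p) ≡ ∣ p ∣
length-members []            = refl
length-members (Subset.outside ∷ p) = trans (List.length-map suc (members p)) (length-members p)
length-members (Subset.inside ∷ p)  =
  cong suc (trans (List.length-map suc (members p)) (length-members p))

∈-members : ∀ {n} {p : Subset n} {x} → x Subset.∈ p → x ∈ members p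
∈-members {p = Subset.inside ∷ p}  Vec.here       = here refl
∈-members {p = Subset.outside ∷ p} (Vec.there x∈) = ∈-map⁺ suc (∈-members x∈)
∈-members {p = Subset.inside ∷ p}  (Vec.there x∈) = there (∈-map⁺ suc (∈-members x∈))

∈-⋃⁺ : ∀ {n} {ps : List (Subset n)} {p x} → p ∈ ps → x Subset.∈ p → x Subset.∈ ⋃ ps
∈-⋃⁺ (here refl) x∈ = Subset.x∈p∪q⁺ (inj₁ x∈)
∈-⋃⁺ (there p∈)  x∈ = Subset.x∈p∪q⁺ (inj₂ (∈-⋃⁺ p∈ x∈))

∈-⋃⁻ : ∀ {n} (ps : List (Subset n)) {x} → x Subset.∈ ⋃ ps → ∃[ p ] p ∈ ps × x Subset.∈ p
∈-⋃⁻ []       x∈ = contradiction x∈ Subset.∉⊥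
∈-⋃⁻ (p ∷ ps) x∈ with Subset.x∈p∪q⁻ p (⋃ ps) x∈
... | inj₁ x∈p = p , here refl , x∈p
... | inj₂ x∈ps with ∈-⋃⁻ ps x∈ps
...   | q , q∈ , x∈q = q , there q∈ , x∈q

∣p∪q∣≤∣p∣+∣q∣ : ∀ {n} (p q : Subset n) → ∣ p Subset.∪ q ∣ ≤ ∣ p ∣ + ∣ q ∣
∣p∪q∣≤∣p∣+∣q∣ []            []            = z≤n
∣p∪q∣≤∣p∣+∣q∣ (Subset.outside ∷ p) (Subset.outside ∷ q) = ∣p∪q∣≤∣p∣+∣q∣ p q
∣p∪q∣≤∣p∣+∣q∣ (Subset.outside ∷ p) (Subset.inside ∷ q)  =
  ℕ.≤-trans (s≤s (∣p∪q∣≤∣p∣+∣q∣ p q)) (ℕ.≤-reflexive (sym (ℕ.+-suc ∣ p ∣ ∣ q ∣)))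
∣p∪q∣≤∣p∣+∣q∣ (Subset.inside ∷ p)  (Subset.outside ∷ q) = s≤s (∣p∪q∣≤∣p∣+∣q∣ p q)
∣p∪q∣≤∣p∣+∣q∣ (Subset.inside ∷ p)  (Subset.inside ∷ q)  =
  s≤s (ℕ.≤-trans (∣p∪q∣≤∣p∣+∣q∣ p q) (ℕ.+-monoʳ-≤ ∣ p ∣ (ℕ.n≤1+n ∣ q ∣)))

-- The subset lies in the union of the singletons of the list.
cover⇒∣p∣≤length : ∀ {n} (p : Subset n) (xs : List (Fin n)) →
                   (∀ {x} → x Subset.∈ p → x ∈ xs) → ∣ p ∣ ≤ List.length xs
cover⇒∣p∣≤length {n} p xs p⊆xs = ℕ.≤-trans
  (Subset.p⊆q⇒∣p∣≤∣q∣ λ x∈ → ∈-⋃⁺ (∈-map⁺ ⁅_⁆ (p⊆xs x∈)) (Subset.x∈⁅x⁆ _)) (∣singletons∣ xs)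
  where
  ∣singletons∣ : ∀ xs → ∣ ⋃ (List.map ⁅_⁆ xs) ∣ ≤ List.length xs
  ∣singletons∣ []       = ℕ.≤-reflexive (Subset.∣⊥∣≡0 n)
  ∣singletons∣ (x ∷ xs) = ℕ.≤-trans (∣p∪q∣≤∣p∣+∣q∣ ⁅ x ⁆ _)
    (ℕ.+-mono-≤ (ℕ.≤-reflexive (Subset.∣⁅x⁆∣≡1 x)) (∣singletons∣ xs))

-- Tailored to the growth condition, where the nodes of K↾r are images of nodes from two other sets.
cover₂⇒∣p∣≤∣q∣+∣q′∣ : ∀ {m n} (p : Subset n) (q q′ : Subset m) (f g : Fin m → Fin n) →
  (∀ {x} → x Subset.∈ p → (∃[ y ] y Subset.∈ q × x ≡ f y) ⊎ (∃[ y ] y Subset.∈ q′ × x ≡ g y)) →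
  ∣ p ∣ ≤ ∣ q ∣ + ∣ q′ ∣
cover₂⇒∣p∣≤∣q∣+∣q′∣ p q q′ f g covers = ℕ.≤-trans
  (cover⇒∣p∣≤length p (List.map f (members q) List.++ List.map g (members q′))
    λ x∈ → covered (covers x∈))
  (ℕ.≤-reflexive (trans (List.length-++ (List.map f (members q))) (cong₂ _+_
    (trans (List.length-map f (members q)) (length-members q))
    (trans (List.length-map g (members q′)) (length-members q′)))))
  where
  covered : ∀ {x} → (∃[ y ] y Subset.∈ q × x ≡ f y) ⊎ (∃[ y ] y Subset.∈ q′ × x ≡ g y) →
            x ∈ List.map f (members q) List.++ List.map g (members q′)
  covered (inj₁ (y , y∈ , refl)) = ∈-++⁺ˡ (∈-map⁺ f (∈-members y∈))
  covered (inj₂ (y , y∈ , refl)) = ∈-++⁺ʳ (List.map f (members q)) (∈-map⁺ g (∈-members y∈))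

-- Sharing, closedness, boundedness and growth for the rules of a recursion

module RecursionRules {𝒞 : Constructors}
  (Sym : ∀ {k l} → GeneralSafeRecursion.Fun 𝒞 k l → Set)
  (symRank : ∀ {k l} {f : GeneralSafeRecursion.Fun 𝒞 k l} → Sym f → ℕ)
  (finite : ∃[ m ] (System.DefinedSymbol 𝒞 Sym symRank ↔ Fin m)) where
  open Constructors 𝒞
  open GeneralSafeRecursion 𝒞
  open System 𝒞 Sym symRank
  open DefinedSymbol
  open Rules finite
  open Signature S
  open TermGraphs S
  open TermGraphProperties S
  open Evaluation S fun (λ f → symRank (sym′ f))
  open Templates S fun (λ f → symRank (sym′ f))

  module _ (G : Graph) where
    open Graph G

    ∈-nodes⁺ : ∀ {u v} → Reach content u v → v Subset.∈ nodes G u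
    ∈-nodes⁺ {u} {v} p =
      Vec.lookup⇒[]= v _ (trans (Vec.lookup∘tabulate _ v) (dec-true (reach? G u v) p))

    ∈-nodes⁻ : ∀ {u v} → v Subset.∈ nodes G u → Reach content u v
    ∈-nodes⁻ {u} {v} v∈ = decided (reach? G u v)
      (trans (sym (Vec.lookup∘tabulate _ v)) (Vec.[]=⇒lookup v∈))
      where
      decided : ∀ {A : Set} (a? : Dec A) → does a? ≡ true → A
      decided (yes a) _ = a

    ∈-nodesBelow⁺ : ∀ {vs v x} → v ∈ vs → Reach content v x → x Subset.∈ nodesBelow G vs
    ∈-nodesBelow⁺ v∈ p = ∈-⋃⁺ (∈-map⁺ (nodes G) v∈) (∈-nodes⁺ p)

    ∈-nodesBelow⁻ : ∀ vs {x} → x Subset.∈ nodesBelow G vs → ∃[ v ] v ∈ vs × Reach content v x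
    ∈-nodesBelow⁻ vs x∈ with ∈-⋃⁻ (List.map (nodes G) vs) x∈
    ... | p , p∈ , x∈p with ∈-map⁻ (nodes G) p∈
    ... | v , v∈ , refl = v , v∈ , ∈-nodes⁻ x∈p

    ∈-unlabeledNodes⁻ : ∀ vs {x} → x Subset.∈ unlabeledNodes G vs → x ∈ vs × Unlabeled content x
    ∈-unlabeledNodes⁻ vs x∈ with ∈-⋃⁻ (List.map ⁅_⁆ (filter (unlabeled? content) vs)) x∈
    ... | p , p∈ , x∈p with ∈-map⁻ ⁅_⁆ p∈
    ... | v , v∈ , refl with Subset.x∈⁅y⁆⇒x≡y v x∈p
    ... | refl = ∈-filter⁻ (unlabeled? content) v∈

    ∣unlabeled∪below∣≤length : ∀ us vs xs →
      (∀ {x} → x ∈ us → Unlabeled content x → x ∈ xs) →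
      (∀ {v x} → v ∈ vs → Reach content v x → x ∈ xs) →
      ∣ unlabeledNodes G us Subset.∪ nodesBelow G vs ∣ ≤ List.length xs
    ∣unlabeled∪below∣≤length us vs xs unlabeled⊆ below⊆ = cover⇒∣p∣≤length _ xs λ x∈ →
      [ (λ x∈ → unlabeled⊆ (proj₁ (∈-unlabeledNodes⁻ us x∈)) (proj₂ (∈-unlabeledNodes⁻ us x∈)))
      , (λ x∈ → below⊆ (proj₁ (proj₂ (∈-nodesBelow⁻ vs x∈)))
                       (proj₂ (proj₂ (∈-nodesBelow⁻ vs x∈)))) ]′
      (Subset.x∈p∪q⁻ (unlabeledNodes G us) (nodesBelow G vs) x∈)

    ∣↾∣≤∣↾∣+∣below∣ : ∀ u v vs (f g : Fin size → Fin size) →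
      (∀ {x} → Reach content u x →
        (∃[ y ] Reach content v y × x ≡ f y) ⊎
        (∃[ w ] ∃[ y ] w ∈ vs × Reach content w y × x ≡ g y)) →
      ∣ nodes G u ∣ ≤ ∣ nodes G v ∣ + ∣ nodesBelow G vs ∣
    ∣↾∣≤∣↾∣+∣below∣ u v vs f g covers =
      cover₂⇒∣p∣≤∣q∣+∣q′∣ (nodes G u) (nodes G v) (nodesBelow G vs) f g
        λ x∈ → covered (covers (∈-nodes⁻ x∈))
      where
      covered : ∀ {x} →
        (∃[ y ] Reach content v y × x ≡ f y) ⊎
        (∃[ w ] ∃[ y ] w ∈ vs × Reach content w y × x ≡ g y) →
        (∃[ y ] y Subset.∈ nodes G v × x ≡ f y) ⊎ (∃[ y ] y Subset.∈ nodesBelow G vs × x ≡ g y)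
      covered (inj₁ (y , p , eq))          = inj₁ (y , ∈-nodes⁺ p , eq)
      covered (inj₂ (w , y , w∈ , p , eq)) = inj₂ (y , ∈-nodesBelow⁺ w∈ p , eq)

  module _ {k l} {f : Fun (suc k) l} (s : Sym f) {h : ∀ c → Fun (arity c + k) (l + arity c)}
    (hs : ∀ c → Sym (h c)) (hs⊏f : ∀ c → symRank (hs c) < symRank s)
    (eq : ∀ c xs ys zs → f (con c xs ∷ ys) zs
        ≡ h c (xs Vec.++ ys) (zs Vec.++ Vec.map (λ x → f (x ∷ ys) zs) xs)) (G : SharedGraph) where
    open SharedGraph G renaming (order to N)
    open Recursive s hs hs⊏f eq G
    open TemplateRule wellFormed hiding (patNode)

    K : Graph
    K = Rule.K rule

    private
      zero-normals⁻ : ∀ {x} → x ∈ normals (K₀ zero) →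
                      x ≡ node (patNode top) ⊎ ∃[ i ] x ≡ node (left (nrm i))
      zero-normals⁻ (here refl) = inj₁ refl
      zero-normals⁻ {x} (there x∈) = inj₂ (∈-toList-map Q node _
        (∈-toList-map (Q ∘ node) left normalVariables
        (∈-toList-tabulate (Q ∘ node ∘ left) (λ i → nrm i) λ i → i , refl)) x∈)
        where
        Q : Fin size → Set
        Q x = ∃[ i ] x ≡ node (left (nrm i))

      zero-safes⁻ : ∀ {x} → x ∈ safes (K₀ zero) → ∃[ i ] x ≡ node (left (sf i))
      zero-safes⁻ = ∈-toList-map Q node _ (∈-toList-map (Q ∘ node) left safeVariables
        (∈-toList-tabulate (Q ∘ node ∘ left) (λ i → sf i) λ i → i , refl))
        where
        Q : Fin size → Set
        Q x = ∃[ i ] x ≡ node (left (sf i))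

      K₀-pat : ∀ y → K₀ (node (patNode y)) ≡ mapContent (node ∘ patNode) (patternGraph shape y)
      K₀-pat y = trans (K₀-node (patNode y)) (mapContent-∘ node patNode (patternGraph shape y))

      variables : List (Fin size)
      variables = List.map (λ i → node (left (nrm i))) (allFin k) List.++
                  List.map (λ i → node (left (sf i))) (allFin l)

      length-variables : List.length variables ≡ k + l
      length-variables = trans (List.length-++ (List.map _ (allFin k)))
        (cong₂ _+_ (trans (List.length-map _ (allFin k)) (List.length-tabulate {n = k} id))
                   (trans (List.length-map _ (allFin l)) (List.length-tabulate {n = l} id)))

    -- The unlabeled normal successors of `l` and everything below its safe ones are among the
    -- `k + l` variables, whence the bound. As for sharing, the root carries a defined symbol and
    -- the pattern constructors, so distinct labeled nodes of equal content could only lie in the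
    -- recursion argument, where `unique` applies.
    conditions : ∀ {d} → k + l ≤ d → InfiniteRuleConditions d rule
    conditions {d} k+l≤d = record
      { shared  = content-injective⇒maximallyShared M (zero ↑ˡ l) M-injective
      ; closed  = λ v v∈ v-labeled → closed′ (zero-normals⁻ v∈) v-labeled
      ; bounded = ℕ.≤-trans
          (∣unlabeled∪below∣≤length K (normals (K₀ zero)) (safes (K₀ zero)) variables
            (λ x∈ unl → covered-normal (zero-normals⁻ x∈) unl)
            (λ v∈ p → covered-safe (zero-safes⁻ v∈) p))
          (ℕ.≤-trans (ℕ.≤-reflexive length-variables) k+l≤d)
      ; growth  = ∣↾∣≤∣↾∣+∣below∣ K (node (right top)) zero rs fromLeft fromNormal
          λ {x} p → covers (view x) refl (reach-right⁻ (right top) ε p)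
      }
      where
      closed′ : ∀ {v} → (v ≡ node (patNode top) ⊎ ∃[ i ] v ≡ node (left (nrm i))) →
                Labeled K₀ v → Closed K₀ v
      closed′ (inj₁ refl) _ u p with reach-pat⁻ p
      ... | y , refl , q = proj₁ (closed q) , trans (cong label (K₀-pat y))
        (trans (label-map _ (patternGraph shape y)) (proj₂ (closed q)))
      closed′ (inj₂ (i , refl)) (g , eq)
        with () ← trans (sym eq) (cong label (K₀-node (left (nrm i))))

      covered-normal : ∀ {x} → (x ≡ node (patNode top) ⊎ ∃[ i ] x ≡ node (left (nrm i))) →
                       Unlabeled K₀ x → x ∈ variables
      covered-normal (inj₂ (i , refl)) _ = ∈-++⁺ˡ (∈-map⁺ _ (∈-allFin i))
      covered-normal (inj₁ refl) unl with () ← trans (sym (proj₂ (closed ε)))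
        (trans (sym (trans (cong label (K₀-pat top)) (label-map _ (patternGraph shape top)))) unl)

      covered-safe : ∀ {v x} → (∃[ i ] v ≡ node (left (sf i))) → Reach K₀ v x → x ∈ variables
      covered-safe (i , refl) p = subst (_∈ variables) (sym (reach-variable⁻ {z = inj₂ i} p))
        (∈-++⁺ʳ (List.map _ (allFin k)) (∈-map⁺ _ (∈-allFin i)))

      M : PreGraph (size + l)
      M = K₀ ∩nrm zero

      M-node : ∀ b → M (node b ↑ˡ l) ≡ mapContent (_↑ˡ l) (K₀ (node b))
      M-node b rewrite Fin.splitAt-↑ˡ size (node b) l = refl

      M-fresh : ∀ i → M (size ↑ʳ i) ≡ unlabeled
      M-fresh i rewrite Fin.splitAt-↑ʳ size l i = refl

      ι : Fin N → Fin (size + l)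
      ι y = node (patNode y) ↑ˡ l

      M-pat : ∀ y → M (ι y) ≡ mapContent ι (patternGraph shape y)
      M-pat y = trans (M-node (patNode y)) (trans (cong (mapContent (_↑ˡ l)) (K₀-pat y))
        (mapContent-∘ (_↑ˡ l) (node ∘ patNode) (patternGraph shape y)))

      -- Left inverse of `ι`, by which equal contents are transported back to the index; `top` is an
      -- arbitrary default.
      ι⁻¹ : Fin (size + l) → Fin N
      ι⁻¹ = [ toPat ∘ view , const top ]′ ∘ splitAt size
        where
        toPat : Node → Fin N
        toPat (just (left (pat y))) = y
        toPat _                     = top

      ι⁻¹-ι : ∀ y → ι⁻¹ (ι y) ≡ y
      ι⁻¹-ι y rewrite Fin.splitAt-↑ˡ size (node (patNode y)) l | view-node (patNode y) = refl

      -- Covers the nodes reachable in (K↾l) ∩ nrm; variables and fresh nodes alike fall under the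
      -- unlabeled case.
      Below : Fin (size + l) → Set
      Below x =
        x ≡ zero ↑ˡ l ⊎ (∃[ y ] Reach (patternGraph shape) top y × x ≡ ι y) ⊎ M x ≡ unlabeled

      Below-normal : ∀ {x} → (x ≡ node (patNode top) ⊎ ∃[ i ] x ≡ node (left (nrm i))) →
                     Below (x ↑ˡ l)
      Below-normal (inj₁ refl)       = inj₂ (inj₁ (top , ε , refl))
      Below-normal (inj₂ (i , refl)) = inj₂ (inj₂ (trans (M-node (left (nrm i)))
        (cong (mapContent (_↑ˡ l)) (K₀-node (left (nrm i))))))

      Below-edge : ∀ {x y} → Below x → Edge M x y → Below y
      Below-edge (inj₁ refl) e with ∈-++⁻ (toList (Vec.map (_↑ˡ l) _)) e
      ... | inj₁ n∈ = ∈-toList-map Below (_↑ˡ l) _ (λ x∈ → Below-normal (zero-normals⁻ x∈)) n∈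
      ... | inj₂ s∈ = ∈-toList-tabulate Below (size ↑ʳ_) (λ i → inj₂ (inj₂ (M-fresh i))) s∈
      Below-edge (inj₂ (inj₁ (z , p , refl))) e
        with ∈-att-map⁻ ι (patternGraph shape z) (subst (λ c → _ ∈ att c) (M-pat z) e)
      ... | z′ , z′∈ , refl = inj₂ (inj₁ (z′ , p ◅◅ z′∈ ◅ ε , refl))
      Below-edge (inj₂ (inj₂ unl)) e with () ← subst (λ c → _ ∈ att c) unl e

      reach-Below : ∀ {x y} → Below x → Reach M x y → Below y
      reach-Below b ε       = b
      reach-Below b (e ◅ p) = reach-Below (Below-edge b e) p

      Below-pat-con : ∀ {y} → Reach (patternGraph shape) top y →
                      ∃[ c ] label (M (ι y)) ≡ just (con c)
      Below-pat-con {y} p with closed p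
      ... | g , eq with patternContent-label (shape y) eq
      ... | c , refl =
        c , trans (cong label (M-pat y)) (trans (label-map ι (patternGraph shape y)) eq)

      M-injective′ : ∀ {u v} → Below u → Below v → Labeled M u → M u ≡ M v → u ≡ v
      M-injective′ (inj₁ refl) (inj₁ refl) _ _ = refl
      M-injective′ (inj₁ refl) (inj₂ (inj₁ (y , p , refl))) _ eq
        with () ← trans (cong label eq) (proj₂ (Below-pat-con p))
      M-injective′ (inj₂ (inj₁ (y , p , refl))) (inj₁ refl) _ eq
        with () ← trans (cong label (sym eq)) (proj₂ (Below-pat-con p))
      M-injective′ (inj₂ (inj₁ (y , p , refl))) (inj₂ (inj₁ (z , q , refl))) _ eq =
        cong ι (unique p q (trans (sym (restore y)) (trans (cong (mapContent ι⁻¹) eq) (restore z))))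
        where
        restore : ∀ y → mapContent ι⁻¹ (M (ι y)) ≡ patternGraph shape y
        restore y = trans (cong (mapContent ι⁻¹) (M-pat y))
          (trans (mapContent-∘ ι⁻¹ ι (patternGraph shape y))
          (trans (mapContent-cong-∈ (patternGraph shape y) λ z _ → ι⁻¹-ι z) (mapContent-id _)))
      M-injective′ _ (inj₂ (inj₂ unl)) (g , g≡) eq
        with () ← trans (sym g≡) (cong label (trans eq unl))
      M-injective′ (inj₂ (inj₂ unl)) _ (g , g≡) eq with () ← trans (sym g≡) (cong label unl)

      M-injective : ∀ {u v} → Reach M (zero ↑ˡ l) u → Reach M (zero ↑ˡ l) v →
                    Labeled M u → M u ≡ M v → u ≡ v
      M-injective p q = M-injective′ (reach-Below (inj₁ refl) p) (reach-Below (inj₁ refl) q)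

      rs : List (Fin size)
      rs = normals (K₀ (node (right top)))

      -- The copies of the nodes below the root of the recursion argument occur
      -- below the normal arguments of r; the remaining one is paired with l.
      fromLeft fromNormal : Fin size → Fin size
      fromLeft zero    = node (right top)
      fromLeft (suc i) = suc i
      fromNormal i = copyOf (view i)
        where
        copyOf : Node → Fin size
        copyOf (just (left (pat y))) = node (right y)
        copyOf _                     = zero

      fromNormal-pat : ∀ y → fromNormal (node (patNode y)) ≡ node (right y)
      fromNormal-pat y rewrite view-node (patNode y) = refl

      child-normal : ∀ p {z} → z ∈ att (patternContent p) →
                     node (patNode z) ∈ normals (mapContent node (unfold p))
      child-normal p@(just (c , xs)) {z} z∈ = ∈-normals-map⁺ node (unfold p)
        (subst (patNode z ∈_) (sym (Vec.toList-++ (Vec.map patNode xs) _))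
          (∈-++⁺ˡ (subst (patNode z ∈_) (sym (Vec.toList-map patNode xs)) (∈-map⁺ patNode z∈))))

      -- Left nodes of K↾r lie in K↾l. A right node reached by a nonempty path from `top` stands for
      -- a node below some child of `top`, and that child is a normal argument of the root of K↾r.
      covers : ∀ {x} v → view x ≡ v → RightNode v →
        (∃[ y ] Reach K₀ zero y × x ≡ fromLeft y) ⊎
        (∃[ w ] ∃[ y ] w ∈ rs × Reach K₀ w y × x ≡ fromNormal y)
      covers (just (left z)) eq p =
        inj₁ (node (left z) , reach-left z (leftNode z p) , node-view eq)
        where
        leftNode : ∀ z → RightNode (just (left z)) → LeftNode (just (left z))
        leftNode (pat x)  p = p
        leftNode (inj₂ _) _ = tt
      covers (just (right y)) eq ε = inj₁ (zero , ε , node-view eq)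
      covers (just (right y)) eq (_◅_ {j = z} e q) = inj₂
        ( node (patNode z) , node (patNode y)
        , subst (λ c → node (patNode z) ∈ normals c) (sym (K₀-node (right top)))
            (child-normal (shape top) e)
        , reach-pat q , trans (node-view eq) (sym (fromNormal-pat y)) )

-- Symbols with finitely or infinitely many rules, and the constant `d`

uniform-bound : ∀ {n} (b : Fin n → ℕ) → ∃[ d ] (∀ i → b i ≤ d)
uniform-bound {zero}  b = 0 , λ ()
uniform-bound {suc n} b with uniform-bound (b ∘ suc)
... | d , b≤d = b zero + d , λ where
  zero    → ℕ.m≤m+n (b zero) d
  (suc i) → ℕ.≤-trans (b≤d i) (ℕ.m≤n+m d (b zero))

list-bound : ∀ {A : Set} (b : A → ℕ) (xs : List A) → ∃[ d ] (∀ {x} → x ∈ xs → b x ≤ d)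
list-bound b []       = 0 , λ ()
list-bound b (x ∷ xs) with list-bound b xs
... | d , b≤d = b x + d , λ where
  (here refl) → ℕ.m≤m+n (b x) d
  (there y∈)  → ℕ.≤-trans (b≤d y∈) (ℕ.m≤n+m d (b x))

module Bounds {𝒞 : Constructors}
  (Sym : ∀ {k l} → GeneralSafeRecursion.Fun 𝒞 k l → Set)
  (symRank : ∀ {k l} {f : GeneralSafeRecursion.Fun 𝒞 k l} → Sym f → ℕ)
  (finite : ∃[ m ] (System.DefinedSymbol 𝒞 Sym symRank ↔ Fin m))
  (entry : ∀ {k l} {f : GeneralSafeRecursion.Fun 𝒞 k l} (s : Sym f) →
    System.Rules.Entry 𝒞 Sym symRank finite (symRank s) f) where
  open Constructors 𝒞
  open GeneralSafeRecursion 𝒞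
  open System 𝒞 Sym symRank
  open DefinedSymbol
  open Rules finite
  open Signature S hiding (finite)
  open TermGraphs S
  open TermGraphProperties S
  open Evaluation S fun (λ f → symRank (sym′ f))
  open Templates S fun (λ f → symRank (sym′ f))
  open SystemProperties 𝒞 Sym symRank finite entry
  open RecursionRules Sym symRank finite using (conditions)

  ⊏-isPrecedence : IsPrecedence _⊏_
  ⊏-isPrecedence = record
    { isStrictPartialOrder = record
      { isEquivalence = isEquivalence
      ; irrefl        = λ { refl → ℕ.<-irrefl refl }
      ; trans         = ℕ.<-trans
      ; <-resp-≈      = resp₂ _⊏_
      }
    ; wellFounded          = On.wellFounded symbolRank <-wellFounded
    ; constructorsMinimal  = λ _ _ ()
    }

  𝒢-precedenceTerminating : PrecedenceTerminating 𝒢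
  𝒢-precedenceTerminating =
    _⊏_ , ⊏-isPrecedence , λ R R∈𝒢 → Admissible.terminating (𝒢-admissible R R∈𝒢)

  ruleOf-label : ∀ {k l} {f : Fun k l} (s : Sym f) (e : Entry (symRank s) f) (i : Index e) →
                 label (Rule.K₀ (ruleOf s e i) (Rule.l (ruleOf s e i))) ≡ just (def ⌈ s ⌉)
  ruleOf-label s (copy _ _)            _ = refl
  ruleOf-label s (apply _ _ _ _ _ _ _) _ = refl
  ruleOf-label s (cases _ _)           _ = refl
  ruleOf-label s (recursive _ _ _)     _ = refl

  data IsRecursive {b} : ∀ {k l} {f : Fun k l} → Entry b f → Set where
    recursive : ∀ {k l} {f : Fun (suc k) l} {h : ∀ c → Fun (arity c + k) (l + arity c)}
      {hs : ∀ c → Sym (h c)} {hs⊏f eq} → IsRecursive (recursive {f = f} hs hs⊏f eq)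

  indices : ∀ {b k l} {f : Fun k l} (e : Entry b f) →
            (Σ[ is ∈ List (Index e) ] (∀ i → i ∈ is)) ⊎ IsRecursive e
  indices (copy _ _)            = inj₁ (tt ∷ [] , λ _ → here refl)
  indices (apply _ _ _ _ _ _ _) = inj₁ (tt ∷ [] , λ _ → here refl)
  indices (cases _ _)           = inj₁ (allFin count , ∈-allFin)
  indices (recursive _ _ _)     = inj₂ recursive

  -- The label of the left root determines the symbol, so each rule for `⌈ s ⌉` comes from one of
  -- the listed indices.
  finitelyManyRules : ∀ {k l} {f : Fun k l} (s : Sym f) (is : List (Index (entry s))) →
                      (∀ i → i ∈ is) → HasFinitelyManyRules 𝒢 ⌈ s ⌉
  finitelyManyRules s is complete = List.map (ruleOf s (entry s)) is , go
    where
    go : ∀ R → 𝒢 R → label (Rule.K₀ R (Rule.l R)) ≡ just (def ⌈ s ⌉) →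
         R ∈ List.map (ruleOf s (entry s)) is
    go _ (⌈ s′ ⌉ , i , refl) eq with trans (sym (ruleOf-label s′ (entry s′) i)) eq
    ... | refl = ∈-map⁺ (ruleOf s (entry s)) (complete i)

  -- Unreachable nodes make the size of a shared graph arbitrarily large.
  padded : ℕ → SharedGraph
  padded n = record
    { order   = suc n
    ; shape   = λ _ → just (c , subst (Vec _) (sym c-constant) [])
    ; acyclic = wellFounded⇒acyclic {G = G} λ x → acc λ {y} e → contradiction e (noEdge x y)
    ; top     = zero
    ; closed  = λ _ → con c , refl
    ; unique  = λ p q _ → trans (sym (reach p)) (reach q)
    }
    where
    c : Fin count
    c = proj₁ someConst
    c-constant : arity c ≡ 0
    c-constant = proj₂ someConst
    G : PreGraph (suc n)
    G = patternGraph λ _ → just (c , subst (Vec _) (sym c-constant) [])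
    empty : ∀ {A : Set} {m} (eq : 0 ≡ m) {x : A} → ¬ x ∈ toList (subst (Vec A) eq [])
    empty refl ()
    noEdge : ∀ x y → ¬ Edge G x y
    noEdge _ _ = empty (sym c-constant)
    reach : ∀ {x y} → Reach G x y → x ≡ y
    reach ε       = refl
    reach {x} (_◅_ {j = y} e _) = contradiction e (noEdge x y)

  ruleSize : Rule → ℕ
  ruleSize R = Graph.size (Rule.K R)

  rhsSize≤ruleSize : ∀ R → rhsSize R ≤ ruleSize R
  rhsSize≤ruleSize R = Subset.∣p∣≤n (nodes (Rule.K R) (Rule.r R))

  unbounded : ∀ {k l} {f : Fun k l} (s : Sym f) (e : Entry (symRank s) f) → IsRecursive e →
              ∀ n → ∃[ i ] n < ruleSize (ruleOf s e i)
  unbounded {suc k} {l} s (recursive _ _ _) recursive n =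
    -- The last summand of the size is `suc n`, the number of right nodes.
    padded n , s≤s (ℕ.m≤n⇒m≤o+n (suc n + (k + l)) (ℕ.n≤1+n n))

  -- A finite list bounds the sizes of its rules, while padding exceeds any bound. This works even
  -- when all constructors are constants, so no recursion rule belongs to `𝒢fin`.
  infinitelyManyRules : ∀ {k l} {f : Fun k l} (s : Sym f) → IsRecursive (entry s) →
                        ¬ HasFinitelyManyRules 𝒢 ⌈ s ⌉
  infinitelyManyRules s rec (Rs , complete) with list-bound ruleSize Rs
  ... | d , ≤d with unbounded s (entry s) rec d
  ... | i , d< = ℕ.<⇒≱ d< (≤d (complete _ (⌈ s ⌉ , i , refl) (ruleOf-label s (entry s) i)))

  ruleFor : ∀ f → Index (entry (sym′ f)) → Rule
  ruleFor f = ruleOf (sym′ f) (entry (sym′ f))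

  -- For a recursion symbol only the arity counts. For the others the finitely many rules are
  -- bounded by the size of the whole `K`, which dominates that of K↾r.
  ruleBound : ∀ f → ∃[ d ]
    (ar (def f) ≤ d × (¬ IsRecursive (entry (sym′ f)) → ∀ i → ruleSize (ruleFor f i) ≤ d))
  ruleBound f with indices (entry (sym′ f))
  ... | inj₂ rec = ar (def f) , ℕ.≤-refl , λ ¬rec → contradiction rec ¬rec
  ... | inj₁ (is , complete) with list-bound (λ i → ruleSize (ruleFor f i)) is
  ...   | d , ≤d = ar (def f) + d , ℕ.m≤m+n _ d , λ _ i → ℕ.≤-trans (≤d (complete i)) (ℕ.m≤n+m d _)

  private
    conBound : ∃[ d ] (∀ c → arity c ≤ d)
    conBound = uniform-bound arity

    defBound : ∃[ d ] (∀ f → proj₁ (ruleBound f) ≤ d)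
    defBound = proj₁ bound , λ f → subst (λ f → proj₁ (ruleBound f) ≤ proj₁ bound)
        (strictlyInverseʳ f) (proj₂ bound (to f))
      where
      open Inverse (proj₂ finite)
      bound : ∃[ d ] (∀ i → proj₁ (ruleBound (from i)) ≤ d)
      bound = uniform-bound λ i → proj₁ (ruleBound (from i))

  -- Any common upper bound serves, so sums replace maxima.
  d : ℕ
  d = proj₁ conBound + proj₁ defBound

  ruleBound≤d : ∀ f → proj₁ (ruleBound f) ≤ d
  ruleBound≤d f = ℕ.≤-trans (proj₂ defBound f) (ℕ.m≤n+m _ (proj₁ conBound))

  ar≤d : ∀ g → ar g ≤ d
  ar≤d (con c) = ℕ.≤-trans (proj₂ conBound c) (ℕ.m≤m+n _ _)
  ar≤d (def f) = ℕ.≤-trans (proj₁ (proj₂ (ruleBound f))) (ruleBound≤d f)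

  rhsSize≤d : ∀ R → 𝒢fin 𝒢 R → rhsSize R ≤ d
  rhsSize≤d _ (R∈𝒢@(f , i , refl) , finite-rule) = ℕ.≤-trans (rhsSize≤ruleSize (ruleFor f i))
    (ℕ.≤-trans (proj₂ (proj₂ (ruleBound f)) notRecursive i) (ruleBound≤d f))
    where
    notRecursive : ¬ IsRecursive (entry (sym′ f))
    notRecursive rec = finite-rule
      (R∈𝒢 , f , ruleOf-label (sym′ f) (entry (sym′ f)) i , infinitelyManyRules (sym′ f) rec)

  recursive-conditions : ∀ {k l} {f : Fun k l} (s : Sym f) (e : Entry (symRank s) f) →
    IsRecursive e → ∀ i → k + l ≤ d → InfiniteRuleConditions d (ruleOf s e i)
  recursive-conditions s (recursive hs hs⊏f eq) recursive G k+l<d =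
    -- The arity of the symbol counts the recursion argument too, whereas the variables are the
    -- remaining arguments; hence the strict inequality.
    conditions s hs hs⊏f eq G (ℕ.<⇒≤ k+l<d)

  infinite-conditions : ∀ R → 𝒢inf 𝒢 R → InfiniteRuleConditions d R
  infinite-conditions _ ((⌈ s ⌉ , i , refl) , f , f-label , infinite)
    with trans (sym (ruleOf-label s (entry s) i)) f-label
  ... | refl with indices (entry s)
  ...   | inj₁ (is , complete) = contradiction (finitelyManyRules s is complete) infinite
  ...   | inj₂ rec = recursive-conditions s (entry s) rec i (ar≤d (def ⌈ s ⌉))

-- Symbols as positions of a derivation

∑ : ∀ {n} → (Fin n → ℕ) → ℕ
∑ {zero}  m = 0
∑ {suc n} m = m zero + ∑ (m ∘ suc)

m≤∑ : ∀ {n} (m : Fin n → ℕ) i → m i ≤ ∑ m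
m≤∑ m zero    = ℕ.m≤m+n (m zero) _
m≤∑ m (suc i) = ℕ.≤-trans (m≤∑ (m ∘ suc) i) (ℕ.m≤n+m _ (m zero))

Σ-Fin↔Fin-∑ : ∀ {n} {A : Fin n → Set} {m : Fin n → ℕ} →
              (∀ i → A i ↔ Fin (m i)) → (Σ[ i ∈ Fin n ] A i) ↔ Fin (∑ m)
Σ-Fin↔Fin-∑ {zero}  f = mk↔ₛ′ (λ ()) (λ ()) (λ ()) (λ ())
Σ-Fin↔Fin-∑ {suc n} {A} f = ↔-sym Fin.+↔⊎ ↔-∘ ((f zero ⊎-↔ Σ-Fin↔Fin-∑ (f ∘ suc)) ↔-∘ split)
  where
  split : (Σ[ i ∈ Fin (suc n) ] A i) ↔ (A zero ⊎ (Σ[ i ∈ Fin n ] A (suc i)))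
  split = mk↔ₛ′
    (λ { (zero , a) → inj₁ a ; (suc i , a) → inj₂ (i , a) })
    (λ { (inj₁ a) → zero , a ; (inj₂ (i , a)) → suc i , a })
    (λ { (inj₁ a) → refl ; (inj₂ (i , a)) → refl })
    (λ { (zero , a) → refl ; (suc i , a) → refl })

module Derivations (𝒞 : Constructors) where
  open Constructors 𝒞
  open GeneralSafeRecursion 𝒞

  -- The last index is the function derived at the position. A function derived at several positions
  -- gets several symbols.
  data Position : ∀ {k l} {f : Fun k l} → GSR f → ∀ {k′ l′} → Fun k′ l′ → Set where
    root : ∀ {k l} {f : Fun k l} {D : GSR f} → Position D f
    head : ∀ {k l m n} {f : Fun k l} {h : Fun m n} {g : Fin n → Fun k l} {js D}
             {Ds : ∀ i → GSR (g i)} {eq} {k′ l′} {f′ : Fun k′ l′} →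
           Position D f′ → Position (composition {f = f} {h} js D Ds eq) f′
    argument : ∀ {k l m n} {f : Fun k l} {h : Fun m n} {g : Fin n → Fun k l} {js D}
                 {Ds : ∀ i → GSR (g i)} {eq} {k′ l′} {f′ : Fun k′ l′} i →
               Position (Ds i) f′ → Position (composition {f = f} {h} js D Ds eq) f′
    branch : ∀ {k l} {f : Fun (1 + k) l} {h : ∀ c → Fun (arity c + k) (l + arity c)}
               {Ds : ∀ c → GSR (h c)} {eq} {k′ l′} {f′ : Fun k′ l′} c →
             Position (Ds c) f′ → Position (recursion {f = f} Ds eq) f′

  -- Counts the positions, and serves as rank as well, since it drops from a derivation to each of
  -- its premises.
  size : ∀ {k l} {f : Fun k l} → GSR f → ℕ
  size (composition _ D Ds _) = suc (size D + ∑ λ i → size (Ds i))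
  size (recursion Ds _)       = suc (∑ λ c → size (Ds c))
  size _                      = 1

  rank : ∀ {k l} {f : Fun k l} {D : GSR f} {k′ l′} {g : Fun k′ l′} → Position D g → ℕ
  rank (root {D = D}) = size D
  rank (head p)       = rank p
  rank (argument _ p) = rank p
  rank (branch _ p)   = rank p

  Symbols : ∀ {k l} {f : Fun k l} → GSR f → Set
  Symbols D = System.DefinedSymbol 𝒞 (Position D) rank

  module _ {k l} {f : Fun k l} {D : GSR f} where
    open System 𝒞 (Position D) rank public using (⌈_⌉)

  ↔Fin1 : ∀ {A : Set} {a : A} → (∀ b → a ≡ b) → A ↔ Fin 1
  ↔Fin1 {a = a} unique = mk↔ₛ′ (λ _ → zero) (λ _ → a) (λ { zero → refl }) unique

  Symbols↔Fin : ∀ {k l} {f : Fun k l} (D : GSR f) → Symbols D ↔ Fin (size D)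
  Symbols↔Fin (constant _ _ _)       = ↔Fin1 (λ { ⌈ root ⌉ → refl })
  Symbols↔Fin (construct _ _)        = ↔Fin1 (λ { ⌈ root ⌉ → refl })
  Symbols↔Fin (projection _ _)       = ↔Fin1 (λ { ⌈ root ⌉ → refl })
  Symbols↔Fin (predecessor₀ _ _ _ _) = ↔Fin1 (λ { ⌈ root ⌉ → refl })
  Symbols↔Fin (predecessor _ _ _ _)  = ↔Fin1 (λ { ⌈ root ⌉ → refl })
  Symbols↔Fin (conditional _)        = ↔Fin1 (λ { ⌈ root ⌉ → refl })
  Symbols↔Fin (composition js D Ds eq) =
    ↔-sym (Fin.+↔⊎ {1}) ↔-∘
    ((↔-id _ ⊎-↔ (↔-sym Fin.+↔⊎ ↔-∘
      (Symbols↔Fin D ⊎-↔ Σ-Fin↔Fin-∑ (λ i → Symbols↔Fin (Ds i))))) ↔-∘ split)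
    where
    split : Symbols (composition js D Ds eq) ↔ (Fin 1 ⊎ (Symbols D ⊎ Σ[ i ∈ _ ] Symbols (Ds i)))
    split = mk↔ₛ′
      (λ { ⌈ root ⌉ → inj₁ zero ; ⌈ head p ⌉ → inj₂ (inj₁ ⌈ p ⌉)
         ; ⌈ argument i p ⌉ → inj₂ (inj₂ (i , ⌈ p ⌉)) })
      (λ { (inj₁ zero) → ⌈ root ⌉ ; (inj₂ (inj₁ ⌈ p ⌉)) → ⌈ head p ⌉
         ; (inj₂ (inj₂ (i , ⌈ p ⌉))) → ⌈ argument i p ⌉ })
      (λ { (inj₁ zero) → refl ; (inj₂ (inj₁ ⌈ p ⌉)) → refl ; (inj₂ (inj₂ (i , ⌈ p ⌉))) → refl })
      (λ { ⌈ root ⌉ → refl ; ⌈ head p ⌉ → refl ; ⌈ argument i p ⌉ → refl })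
  Symbols↔Fin (recursion Ds eq) =
    ↔-sym (Fin.+↔⊎ {1}) ↔-∘ ((↔-id _ ⊎-↔ Σ-Fin↔Fin-∑ (λ c → Symbols↔Fin (Ds c))) ↔-∘ split)
    where
    split : Symbols (recursion Ds eq) ↔ (Fin 1 ⊎ Σ[ c ∈ _ ] Symbols (Ds c))
    split = mk↔ₛ′
      (λ { ⌈ root ⌉ → inj₁ zero ; ⌈ branch c p ⌉ → inj₂ (c , ⌈ p ⌉) })
      (λ { (inj₁ zero) → ⌈ root ⌉ ; (inj₂ (c , ⌈ p ⌉)) → ⌈ branch c p ⌉ })
      (λ { (inj₁ zero) → refl ; (inj₂ (c , ⌈ p ⌉)) → refl })
      (λ { ⌈ root ⌉ → refl ; ⌈ branch c p ⌉ → refl })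

  module _ {k₀ l₀} {f₀ : Fun k₀ l₀} (D₀ : GSR f₀) where
    symbols-finite : ∃[ m ] (Symbols D₀ ↔ Fin m)
    symbols-finite = size D₀ , Symbols↔Fin D₀

    open System.Rules 𝒞 (Position D₀) rank symbols-finite
    open Signature S using (con; def)

    map-[] : ∀ {A B : Set} {n} (g : A → B) (n≡0 : n ≡ 0) →
             Vec.map g (subst (Vec A) (sym n≡0) []) ≡ subst (Vec B) (sym n≡0) []
    map-[] g refl = refl

    []-unique : ∀ {A : Set} {n} (n≡0 : n ≡ 0) (xs : Vec A n) → xs ≡ subst (Vec A) (sym n≡0) []
    []-unique refl [] = refl

    -- The equations of a subderivation `D` must speak of symbols of the whole `D₀`: `ι` embeds the
    -- positions, and `ι-rank` carries the comparison of sizes over.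
    rootEntry : ∀ {k l} {f : Fun k l} (D : GSR f) →
      (ι : ∀ {k l} {g : Fun k l} → Position D g → Position D₀ g) →
      (∀ {k l} {g : Fun k l} (p : Position D g) → rank (ι p) ≡ rank p) → Entry (size D) f
    rootEntry (constant c isConst eq) ι ι-rank =
      apply {n = 0} (con c) (s≤s z≤n) [] {h = λ ()} (λ ()) (λ ()) (subst (Vec _) (sym isConst) [])
        λ xs ys → trans (eq xs ys) (cong (con c) (sym (map-[] _ isConst)))
    rootEntry (construct c eq) ι ι-rank =
      apply {n = 0} (con c) (s≤s z≤n) [] {h = λ ()} (λ ()) (λ ()) (tabulate λ i → inj₁ (inj₂ i))
        λ { [] ys → trans (eq ys) (cong (con c)
          (sym (trans (map-tabulate _ _) (Vec.tabulate∘lookup ys)))) }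
    rootEntry {k = k} (projection j eq) ι ι-rank =
      copy (splitAt k j) λ xs ys → trans (eq xs ys) (Vec.lookup-splitAt k xs ys j)
    -- The two equations together make this predecessor the identity.
    rootEntry (predecessor₀ {f} c isConst eq eq′) ι ι-rank =
      copy (inj₂ zero) λ { [] (t ∷ []) → identity t }
      where
      identity : ∀ t → f [] (t ∷ []) ≡ t
      identity (con c′ ts) with c′ ≟ c
      ... | no c′≢c  = eq′ c′ ts c′≢c
      ... | yes refl =
        subst (λ ts → f [] (con c ts ∷ []) ≡ con c ts) (sym ([]-unique isConst ts)) eq
    rootEntry (predecessor {f} c j eq eq′) ι ι-rank = cases target correct
      where
      target : ∀ c′ → ⊤ ⊎ (Fin (arity c′) ⊎ Fin 0)
      target c′ with c′ ≟ c
      ... | yes refl = inj₂ (inj₁ j)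
      -- On other heads the argument is returned unchanged.
      ... | no _     = inj₁ tt
      correct : ∀ c′ ts ys → f [] (con c′ ts ∷ ys) ≡
                [ const (con c′ ts) , [ lookup ts , lookup ys ]′ ]′ (target c′)
      correct c′ ts [] with c′ ≟ c
      ... | yes refl = eq ts
      ... | no c′≢c  = eq′ c′ ts c′≢c
    rootEntry (conditional eq) ι ι-rank = cases (λ c → inj₂ (inj₂ c)) eq
    rootEntry (composition {h = h} {g = g} js D Ds eq) ι ι-rank =
      apply (def ⌈ ι (head root) ⌉)
        (s≤s (subst (_< _) (sym (ι-rank (head root))) (s≤s (ℕ.m≤m+n (size D) _))))
        js
        (λ i → ι (argument i root))
        (λ i → subst (_< _) (sym (ι-rank (argument i root)))
          (s≤s (ℕ.≤-trans (m≤∑ (λ i → size (Ds i)) i) (ℕ.m≤n+m _ (size D)))))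
        (tabulate inj₂)
        λ xs ys → trans (eq xs ys) (cong (h _) (sym (map-tabulate _ inj₂)))
    rootEntry (recursion Ds eq) ι ι-rank = recursive (λ c → ι (branch c root))
      (λ c → subst (_< _) (sym (ι-rank (branch c root))) (s≤s (m≤∑ (λ c → size (Ds c)) c))) eq

    -- Descending to a position composes the constructors along the path into the embedding that
    -- `rootEntry` takes at its end.
    entryAt : ∀ {k l} {f : Fun k l} {D : GSR f} →
      (ι : ∀ {k l} {g : Fun k l} → Position D g → Position D₀ g) →
      (∀ {k l} {g : Fun k l} (p : Position D g) → rank (ι p) ≡ rank p) →
      ∀ {k l} {g : Fun k l} (p : Position D g) → Entry (rank p) g
    entryAt ι ι-rank root           = rootEntry _ ι ι-rank
    entryAt ι ι-rank (head p)       = entryAt (λ q → ι (head q)) (λ q → ι-rank (head q)) p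
    entryAt ι ι-rank (argument i p) =
      entryAt (λ q → ι (argument i q)) (λ q → ι-rank (argument i q)) p
    entryAt ι ι-rank (branch c p)   = entryAt (λ q → ι (branch c q)) (λ q → ι-rank (branch c q)) p

    entry : ∀ {k l} {f : Fun k l} (p : Position D₀ f) → Entry (rank p) f
    entry = entryAt id (λ _ → refl)

mainTheorem9 : (𝒞 : Constructors) {k l : ℕ} (f : GeneralSafeRecursion.Fun 𝒞 k l) →
    GeneralSafeRecursion.GSR 𝒞 f →
    Σ[ S ∈ Signature 𝒞 ] Σ[ 𝒢 ∈ TermGraphs.GRS S ]
    TermGraphs.ConstructorGRS S 𝒢
    × TermGraphs.Computes S 𝒢 f
    × TermGraphs.PrecedenceTerminating S 𝒢
    × (Σ[ d ∈ ℕ ]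
    (∀ g → Signature.ar S g ≤ d)
    × (∀ R → TermGraphs.𝒢fin S 𝒢 R → TermGraphs.rhsSize S R ≤ d)
    × (∀ R → TermGraphs.𝒢inf S 𝒢 R → TermGraphs.InfiniteRuleConditions S d R))
mainTheorem9 𝒞 f D =
  -- The position `root` is the one at which `f` itself is derived, so its symbol computes `f`.
  S , 𝒢 , 𝒢-constructorGRS , 𝒢-computes ⌈ root ⌉ , 𝒢-precedenceTerminating ,
  d , ar≤d , rhsSize≤d , infinite-conditions
  where
  open Derivations 𝒞
  open System.Rules 𝒞 (Position D) rank (symbols-finite D) using (S)
  open SystemProperties 𝒞 (Position D) rank (symbols-finite D) (entry D)
  open Bounds (Position D) rank (symbols-finite D) (entry D)
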